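{- Let $\mathbf t=(t_1,t_2,t_3)\in\mathbb N^3$, $k=t_1+t_2+t_3+2$, and let $w\ge k$ be a constant integer. For each $n>w$ let $\mathbf J=(J_1,J_2,J_3)$ be a random vector with \[ \mathbb P(\mathbf J=\mathbf j)=\binom{j_1}{t_1}\binom{j_2}{t_2}\binom{j_3}{t_3}\Big/\binom nk\qquad\text{for }\mathbf j\in\mathbb N^3,\ j_1+j_2+j_3=n-2 . \] Let $(E_n)_{n\ge0}$ and $(T_n)_{n\ge0}$ be sequences of real numbers such that $E_n$, for $n\le w$, are given constants and \[ E_n=T_n+\sum_{j=0}^{n-2}E_j\sum_{r=1}^3\mathbb P(J_r=j)\qquad\text{for }n>w, \] and suppose $T_n=an+O(n^{1-\varepsilon})$ for constants $a$ and $\varepsilon>0$. Then \[ E_n\sim\frac{a}{\mathcal H}\,n\ln n\qquad(n\to\infty), \] where $\mathcal H=\sum_{r=1}^3\frac{t_r+1}{k+1}(H_{k+1}-H_{t_r+1})$ and $H_m=\sum_{i=1}^m 1/i$.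
   Context: In the paper, $E_n$ is the expected cost $\mathbb E[C_n]$ of Generalized Yaroslavskiy Quicksort, $T_n$ the expected partitioning cost $\mathbb E[T_n]$, and the base values for $n\le w$ are expected Insertionsort costs; here these are stated abstractly as numbers.
   Formalization: For a = 0 the literal claim E_n ∼ 0 fails (T_n = 0, E_n = n+1); the formal theorem states E_n ∼ (a/H) n ln n for a ≠ 0 (a apart from 0), and E_n = (a/H) n ln n + o(n ln n) for every a. -}

module Defs where

open import Data.Nat.Base as ℕ using (ℕ; zero; suc; z≤n; s≤s)
import Data.Nat.Properties as ℕ
open import Data.Nat.Combinatorics using (_C_; nCk+nC[k+1]≡[n+1]C[k+1])
import Data.Integer.Base as ℤ
import Data.Integer.Properties as ℤ
open import Data.Rational.Unnormalised.Base as ℚᵘ using (mkℚᵘ; *≡*; *≤*)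
import Data.Rational.Unnormalised.Properties as ℚᵘ
open import Data.Rational.Base as ℚ using (ℚ; 0ℚ; 1ℚ; ½)
import Data.Rational.Properties as ℚ
open import Data.Rational.Solver using (module +-*-Solver)
open import Data.Fin.Base using (Fin; zero; suc)
open import Data.List.Base as List using (List; []; _∷_; concatMap; filter; upTo)
open import Data.Vec.Base as Vec using (Vec; []; _∷_; lookup)
open import Data.Product.Base using (∃; _×_; _,_; proj₁; proj₂)
open import Data.Sum.Base using (_⊎_; inj₁; inj₂)
open import Relation.Unary using (Pred; Decidable)
open import Relation.Binary.PropositionalEquality
open import Level using (0ℓ)

IsCauchy : (ℕ → ℚ) → Set
IsCauchy x = ∀ ε → 0ℚ ℚ.< ε →
  ∃ λ N → ∀ m n → N ℕ.≤ m → N ℕ.≤ n → ℚ.∣ x m ℚ.- x n ∣ ℚ.≤ ε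

expTerm : ℚ → ℕ → ℚ
expTerm x zero    = 1ℚ
expTerm x (suc i) = expTerm x i ℚ.* (x ℚ.* (ℤ.+ 1 ℚ./ suc i))

-- ∑_{i ≤ n} xⁱ / i!
expSum : ℚ → ℕ → ℚ
expSum x zero    = expTerm x zero
expSum x (suc n) = expSum x n ℚ.+ expTerm x (suc n)

harmonic : ℕ → ℚ
harmonic zero    = 0ℚ
harmonic (suc m) = harmonic m ℚ.+ (ℤ.+ 1 ℚ./ suc m)

-- The right Riemann sum of ∫₁ⁿ dx/x with mesh 1/m, m = suc i, which is
-- ∑_{m < j ≤ n m} 1/j.
lnSum : ℕ → ℕ → ℚ
lnSum n i = harmonic (n ℕ.* suc i) ℚ.- harmonic (suc i)

module CauchyProofs where
  open import Data.Rational.Base hiding (ℚ; 0ℚ; 1ℚ; ½)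
  open ℚ.≤-Reasoning
  open +-*-Solver using (solve; _:=_; _:+_; _:*_; _:-_; :-_; con)

  private variable
    x y z u : ℕ → ℚ

  0<½ : 0ℚ < ½
  0<½ = ℚ.positive⁻¹ ½

  *-pos : ∀ {p q} → 0ℚ < p → 0ℚ < q → 0ℚ < p * q
  *-pos {p} {q} 0<p 0<q = subst (_< p * q) (ℚ.*-zeroʳ p)
    (ℚ.*-monoʳ-<-pos p {{ℚ.positive 0<p}} 0<q)

  *-mono : ∀ {p q r s} → 0ℚ ≤ p → 0ℚ ≤ s → p ≤ q → r ≤ s → p * r ≤ q * s
  *-mono {p} {q} {r} {s} 0≤p 0≤s p≤q r≤s = ℚ.≤-trans
    (ℚ.*-monoˡ-≤-nonNeg p {{ℚ.nonNegative 0≤p}} r≤s)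
    (ℚ.*-monoʳ-≤-nonNeg s {{ℚ.nonNegative 0≤s}} p≤q)

  *-nonneg : ∀ {p q} → 0ℚ ≤ p → 0ℚ ≤ q → 0ℚ ≤ p * q
  *-nonneg {p} {q} 0≤p 0≤q = subst (_≤ p * q) (ℚ.*-zeroʳ p)
    (ℚ.*-monoˡ-≤-nonNeg p {{ℚ.nonNegative 0≤p}} 0≤q)

  recip : ∀ p → 0ℚ < p → ∃ λ r → 0ℚ < r × p * r ≡ 1ℚ
  recip p 0<p = (1/ p) , ℚ.positive⁻¹ (1/ p) {{ℚ.1/pos⇒pos p}} , ℚ.*-inverseʳ p
    where instance
      _ : Positive p
      _ = ℚ.positive 0<p
      _ : NonZero p
      _ = ℚ.pos⇒nonZero p

  p≤q⇒0≤q-p : ∀ {p q} → p ≤ q → 0ℚ ≤ q - p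
  p≤q⇒0≤q-p {p} {q} p≤q = begin
    0ℚ     ≡⟨ ℚ.+-inverseʳ p ⟨
    p - p  ≤⟨ ℚ.+-monoˡ-≤ (- p) p≤q ⟩
    q - p  ∎

  0≤q-p⇒p≤q : ∀ {p q} → 0ℚ ≤ q - p → p ≤ q
  0≤q-p⇒p≤q {p} {q} h = begin
    p            ≡⟨ ℚ.+-identityˡ p ⟨
    0ℚ + p       ≤⟨ ℚ.+-monoˡ-≤ p h ⟩
    (q - p) + p  ≡⟨ solve 2 (λ p q → (q :- p) :+ p := q) refl p q ⟩
    q            ∎

  swap-∣∣ : ∀ p q → ∣ p - q ∣ ≡ ∣ q - p ∣
  swap-∣∣ p q = trans (sym (ℚ.∣-p∣≡∣p∣ (p - q)))
    (cong ∣_∣ (solve 2 (λ p q → :- (p :- q) := q :- p) refl p q))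

  p≤∣p∣ : ∀ p → p ≤ ∣ p ∣
  p≤∣p∣ p with ℚ.≤-total 0ℚ p
  ... | inj₁ 0≤p = ℚ.≤-reflexive (sym (ℚ.0≤p⇒∣p∣≡p 0≤p))
  ... | inj₂ p≤0 = ℚ.≤-trans p≤0 (ℚ.0≤∣p∣ p)

  ∣∣-≤ : ∀ {p q} → p ≤ q → - p ≤ q → ∣ p ∣ ≤ q
  ∣∣-≤ {p} {q} h h′ with ℚ.∣p∣≡p∨∣p∣≡-p p
  ... | inj₁ e = subst (_≤ q) (sym e) h
  ... | inj₂ e = subst (_≤ q) (sym e) h′

  ∣∣p∣-∣q∣∣≤∣p-q∣ : ∀ p q → ∣ ∣ p ∣ - ∣ q ∣ ∣ ≤ ∣ p - q ∣
  ∣∣p∣-∣q∣∣≤∣p-q∣ p q = ∣∣-≤ (half p q)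
    (subst₂ _≤_ (solve 2 (λ p q → q :- p := :- (p :- q)) refl ∣ p ∣ ∣ q ∣)
      (swap-∣∣ q p) (half q p))
    where
    half : ∀ p q → ∣ p ∣ - ∣ q ∣ ≤ ∣ p - q ∣
    half p q = begin
      ∣ p ∣ - ∣ q ∣              ≡⟨ cong (λ r → ∣ r ∣ - ∣ q ∣)
                                   (solve 2 (λ p q → p := (p :- q) :+ q) refl p q) ⟩
      ∣ (p - q) + q ∣ - ∣ q ∣    ≤⟨ ℚ.+-monoˡ-≤ (- ∣ q ∣) (ℚ.∣p+q∣≤∣p∣+∣q∣ (p - q) q) ⟩
      ∣ p - q ∣ + ∣ q ∣ - ∣ q ∣  ≡⟨ solve 2 (λ a b → a :+ b :- b := a) refl ∣ p - q ∣ ∣ q ∣ ⟩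
      ∣ p - q ∣                  ∎

  cauchy-lipschitz₂ : ∀ A B N₀ → 0ℚ < A → 0ℚ < B → IsCauchy x → IsCauchy y →
    (∀ m n → N₀ ℕ.≤ m → N₀ ℕ.≤ n →
      ∣ z m - z n ∣ ≤ A * ∣ x m - x n ∣ + B * ∣ y m - y n ∣) → IsCauchy z
  cauchy-lipschitz₂ {x} {y} {z} A B N₀ 0<A 0<B cx cy bound ε 0<ε
    with recip A 0<A | recip B 0<B
  ... | A⁻¹ , 0<A⁻¹ , A*A⁻¹ | B⁻¹ , 0<B⁻¹ , B*B⁻¹
    with cx (½ * ε * A⁻¹) (*-pos (*-pos 0<½ 0<ε) 0<A⁻¹)
       | cy (½ * ε * B⁻¹) (*-pos (*-pos 0<½ 0<ε) 0<B⁻¹)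
  ... | N₁ , h₁ | N₂ , h₂ = N₀ ℕ.⊔ (N₁ ℕ.⊔ N₂) , λ m n N≤m N≤n → begin
      ∣ z m - z n ∣
        ≤⟨ bound m n (le₀ N≤m) (le₀ N≤n) ⟩
      A * ∣ x m - x n ∣ + B * ∣ y m - y n ∣
        ≤⟨ ℚ.+-mono-≤
             (ℚ.*-monoˡ-≤-nonNeg A {{ℚ.pos⇒nonNeg A {{ℚ.positive 0<A}}}}
               (h₁ m n (le₁ N≤m) (le₁ N≤n)))
             (ℚ.*-monoˡ-≤-nonNeg B {{ℚ.pos⇒nonNeg B {{ℚ.positive 0<B}}}}
               (h₂ m n (le₂ N≤m) (le₂ N≤n))) ⟩
      A * (½ * ε * A⁻¹) + B * (½ * ε * B⁻¹)
        ≡⟨ solve 5 (λ a b e a′ b′ → a :* (con ½ :* e :* a′) :+ b :* (con ½ :* e :* b′)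
                  := con ½ :* e :* (a :* a′) :+ con ½ :* e :* (b :* b′)) refl A B ε A⁻¹ B⁻¹ ⟩
      ½ * ε * (A * A⁻¹) + ½ * ε * (B * B⁻¹)
        ≡⟨ cong₂ (λ p q → ½ * ε * p + ½ * ε * q) A*A⁻¹ B*B⁻¹ ⟩
      ½ * ε * 1ℚ + ½ * ε * 1ℚ
        ≡⟨ solve 1 (λ e → con ½ :* e :* con 1ℚ :+ con ½ :* e :* con 1ℚ := e) refl ε ⟩
      ε ∎
    where
    le₀ : ∀ {m} → N₀ ℕ.⊔ (N₁ ℕ.⊔ N₂) ℕ.≤ m → N₀ ℕ.≤ m
    le₀ = ℕ.m⊔n≤o⇒m≤o N₀ (N₁ ℕ.⊔ N₂)
    le₁ : ∀ {m} → N₀ ℕ.⊔ (N₁ ℕ.⊔ N₂) ℕ.≤ m → N₁ ℕ.≤ m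
    le₁ h = ℕ.m⊔n≤o⇒m≤o N₁ N₂ (ℕ.m⊔n≤o⇒n≤o N₀ (N₁ ℕ.⊔ N₂) h)
    le₂ : ∀ {m} → N₀ ℕ.⊔ (N₁ ℕ.⊔ N₂) ℕ.≤ m → N₂ ℕ.≤ m
    le₂ h = ℕ.m⊔n≤o⇒n≤o N₁ N₂ (ℕ.m⊔n≤o⇒n≤o N₀ (N₁ ℕ.⊔ N₂) h)

  0<1 : 0ℚ < 1ℚ
  0<1 = ℚ.positive⁻¹ 1ℚ

  eventually-bounded : IsCauchy x →
    ∃ λ B → ∃ λ N → 0ℚ < B × (∀ n → N ℕ.≤ n → ∣ x n ∣ ≤ B)
  eventually-bounded {x} cx with cx 1ℚ 0<1
  ... | N , h = 1ℚ + ∣ x N ∣ , N , ℚ.+-mono-<-≤ 0<1 (ℚ.0≤∣p∣ (x N)) , λ n N≤n → begin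
      ∣ x n ∣                  ≡⟨ cong ∣_∣ (solve 2 (λ p q → p := (p :- q) :+ q) refl (x n) (x N)) ⟩
      ∣ (x n - x N) + x N ∣    ≤⟨ ℚ.∣p+q∣≤∣p∣+∣q∣ (x n - x N) (x N) ⟩
      ∣ x n - x N ∣ + ∣ x N ∣  ≤⟨ ℚ.+-monoˡ-≤ ∣ x N ∣ (h n N N≤n ℕ.≤-refl) ⟩
      1ℚ + ∣ x N ∣             ∎

  abstract
    cauchy-const : ∀ q → IsCauchy (λ _ → q)
    cauchy-const q ε 0<ε = 0 , λ _ _ _ _ → subst (λ r → ∣ r ∣ ≤ ε) (sym (ℚ.+-inverseʳ q)) (ℚ.<⇒≤ 0<ε)

    cauchy-+ : IsCauchy x → IsCauchy y → IsCauchy (λ n → x n + y n)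
    cauchy-+ {x} {y} cx cy = cauchy-lipschitz₂ {x} {y} {λ n → x n + y n} 1ℚ 1ℚ 0 0<1 0<1 cx cy λ m n _ _ → begin
      ∣ (x m + y m) - (x n + y n) ∣
        ≡⟨ cong ∣_∣ (solve 4 (λ a b c d → (a :+ b) :- (c :+ d) := (a :- c) :+ (b :- d))
             refl (x m) (y m) (x n) (y n)) ⟩
      ∣ (x m - x n) + (y m - y n) ∣
        ≤⟨ ℚ.∣p+q∣≤∣p∣+∣q∣ (x m - x n) (y m - y n) ⟩
      ∣ x m - x n ∣ + ∣ y m - y n ∣
        ≡⟨ cong₂ _+_ (ℚ.*-identityˡ ∣ x m - x n ∣) (ℚ.*-identityˡ ∣ y m - y n ∣) ⟨
      1ℚ * ∣ x m - x n ∣ + 1ℚ * ∣ y m - y n ∣ ∎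

    cauchy-neg : IsCauchy x → IsCauchy (λ n → - x n)
    cauchy-neg {x} cx ε 0<ε with cx ε 0<ε
    ... | N , h = N , λ m n N≤m N≤n → subst (_≤ ε)
      (trans (swap-∣∣ (x m) (x n))
        (cong ∣_∣ (solve 2 (λ a b → b :- a := :- a :- (:- b)) refl (x m) (x n))))
      (h m n N≤m N≤n)

    cauchy-∣∣ : IsCauchy x → IsCauchy (λ n → ∣ x n ∣)
    cauchy-∣∣ {x} cx ε 0<ε with cx ε 0<ε
    ... | N , h = N , λ m n N≤m N≤n → ℚ.≤-trans (∣∣p∣-∣q∣∣≤∣p-q∣ (x m) (x n)) (h m n N≤m N≤n)

    cauchy-* : IsCauchy x → IsCauchy y → IsCauchy (λ n → x n * y n)
    cauchy-* {x} {y} cx cy =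
      let A , N , 0<A , ≤A = eventually-bounded {x} cx
          B , M , 0<B , ≤B = eventually-bounded {y} cy
      in cauchy-lipschitz₂ {x} {y} {λ n → x n * y n} B A (N ℕ.⊔ M) 0<B 0<A cx cy λ m n N≤m N≤n → begin
        ∣ x m * y m - x n * y n ∣
          ≡⟨ cong ∣_∣ (solve 4 (λ a b c d → a :* b :- c :* d := d :* (a :- c) :+ a :* (b :- d))
               refl (x m) (y m) (x n) (y n)) ⟩
        ∣ y n * (x m - x n) + x m * (y m - y n) ∣
          ≤⟨ ℚ.∣p+q∣≤∣p∣+∣q∣ (y n * (x m - x n)) (x m * (y m - y n)) ⟩
        ∣ y n * (x m - x n) ∣ + ∣ x m * (y m - y n) ∣
          ≡⟨ cong₂ _+_ (ℚ.∣p*q∣≡∣p∣*∣q∣ (y n) (x m - x n)) (ℚ.∣p*q∣≡∣p∣*∣q∣ (x m) (y m - y n)) ⟩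
        ∣ y n ∣ * ∣ x m - x n ∣ + ∣ x m ∣ * ∣ y m - y n ∣
          ≤⟨ ℚ.+-mono-≤
               (ℚ.*-monoʳ-≤-nonNeg ∣ x m - x n ∣ {{ℚ.∣-∣-nonNeg (x m - x n)}}
                 (≤B n (ℕ.m⊔n≤o⇒n≤o N M N≤n)))
               (ℚ.*-monoʳ-≤-nonNeg ∣ y m - y n ∣ {{ℚ.∣-∣-nonNeg (y m - y n)}}
                 (≤A m (ℕ.m⊔n≤o⇒m≤o N M N≤m))) ⟩
        B * ∣ x m - x n ∣ + A * ∣ y m - y n ∣ ∎

  -- If x increases, x + u decreases and u → 0 then x converges.
  cauchy-squeeze : ∀ M → (∀ n → M ℕ.≤ n → x n ≤ x (suc n)) →
    (∀ n → M ℕ.≤ n → x (suc n) + u (suc n) ≤ x n + u n) →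
    (∀ n → 0ℚ ≤ u n) →
    (∀ ε → 0ℚ < ε → ∃ λ N → ∀ n → N ℕ.≤ n → u n ≤ ε) → IsCauchy x
  cauchy-squeeze {x} {u} M inc dec 0≤u u→0 ε 0<ε with u→0 ε 0<ε
  ... | N , h = M ℕ.⊔ N , λ m n N≤m N≤n → both m n N≤m N≤n (ℕ.≤-total m n)
    where
    inc* : ∀ m j → M ℕ.≤ m → x m ≤ x (j ℕ.+ m)
    inc* m zero M≤m = ℚ.≤-refl
    inc* m (suc j) M≤m = ℚ.≤-trans (inc* m j M≤m) (inc (j ℕ.+ m) (ℕ.≤-trans M≤m (ℕ.m≤n+m m j)))

    dec* : ∀ m j → M ℕ.≤ m → x (j ℕ.+ m) + u (j ℕ.+ m) ≤ x m + u m
    dec* m zero M≤m = ℚ.≤-refl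
    dec* m (suc j) M≤m = ℚ.≤-trans (dec (j ℕ.+ m) (ℕ.≤-trans M≤m (ℕ.m≤n+m m j))) (dec* m j M≤m)

    close : ∀ m j → M ℕ.⊔ N ℕ.≤ m → ∣ x (j ℕ.+ m) - x m ∣ ≤ ε
    close m j K≤m = begin
      ∣ x (j ℕ.+ m) - x m ∣
        ≡⟨ ℚ.0≤p⇒∣p∣≡p (p≤q⇒0≤q-p (inc* m j M≤m)) ⟩
      x (j ℕ.+ m) - x m
        ≡⟨ cong (_- x m) (ℚ.+-identityʳ (x (j ℕ.+ m))) ⟨
      x (j ℕ.+ m) + 0ℚ - x m
        ≤⟨ ℚ.+-monoˡ-≤ (- x m) (ℚ.+-monoʳ-≤ (x (j ℕ.+ m)) (0≤u (j ℕ.+ m))) ⟩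
      x (j ℕ.+ m) + u (j ℕ.+ m) - x m
        ≤⟨ ℚ.+-monoˡ-≤ (- x m) (dec* m j M≤m) ⟩
      x m + u m - x m
        ≡⟨ solve 2 (λ a b → a :+ b :- a := b) refl (x m) (u m) ⟩
      u m
        ≤⟨ h m (ℕ.m⊔n≤o⇒n≤o M N K≤m) ⟩
      ε ∎
      where
      M≤m : M ℕ.≤ m
      M≤m = ℕ.m⊔n≤o⇒m≤o M N K≤m

    both : ∀ m n → M ℕ.⊔ N ℕ.≤ m → M ℕ.⊔ N ℕ.≤ n → m ℕ.≤ n ⊎ n ℕ.≤ m → ∣ x m - x n ∣ ≤ ε
    both m n K≤m K≤n (inj₁ m≤n) = subst (_≤ ε)
      (trans (cong (λ i → ∣ x i - x m ∣) (ℕ.m∸n+n≡m m≤n)) (swap-∣∣ (x n) (x m)))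
      (close m (n ℕ.∸ m) K≤m)
    both m n K≤m K≤n (inj₂ n≤m) = subst (_≤ ε)
      (cong (λ i → ∣ x i - x n ∣) (ℕ.m∸n+n≡m n≤m))
      (close n (m ℕ.∸ n) K≤n)

  inv : ℕ → ℚ
  inv i = ℤ.+ 1 / suc i

  fromℕ : ℕ → ℚ
  fromℕ n = ℤ.+ n / 1

  fromℚᵘ-homo-+ : ∀ p q → fromℚᵘ p + fromℚᵘ q ≡ fromℚᵘ (p ℚᵘ.+ q)
  fromℚᵘ-homo-+ p q = ℚ.toℚᵘ-injective (ℚᵘ.≃-trans (ℚ.toℚᵘ-homo-+ (fromℚᵘ p) (fromℚᵘ q))
    (ℚᵘ.≃-trans (ℚᵘ.+-cong (ℚ.toℚᵘ-fromℚᵘ p) (ℚ.toℚᵘ-fromℚᵘ q))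
      (ℚᵘ.≃-sym (ℚ.toℚᵘ-fromℚᵘ (p ℚᵘ.+ q)))))

  fromℚᵘ-homo-* : ∀ p q → fromℚᵘ p * fromℚᵘ q ≡ fromℚᵘ (p ℚᵘ.* q)
  fromℚᵘ-homo-* p q = ℚ.toℚᵘ-injective (ℚᵘ.≃-trans (ℚ.toℚᵘ-homo-* (fromℚᵘ p) (fromℚᵘ q))
    (ℚᵘ.≃-trans (ℚᵘ.*-cong (ℚ.toℚᵘ-fromℚᵘ p) (ℚ.toℚᵘ-fromℚᵘ q))
      (ℚᵘ.≃-sym (ℚ.toℚᵘ-fromℚᵘ (p ℚᵘ.* q)))))

  fromℚᵘ-mono-≤ : ∀ {p q} → p ℚᵘ.≤ q → fromℚᵘ p ≤ fromℚᵘ q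
  fromℚᵘ-mono-≤ {p} {q} p≤q = ℚ.toℚᵘ-cancel-≤
    (ℚᵘ.≤-respˡ-≃ (ℚᵘ.≃-sym (ℚ.toℚᵘ-fromℚᵘ p))
      (ℚᵘ.≤-respʳ-≃ (ℚᵘ.≃-sym (ℚ.toℚᵘ-fromℚᵘ q)) p≤q))

  fromℕ-+ : ∀ m n → fromℕ (m ℕ.+ n) ≡ fromℕ m + fromℕ n
  fromℕ-+ m n = sym (trans (fromℚᵘ-homo-+ (mkℚᵘ (ℤ.+ m) 0) (mkℚᵘ (ℤ.+ n) 0))
    (cong (_/ 1) (cong₂ ℤ._+_ (ℤ.*-identityʳ (ℤ.+ m)) (ℤ.*-identityʳ (ℤ.+ n)))))

  fromℕ-* : ∀ m n → fromℕ (m ℕ.* n) ≡ fromℕ m * fromℕ n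
  fromℕ-* m n = sym (trans (fromℚᵘ-homo-* (mkℚᵘ (ℤ.+ m) 0) (mkℚᵘ (ℤ.+ n) 0))
    (cong (_/ 1) (sym (ℤ.pos-* m n))))

  fromℕ-mono : ∀ {m n} → m ℕ.≤ n → fromℕ m ≤ fromℕ n
  fromℕ-mono {m} {n} m≤n = fromℚᵘ-mono-≤ {mkℚᵘ (ℤ.+ m) 0} {mkℚᵘ (ℤ.+ n) 0} (*≤* (ℤ.*-monoʳ-≤-nonNeg (ℤ.+ 1) (ℤ.+≤+ m≤n)))

  0≤fromℕ : ∀ n → 0ℚ ≤ fromℕ n
  0≤fromℕ n = fromℕ-mono {0} {n} z≤n

  fromℕ-inv : ∀ i → fromℕ (suc i) * inv i ≡ 1ℚ
  fromℕ-inv i = trans (fromℚᵘ-homo-* (mkℚᵘ (ℤ.+ suc i) 0) (mkℚᵘ (ℤ.+ 1) i))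
    (ℚ.fromℚᵘ-cong {mkℚᵘ (ℤ.+ suc i) 0 ℚᵘ.* mkℚᵘ (ℤ.+ 1) i} {mkℚᵘ (ℤ.+ 1) 0} (*≡* (trans (ℤ.*-identityʳ _)
      (trans (ℤ.*-identityʳ _) (sym (trans (ℤ.*-identityˡ _)
        (cong (λ k → ℤ.+ suc k) (ℕ.+-identityʳ i))))))))

  inv-pos : ∀ i → 0ℚ < inv i
  inv-pos i = ℚ.positive⁻¹ (inv i) {{ℚ.normalize-pos 1 (suc i)}}

  0≤inv : ∀ i → 0ℚ ≤ inv i
  0≤inv i = ℚ.<⇒≤ (inv-pos i)

  inv-anti : ∀ {i j} → i ℕ.≤ j → inv j ≤ inv i
  inv-anti {i} {j} i≤j = fromℚᵘ-mono-≤ {mkℚᵘ (ℤ.+ 1) j} {mkℚᵘ (ℤ.+ 1) i} (*≤* (ℤ.*-monoˡ-≤-nonNeg (ℤ.+ 1) (ℤ.+≤+ (s≤s i≤j))))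

  fromℕ-pos : ∀ i → 0ℚ < fromℕ (suc i)
  fromℕ-pos i = ℚ.positive⁻¹ (fromℕ (suc i)) {{ℚ.normalize-pos (suc i) 1}}

  archimedean : ∀ p → ∃ λ n → p ≤ fromℕ n
  archimedean p@(mkℚ n d _) = ℤ.∣ n ∣ , subst (_≤ fromℕ ℤ.∣ n ∣) (ℚ.fromℚᵘ-toℚᵘ p)
    (fromℚᵘ-mono-≤ {toℚᵘ p} {mkℚᵘ (ℤ.+ ℤ.∣ n ∣) 0}
      (*≤* (subst (ℤ._≤ ℤ.+ ℤ.∣ n ∣ ℤ.* ℤ.+ suc d) (sym (ℤ.*-identityʳ n)) (lem n))))
    where
    lem : ∀ n → n ℤ.≤ ℤ.+ ℤ.∣ n ∣ ℤ.* ℤ.+ suc d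
    lem (ℤ.+ n) = subst (ℤ.+ n ℤ.≤_) (ℤ.pos-* n (suc d)) (ℤ.+≤+ (ℕ.m≤m*n n (suc d)))
    lem ℤ.-[1+ n ] = subst (ℤ.-[1+ n ] ℤ.≤_) (ℤ.pos-* (suc n) (suc d)) ℤ.-≤+

  -- c/n → 0
  inv→0 : ∀ c → 0ℚ ≤ c → ∀ ε → 0ℚ < ε → ∃ λ N → ∀ n → N ℕ.≤ n → c * inv n ≤ ε
  inv→0 c 0≤c ε 0<ε =
    let ε⁻¹ , 0<ε⁻¹ , ε*ε⁻¹ = recip ε 0<ε
        N , h               = archimedean (c * ε⁻¹)
    in N , λ n N≤n → begin
    c * inv n
      ≡⟨ cong (_* inv n) (trans (cong (c *_) ε*ε⁻¹) (ℚ.*-identityʳ c)) ⟨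
    c * (ε * ε⁻¹) * inv n
      ≡⟨ solve 4 (λ c e e′ i → c :* (e :* e′) :* i := e :* (c :* e′ :* i)) refl c ε ε⁻¹ (inv n) ⟩
    ε * (c * ε⁻¹ * inv n)
      ≤⟨ ℚ.*-monoˡ-≤-nonNeg ε {{ℚ.nonNegative (ℚ.<⇒≤ 0<ε)}}
           (ℚ.*-monoʳ-≤-nonNeg (inv n) {{ℚ.nonNegative (0≤inv n)}}
             (ℚ.≤-trans h (fromℕ-mono (ℕ.≤-trans N≤n (ℕ.n≤1+n n))))) ⟩
    ε * (fromℕ (suc n) * inv n)
      ≡⟨ trans (cong (ε *_) (fromℕ-inv n)) (ℚ.*-identityʳ ε) ⟩
    ε ∎

  harmonic-lower : ∀ p j q → p ℕ.+ j ℕ.≤ suc q →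
    harmonic p + fromℕ j * inv q ≤ harmonic (p ℕ.+ j)
  harmonic-lower p zero q _ = ℚ.≤-reflexive (trans (cong (harmonic p +_) (ℚ.*-zeroˡ (inv q)))
    (trans (ℚ.+-identityʳ _) (cong harmonic (sym (ℕ.+-identityʳ p)))))
  harmonic-lower p (suc j) q h rewrite ℕ.+-suc p j = begin
    harmonic p + fromℕ (suc j) * inv q
      ≡⟨ cong (λ r → harmonic p + r * inv q) (fromℕ-+ 1 j) ⟩
    harmonic p + (1ℚ + fromℕ j) * inv q
      ≡⟨ solve 3 (λ a b c → a :+ (con 1ℚ :+ b) :* c := (a :+ b :* c) :+ c) refl
           (harmonic p) (fromℕ j) (inv q) ⟩
    (harmonic p + fromℕ j * inv q) + inv q
      ≤⟨ ℚ.+-mono-≤ (harmonic-lower p j q (ℕ.≤-trans (ℕ.n≤1+n _) h)) (inv-anti (ℕ.s≤s⁻¹ h)) ⟩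
    harmonic (p ℕ.+ j) + inv (p ℕ.+ j) ∎

  harmonic-upper : ∀ p j q → suc q ℕ.≤ suc p →
    harmonic (p ℕ.+ j) ≤ harmonic p + fromℕ j * inv q
  harmonic-upper p zero q _ = ℚ.≤-reflexive (sym (trans (cong (harmonic p +_) (ℚ.*-zeroˡ (inv q)))
    (trans (ℚ.+-identityʳ _) (cong harmonic (sym (ℕ.+-identityʳ p))))))
  harmonic-upper p (suc j) q h rewrite ℕ.+-suc p j = begin
    harmonic (p ℕ.+ j) + inv (p ℕ.+ j)
      ≤⟨ ℚ.+-mono-≤ (harmonic-upper p j q h)
           (inv-anti (ℕ.≤-trans (ℕ.s≤s⁻¹ h) (ℕ.m≤m+n p j))) ⟩
    (harmonic p + fromℕ j * inv q) + inv q
      ≡⟨ solve 3 (λ a b c → a :+ (con 1ℚ :+ b) :* c := (a :+ b :* c) :+ c) refl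
           (harmonic p) (fromℕ j) (inv q) ⟨
    harmonic p + (1ℚ + fromℕ j) * inv q
      ≡⟨ cong (λ r → harmonic p + r * inv q) (fromℕ-+ 1 j) ⟨
    harmonic p + fromℕ (suc j) * inv q ∎

  -- n · 1/(n (i+1)) = 1/(i+1)
  scale-inv : ∀ n i q → suc q ≡ suc n ℕ.* suc i → fromℕ (suc n) * inv q ≡ inv i
  scale-inv n i q e = begin-equality
    fromℕ (suc n) * inv q
      ≡⟨ trans (cong (fromℕ (suc n) * inv q *_) (fromℕ-inv i)) (ℚ.*-identityʳ _) ⟨
    fromℕ (suc n) * inv q * (fromℕ (suc i) * inv i)
      ≡⟨ solve 4 (λ a b c d → a :* b :* (c :* d) := a :* c :* b :* d) refl
           (fromℕ (suc n)) (inv q) (fromℕ (suc i)) (inv i) ⟩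
    fromℕ (suc n) * fromℕ (suc i) * inv q * inv i
      ≡⟨ cong (λ r → r * inv q * inv i) (trans (sym (fromℕ-* (suc n) (suc i))) (cong fromℕ (sym e))) ⟩
    fromℕ (suc q) * inv q * inv i
      ≡⟨ trans (cong (_* inv i) (fromℕ-inv q)) (ℚ.*-identityˡ (inv i)) ⟩
    inv i ∎

  abstract
    cauchy-ln : ∀ n → IsCauchy (lnSum (suc n))
    cauchy-ln n = cauchy-squeeze {x = lnSum (suc n)} {u = inv} 0 (λ i _ → inc i) (λ i _ → dec i) 0≤inv
      λ ε 0<ε → let N , h = inv→0 1ℚ (ℚ.<⇒≤ 0<1) ε 0<ε in
        N , λ m N≤m → subst (_≤ ε) (ℚ.*-identityˡ (inv m)) (h m N≤m)
      where
      step : ∀ i → suc n ℕ.* suc (suc i) ≡ suc n ℕ.* suc i ℕ.+ suc n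
      step i = trans (ℕ.*-suc (suc n) (suc i)) (ℕ.+-comm (suc n) (suc n ℕ.* suc i))

      inc : ∀ i → lnSum (suc n) i ≤ lnSum (suc n) (suc i)
      inc i = begin
        harmonic (suc n ℕ.* suc i) - harmonic (suc i)
          ≡⟨ solve 3 (λ a b c → a :- b := a :+ c :- (b :+ c)) refl
               (harmonic (suc n ℕ.* suc i)) (harmonic (suc i)) (inv (suc i)) ⟩
        harmonic (suc n ℕ.* suc i) + inv (suc i) - harmonic (suc (suc i))
          ≡⟨ cong (λ r → harmonic (suc n ℕ.* suc i) + r - harmonic (suc (suc i)))
               (scale-inv n (suc i) (suc i ℕ.+ n ℕ.* suc (suc i)) refl) ⟨
        harmonic (suc n ℕ.* suc i) + fromℕ (suc n) * inv (suc i ℕ.+ n ℕ.* suc (suc i))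
          - harmonic (suc (suc i))
          ≤⟨ ℚ.+-monoˡ-≤ (- harmonic (suc (suc i)))
               (harmonic-lower (suc n ℕ.* suc i) (suc n) (suc i ℕ.+ n ℕ.* suc (suc i))
                 (ℕ.≤-reflexive (sym (step i)))) ⟩
        harmonic (suc n ℕ.* suc i ℕ.+ suc n) - harmonic (suc (suc i))
          ≡⟨ cong (λ m → harmonic m - harmonic (suc (suc i))) (step i) ⟨
        lnSum (suc n) (suc i) ∎

      dec : ∀ i → lnSum (suc n) (suc i) + inv (suc i) ≤ lnSum (suc n) i + inv i
      dec i = begin
        harmonic (suc n ℕ.* suc (suc i)) - (harmonic (suc i) + inv (suc i)) + inv (suc i)
          ≡⟨ solve 3 (λ a b c → a :- (b :+ c) :+ c := a :- b) refl
               (harmonic (suc n ℕ.* suc (suc i))) (harmonic (suc i)) (inv (suc i)) ⟩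
        harmonic (suc n ℕ.* suc (suc i)) - harmonic (suc i)
          ≡⟨ cong (λ m → harmonic m - harmonic (suc i)) (step i) ⟩
        harmonic (suc n ℕ.* suc i ℕ.+ suc n) - harmonic (suc i)
          ≤⟨ ℚ.+-monoˡ-≤ (- harmonic (suc i))
               (harmonic-upper (suc n ℕ.* suc i) (suc n) (i ℕ.+ n ℕ.* suc i) (ℕ.n≤1+n _)) ⟩
        harmonic (suc n ℕ.* suc i) + fromℕ (suc n) * inv (i ℕ.+ n ℕ.* suc i) - harmonic (suc i)
          ≡⟨ cong (λ r → harmonic (suc n ℕ.* suc i) + r - harmonic (suc i))
               (scale-inv n i (i ℕ.+ n ℕ.* suc i) refl) ⟩
        harmonic (suc n ℕ.* suc i) + inv i - harmonic (suc i)
          ≡⟨ solve 3 (λ a b c → a :+ b :- c := a :- c :+ b) refl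
               (harmonic (suc n ℕ.* suc i)) (inv i) (harmonic (suc i)) ⟩
        lnSum (suc n) i + inv i ∎

  module Exp (B : ℚ) (0≤B : 0ℚ ≤ B) where

    0≤term : ∀ i → 0ℚ ≤ expTerm B i
    0≤term zero    = ℚ.<⇒≤ 0<1
    0≤term (suc i) = *-nonneg (0≤term i) (*-nonneg 0≤B (0≤inv i))

    ∣term∣≤ : ∀ x → ∣ x ∣ ≤ B → ∀ i → ∣ expTerm x i ∣ ≤ expTerm B i
    ∣term∣≤ x x≤B zero    = ℚ.≤-refl
    ∣term∣≤ x x≤B (suc i) = begin
      ∣ expTerm x i * (x * inv i) ∣      ≡⟨ ℚ.∣p*q∣≡∣p∣*∣q∣ (expTerm x i) (x * inv i) ⟩
      ∣ expTerm x i ∣ * ∣ x * inv i ∣    ≡⟨ cong (∣ expTerm x i ∣ *_) (trans (ℚ.∣p*q∣≡∣p∣*∣q∣ x (inv i))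
                                              (cong (∣ x ∣ *_) (ℚ.0≤p⇒∣p∣≡p (0≤inv i)))) ⟩
      ∣ expTerm x i ∣ * (∣ x ∣ * inv i)  ≤⟨ *-mono (ℚ.0≤∣p∣ _) (*-nonneg 0≤B (0≤inv i)) (∣term∣≤ x x≤B i)
                                             (ℚ.*-monoʳ-≤-nonNeg (inv i) {{ℚ.nonNegative (0≤inv i)}} x≤B) ⟩
      expTerm B i * (B * inv i)          ∎

    term-step : ∀ i → expTerm B i * B ≡ fromℕ (suc i) * expTerm B (suc i)
    term-step i = begin-equality
      expTerm B i * B
        ≡⟨ trans (cong (expTerm B i * B *_) (fromℕ-inv i)) (ℚ.*-identityʳ _) ⟨
      expTerm B i * B * (fromℕ (suc i) * inv i)
        ≡⟨ solve 4 (λ t b f v → t :* b :* (f :* v) := f :* (t :* (b :* v))) refl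
             (expTerm B i) B (fromℕ (suc i)) (inv i) ⟩
      fromℕ (suc i) * expTerm B (suc i) ∎

    term-lipschitz : ∀ x y → ∣ x ∣ ≤ B → ∣ y ∣ ≤ B → ∀ i →
      ∣ expTerm x (suc i) - expTerm y (suc i) ∣ ≤ ∣ x - y ∣ * expTerm B i
    term-lipschitz x y x≤B y≤B zero = ℚ.≤-reflexive (trans
      (cong ∣_∣ (solve 2 (λ x y → con 1ℚ :* (x :* con 1ℚ) :- con 1ℚ :* (y :* con 1ℚ) := x :- y) refl x y))
      (sym (ℚ.*-identityʳ _)))
    term-lipschitz x y x≤B y≤B (suc i) = begin
      ∣ s * (x * v) - t * (y * v) ∣
        ≡⟨ cong ∣_∣ (solve 5 (λ s t x y v → s :* (x :* v) :- t :* (y :* v)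
             := (s :* (x :- y) :+ (s :- t) :* y) :* v) refl s t x y v) ⟩
      ∣ (s * (x - y) + (s - t) * y) * v ∣
        ≡⟨ trans (ℚ.∣p*q∣≡∣p∣*∣q∣ (s * (x - y) + (s - t) * y) v)
             (cong (∣ s * (x - y) + (s - t) * y ∣ *_) (ℚ.0≤p⇒∣p∣≡p (0≤inv (suc i)))) ⟩
      ∣ s * (x - y) + (s - t) * y ∣ * v
        ≤⟨ ℚ.*-monoʳ-≤-nonNeg v {{ℚ.nonNegative (0≤inv (suc i))}} (begin
             ∣ s * (x - y) + (s - t) * y ∣
               ≤⟨ ℚ.∣p+q∣≤∣p∣+∣q∣ (s * (x - y)) ((s - t) * y) ⟩
             ∣ s * (x - y) ∣ + ∣ (s - t) * y ∣
               ≡⟨ cong₂ _+_ (ℚ.∣p*q∣≡∣p∣*∣q∣ s (x - y)) (ℚ.∣p*q∣≡∣p∣*∣q∣ (s - t) y) ⟩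
             ∣ s ∣ * d + ∣ s - t ∣ * ∣ y ∣
               ≤⟨ ℚ.+-mono-≤
                    (ℚ.*-monoʳ-≤-nonNeg d {{ℚ.∣-∣-nonNeg (x - y)}} (∣term∣≤ x x≤B (suc i)))
                    (*-mono (ℚ.0≤∣p∣ (s - t)) 0≤B (term-lipschitz x y x≤B y≤B i) y≤B) ⟩
             b * d + d * expTerm B i * B
               ≡⟨ cong (b * d +_) (trans (ℚ.*-assoc d (expTerm B i) B) (cong (d *_) (term-step i))) ⟩
             b * d + d * (fromℕ (suc i) * b)
               ≡⟨ solve 3 (λ b d f → b :* d :+ d :* (f :* b) := d :* b :* (con 1ℚ :+ f)) refl
                    b d (fromℕ (suc i)) ⟩
             d * b * (1ℚ + fromℕ (suc i))
               ≡⟨ cong (d * b *_) (fromℕ-+ 1 (suc i)) ⟨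
             d * b * fromℕ (suc (suc i)) ∎) ⟩
      d * b * fromℕ (suc (suc i)) * v
        ≡⟨ trans (ℚ.*-assoc (d * b) (fromℕ (suc (suc i))) v)
             (trans (cong (d * b *_) (fromℕ-inv (suc i))) (ℚ.*-identityʳ (d * b))) ⟩
      d * b ∎
      where
      s t v d b : ℚ
      s = expTerm x (suc i)
      t = expTerm y (suc i)
      v = inv (suc i)
      d = ∣ x - y ∣
      b = expTerm B (suc i)

    sum-mono : ∀ n → expSum B n ≤ expSum B (suc n)
    sum-mono n = begin
      expSum B n                      ≡⟨ ℚ.+-identityʳ _ ⟨
      expSum B n + 0ℚ                 ≤⟨ ℚ.+-monoʳ-≤ (expSum B n) (0≤term (suc n)) ⟩
      expSum B n + expTerm B (suc n)  ∎

    sum-lipschitz : ∀ x y → ∣ x ∣ ≤ B → ∣ y ∣ ≤ B → ∀ n →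
      ∣ expSum x n - expSum y n ∣ ≤ expSum B n * ∣ x - y ∣
    sum-lipschitz x y x≤B y≤B n = ℚ.≤-trans (go n) (ℚ.≤-trans
      (ℚ.≤-reflexive (ℚ.*-comm ∣ x - y ∣ (pre n)))
      (ℚ.*-monoʳ-≤-nonNeg ∣ x - y ∣ {{ℚ.∣-∣-nonNeg (x - y)}} (pre≤ n)))
      where
      pre : ℕ → ℚ
      pre zero    = 0ℚ
      pre (suc n) = expSum B n

      pre≤ : ∀ n → pre n ≤ expSum B n
      pre≤ zero    = ℚ.<⇒≤ 0<1
      pre≤ (suc n) = sum-mono n

      pre-step : ∀ n → pre n + expTerm B n ≡ expSum B n
      pre-step zero    = ℚ.+-identityˡ 1ℚ
      pre-step (suc n) = refl

      go : ∀ n → ∣ expSum x n - expSum y n ∣ ≤ ∣ x - y ∣ * pre n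
      go zero    = ℚ.≤-reflexive (sym (ℚ.*-zeroʳ ∣ x - y ∣))
      go (suc n) = begin
        ∣ expSum x n + expTerm x (suc n) - (expSum y n + expTerm y (suc n)) ∣
          ≡⟨ cong ∣_∣ (solve 4 (λ a b c d → a :+ b :- (c :+ d) := (a :- c) :+ (b :- d)) refl
               (expSum x n) (expTerm x (suc n)) (expSum y n) (expTerm y (suc n))) ⟩
        ∣ (expSum x n - expSum y n) + (expTerm x (suc n) - expTerm y (suc n)) ∣
          ≤⟨ ℚ.∣p+q∣≤∣p∣+∣q∣ (expSum x n - expSum y n) (expTerm x (suc n) - expTerm y (suc n)) ⟩
        ∣ expSum x n - expSum y n ∣ + ∣ expTerm x (suc n) - expTerm y (suc n) ∣
          ≤⟨ ℚ.+-mono-≤ (go n) (term-lipschitz x y x≤B y≤B n) ⟩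
        ∣ x - y ∣ * pre n + ∣ x - y ∣ * expTerm B n
          ≡⟨ ℚ.*-distribˡ-+ ∣ x - y ∣ (pre n) (expTerm B n) ⟨
        ∣ x - y ∣ * (pre n + expTerm B n)
          ≡⟨ cong (∣ x - y ∣ *_) (pre-step n) ⟩
        ∣ x - y ∣ * expSum B n ∎

    sum-tail : ∀ x → ∣ x ∣ ≤ B → ∀ m j →
      ∣ expSum x (j ℕ.+ m) - expSum x m ∣ ≤ expSum B (j ℕ.+ m) - expSum B m
    sum-tail x x≤B m zero = ℚ.≤-reflexive
      (trans (cong ∣_∣ (ℚ.+-inverseʳ (expSum x m))) (sym (ℚ.+-inverseʳ (expSum B m))))
    sum-tail x x≤B m (suc j) = begin
      ∣ expSum x (j ℕ.+ m) + expTerm x (suc (j ℕ.+ m)) - expSum x m ∣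
        ≡⟨ cong ∣_∣ (solve 3 (λ a b c → a :+ b :- c := (a :- c) :+ b) refl
             (expSum x (j ℕ.+ m)) (expTerm x (suc (j ℕ.+ m))) (expSum x m)) ⟩
      ∣ (expSum x (j ℕ.+ m) - expSum x m) + expTerm x (suc (j ℕ.+ m)) ∣
        ≤⟨ ℚ.∣p+q∣≤∣p∣+∣q∣ (expSum x (j ℕ.+ m) - expSum x m) (expTerm x (suc (j ℕ.+ m))) ⟩
      ∣ expSum x (j ℕ.+ m) - expSum x m ∣ + ∣ expTerm x (suc (j ℕ.+ m)) ∣
        ≤⟨ ℚ.+-mono-≤ (sum-tail x x≤B m j) (∣term∣≤ x x≤B (suc (j ℕ.+ m))) ⟩
      expSum B (j ℕ.+ m) - expSum B m + expTerm B (suc (j ℕ.+ m))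
        ≡⟨ solve 3 (λ a b c → a :+ b :- c := (a :- c) :+ b) refl
             (expSum B (j ℕ.+ m)) (expTerm B (suc (j ℕ.+ m))) (expSum B m) ⟨
      expSum B (suc (j ℕ.+ m)) - expSum B m ∎

    sum-tail∣∣ : ∀ x → ∣ x ∣ ≤ B → ∀ m n →
      ∣ expSum x m - expSum x n ∣ ≤ ∣ expSum B m - expSum B n ∣
    sum-tail∣∣ x x≤B m n with ℕ.≤-total m n
    ... | inj₁ m≤n = subst₂ _≤_ (swap-∣∣ (expSum x n) (expSum x m)) (swap-∣∣ (expSum B n) (expSum B m))
      (ℚ.≤-trans (subst (λ i → ∣ expSum x i - expSum x m ∣ ≤ expSum B i - expSum B m)
        (ℕ.m∸n+n≡m m≤n) (sum-tail x x≤B m (n ℕ.∸ m))) (p≤∣p∣ _))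
    ... | inj₂ n≤m =
      ℚ.≤-trans (subst (λ i → ∣ expSum x i - expSum x n ∣ ≤ expSum B i - expSum B n)
        (ℕ.m∸n+n≡m n≤m) (sum-tail x x≤B n (m ℕ.∸ n))) (p≤∣p∣ _)

    -- From index M ≥ 2B on, each term is at most half of its predecessor.
    M : ℕ
    M = proj₁ (archimedean (B + B))

    term-halves : ∀ i → M ℕ.≤ i → expTerm B (suc i) + expTerm B (suc i) ≤ expTerm B i
    term-halves i M≤i = begin
      t * (B * v) + t * (B * v)
        ≡⟨ solve 3 (λ t b v → t :* (b :* v) :+ t :* (b :* v) := t :* ((b :+ b) :* v)) refl t B v ⟩
      t * ((B + B) * v)
        ≤⟨ ℚ.*-monoˡ-≤-nonNeg t {{ℚ.nonNegative (0≤term i)}}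
             (ℚ.*-monoʳ-≤-nonNeg v {{ℚ.nonNegative (0≤inv i)}}
               (ℚ.≤-trans (proj₂ (archimedean (B + B)))
                 (fromℕ-mono (ℕ.≤-trans M≤i (ℕ.n≤1+n i))))) ⟩
      t * (fromℕ (suc i) * v)
        ≡⟨ trans (cong (t *_) (fromℕ-inv i)) (ℚ.*-identityʳ t) ⟩
      t ∎
      where
      t v : ℚ
      t = expTerm B i
      v = inv i

    term-decay : ∀ j → fromℕ (suc j) * expTerm B (j ℕ.+ M) ≤ expTerm B M
    term-decay zero    = ℚ.≤-reflexive (ℚ.*-identityˡ _)
    term-decay (suc j) = begin
      fromℕ (suc (suc j)) * t
        ≤⟨ ℚ.*-monoʳ-≤-nonNeg t {{ℚ.nonNegative (0≤term (suc j ℕ.+ M))}}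
             (fromℕ-mono (ℕ.+-monoʳ-≤ 1 (ℕ.m≤n+m (suc j) j))) ⟩
      fromℕ (suc j ℕ.+ suc j) * t
        ≡⟨ cong (_* t) (fromℕ-+ (suc j) (suc j)) ⟩
      (fromℕ (suc j) + fromℕ (suc j)) * t
        ≡⟨ solve 2 (λ f t → (f :+ f) :* t := f :* (t :+ t)) refl (fromℕ (suc j)) t ⟩
      fromℕ (suc j) * (t + t)
        ≤⟨ ℚ.*-monoˡ-≤-nonNeg (fromℕ (suc j)) {{ℚ.nonNegative (0≤fromℕ (suc j))}}
             (term-halves (j ℕ.+ M) (ℕ.m≤n+m M j)) ⟩
      fromℕ (suc j) * expTerm B (j ℕ.+ M)
        ≤⟨ term-decay j ⟩
      expTerm B M ∎
      where
      t : ℚ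
      t = expTerm B (suc j ℕ.+ M)

    term→0 : ∀ ε → 0ℚ < ε → ∃ λ N → ∀ n → N ℕ.≤ n → expTerm B n ≤ ε
    term→0 ε 0<ε =
      let N , h = inv→0 (expTerm B M) (0≤term M) ε 0<ε
      in N ℕ.+ M , λ n N+M≤n →
      let j   = n ℕ.∸ M
          j+M : j ℕ.+ M ≡ n
          j+M = ℕ.m∸n+n≡m (ℕ.≤-trans (ℕ.m≤n+m M N) N+M≤n)
          N≤j : N ℕ.≤ j
          N≤j = subst (ℕ._≤ j) (ℕ.m+n∸n≡m N M) (ℕ.∸-monoˡ-≤ M N+M≤n)
      in begin
      expTerm B n
        ≡⟨ cong (expTerm B) j+M ⟨
      expTerm B (j ℕ.+ M)
        ≡⟨ trans (cong (_* expTerm B (j ℕ.+ M)) (fromℕ-inv j)) (ℚ.*-identityˡ _) ⟨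
      fromℕ (suc j) * inv j * expTerm B (j ℕ.+ M)
        ≡⟨ solve 3 (λ f v t → f :* v :* t := f :* t :* v) refl
             (fromℕ (suc j)) (inv j) (expTerm B (j ℕ.+ M)) ⟩
      fromℕ (suc j) * expTerm B (j ℕ.+ M) * inv j
        ≤⟨ ℚ.*-monoʳ-≤-nonNeg (inv j) {{ℚ.nonNegative (0≤inv j)}} (term-decay j) ⟩
      expTerm B M * inv j
        ≤⟨ h j N≤j ⟩
      ε ∎

    cauchy-sum : IsCauchy (expSum B)
    cauchy-sum = cauchy-squeeze {x = expSum B} {u = expTerm B} M (λ n _ → sum-mono n) dec 0≤term term→0
      where
      dec : ∀ n → M ℕ.≤ n → expSum B (suc n) + expTerm B (suc n) ≤ expSum B n + expTerm B n
      dec n M≤n = begin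
        expSum B n + expTerm B (suc n) + expTerm B (suc n)
          ≡⟨ ℚ.+-assoc (expSum B n) (expTerm B (suc n)) (expTerm B (suc n)) ⟩
        expSum B n + (expTerm B (suc n) + expTerm B (suc n))
          ≤⟨ ℚ.+-monoʳ-≤ (expSum B n) (term-halves n M≤n) ⟩
        expSum B n + expTerm B n ∎

  abstract
    cauchy-exp : IsCauchy x → IsCauchy (λ n → expSum (x n) n)
    cauchy-exp {x} cx =
      let B , N , 0<B , ≤B    = eventually-bounded {x} cx
          open Exp B (ℚ.<⇒≤ 0<B)
          K , N′ , 0<K , ≤K   = eventually-bounded {expSum B} cauchy-sum
      in cauchy-lipschitz₂ {x} {expSum B} {λ n → expSum (x n) n}
      K 1ℚ (N ℕ.⊔ N′) 0<K 0<1 cx cauchy-sum λ m n N≤m N≤n →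
      let xm≤B = ≤B m (ℕ.m⊔n≤o⇒m≤o N N′ N≤m)
          xn≤B = ≤B n (ℕ.m⊔n≤o⇒m≤o N N′ N≤n)
      in begin
      ∣ expSum (x m) m - expSum (x n) n ∣
        ≡⟨ cong ∣_∣ (solve 3 (λ a b c → a :- c := (a :- b) :+ (b :- c)) refl
             (expSum (x m) m) (expSum (x n) m) (expSum (x n) n)) ⟩
      ∣ (expSum (x m) m - expSum (x n) m) + (expSum (x n) m - expSum (x n) n) ∣
        ≤⟨ ℚ.∣p+q∣≤∣p∣+∣q∣ (expSum (x m) m - expSum (x n) m) (expSum (x n) m - expSum (x n) n) ⟩
      ∣ expSum (x m) m - expSum (x n) m ∣ + ∣ expSum (x n) m - expSum (x n) n ∣
        ≤⟨ ℚ.+-mono-≤ (sum-lipschitz (x m) (x n) xm≤B xn≤B m) (sum-tail∣∣ (x n) xn≤B m n) ⟩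
      expSum B m * ∣ x m - x n ∣ + ∣ expSum B m - expSum B n ∣
        ≤⟨ ℚ.+-mono-≤
             (ℚ.*-monoʳ-≤-nonNeg ∣ x m - x n ∣ {{ℚ.∣-∣-nonNeg (x m - x n)}}
               (ℚ.≤-trans (p≤∣p∣ (expSum B m)) (≤K m (ℕ.m⊔n≤o⇒n≤o N N′ N≤m))))
             (ℚ.≤-reflexive (sym (ℚ.*-identityˡ _))) ⟩
      K * ∣ x m - x n ∣ + 1ℚ * ∣ expSum B m - expSum B n ∣ ∎

record ℝ : Set where
  constructor mkℝ
  field
    seq    : ℕ → ℚ
    cauchy : IsCauchy seq

open ℝ public

infix 4 _≃_ _≤_ _<_ _#_

-- Equality and order are those of the limits; _≃_ is the equality of ℝ.
record _≃_ (x y : ℝ) : Set where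
  constructor mk≃
  field
    close : ∀ ε → 0ℚ ℚ.< ε → ∃ λ N → ∀ n → N ℕ.≤ n → ℚ.∣ seq x n ℚ.- seq y n ∣ ℚ.≤ ε

record _≤_ (x y : ℝ) : Set where
  constructor mk≤
  field
    below : ∀ ε → 0ℚ ℚ.< ε → ∃ λ N → ∀ n → N ℕ.≤ n → seq x n ℚ.≤ seq y n ℚ.+ ε

record _<_ (x y : ℝ) : Set where
  constructor mk<
  field
    gap : ∃ λ ε → 0ℚ ℚ.< ε × ∃ λ N → ∀ n → N ℕ.≤ n → seq x n ℚ.+ ε ℚ.≤ seq y n

-- Apartness: the constructive form of x ≠ y.
_#_ : ℝ → ℝ → Set
x # y = x < y ⊎ y < x

fromℚ : ℚ → ℝ
fromℚ q = mkℝ (λ _ → q) (CauchyProofs.cauchy-const q)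

fromℕ : ℕ → ℝ
fromℕ n = fromℚ (ℤ.+ n ℚ./ 1)

0ℝ 1ℝ : ℝ
0ℝ = fromℚ 0ℚ
1ℝ = fromℚ 1ℚ

infix  8 -_
infixl 7 _*_ _÷ℚ_
infixl 6 _+_ _-_
infixr 8 _^_

_+_ : ℝ → ℝ → ℝ
x + y = mkℝ (λ n → seq x n ℚ.+ seq y n)
            (CauchyProofs.cauchy-+ {seq x} {seq y} (cauchy x) (cauchy y))

-_ : ℝ → ℝ
- x = mkℝ (λ n → ℚ.- seq x n) (CauchyProofs.cauchy-neg {seq x} (cauchy x))

_-_ : ℝ → ℝ → ℝ
x - y = x + - y

_*_ : ℝ → ℝ → ℝ
x * y = mkℝ (λ n → seq x n ℚ.* seq y n)
            (CauchyProofs.cauchy-* {seq x} {seq y} (cauchy x) (cauchy y))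

_÷ℚ_ : ℝ → (q : ℚ) → .{{ℚ.NonZero q}} → ℝ
x ÷ℚ q = x * fromℚ (ℚ.1/ q)

∣_∣ : ℝ → ℝ
∣ x ∣ = mkℝ (λ n → ℚ.∣ seq x n ∣) (CauchyProofs.cauchy-∣∣ {seq x} (cauchy x))

-- The n-th approximation is ∑_{i ≤ n} xₙⁱ / i! for the n-th approximation xₙ of x.
exp : ℝ → ℝ
exp x = mkℝ (λ n → expSum (seq x n) n) (CauchyProofs.cauchy-exp {seq x} (cauchy x))

-- ln n = ∫₁ⁿ dx/x for n ≥ 1; the value at 0 is a dummy.
ln : ℕ → ℝ
ln zero    = 0ℝ
ln (suc n) = mkℝ (lnSum (suc n)) (CauchyProofs.cauchy-ln n)

-- nˢ for n ≥ 1
_^_ : ℕ → ℝ → ℝ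
n ^ s = exp (s * ln n)

-- ∑_{j < n} f j
∑< : ℕ → (ℕ → ℝ) → ℝ
∑< zero    f = 0ℝ
∑< (suc n) f = ∑< n f + f n

infix 4 _=O_ _=o_ _∼_

-- Asymptotics as n → ∞
_=O_ : (ℕ → ℝ) → (ℕ → ℝ) → Set
f =O g = ∃ λ C → ∃ λ N → ∀ n → N ℕ.≤ n → ∣ f n ∣ ≤ C * ∣ g n ∣

_=o_ : (ℕ → ℝ) → (ℕ → ℝ) → Set
f =o g = ∀ δ → 0ℝ < δ → ∃ λ N → ∀ n → N ℕ.≤ n → ∣ f n ∣ ≤ δ * ∣ g n ∣

_∼_ : (ℕ → ℝ) → (ℕ → ℝ) → Set
f ∼ g = (λ n → f n - g n) =o g

C-nonZero : ∀ {n k} → k ℕ.≤ n → ℕ.NonZero (n C k)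
C-nonZero {n} {zero} _ = _
C-nonZero {suc n} {suc k} (s≤s k≤n) =
  subst ℕ.NonZero (nCk+nC[k+1]≡[n+1]C[k+1] n k) (+-nonZero (C-nonZero k≤n))
  where
  +-nonZero : ∀ {a b} → ℕ.NonZero a → ℕ.NonZero (a ℕ.+ b)
  +-nonZero {suc a} _ = _

-- All j ∈ ℕᵈ with j₁ + ⋯ + j_d = m
compositions : (d m : ℕ) → List (Vec ℕ d)
compositions zero    zero    = [] ∷ []
compositions zero    (suc m) = []
compositions (suc d) m       =
  concatMap (λ i → List.map (i ∷_) (compositions d (m ℕ.∸ i))) (upTo (suc m))

sumℚ : List ℚ → ℚ
sumℚ = List.foldr ℚ._+_ 0ℚ

∑₃ : (Fin 3 → ℚ) → ℚ
∑₃ f = f zero ℚ.+ f (suc zero) ℚ.+ f (suc (suc zero))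

module _ (t : Vec ℕ 3) where

  size : ℕ
  size = Vec.sum t ℕ.+ 2

  module _ (n : ℕ) .(k≤n : size ℕ.≤ n) where

    pmf : Vec ℕ 3 → ℚ
    pmf (j₁ ∷ j₂ ∷ j₃ ∷ []) = ℚ._/_
      (ℤ.+ ((j₁ C lookup t zero) ℕ.* (j₂ C lookup t (suc zero)) ℕ.* (j₃ C lookup t (suc (suc zero)))))
      (n C size) {{C-nonZero k≤n}}

    -- Probability of the event P about the random vector J, whose range is
    -- {j ∈ ℕ³ : j₁ + j₂ + j₃ = n − 2}
    ℙ : {P : Pred (Vec ℕ 3) 0ℓ} → Decidable P → ℚ
    ℙ P? = sumℚ (List.map pmf (filter P? (compositions 3 (n ℕ.∸ 2))))

  𝓗 : ℚ
  𝓗 = ∑₃ λ r → (ℤ.+ suc (lookup t r) ℚ./ suc size)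
                ℚ.* (harmonic (suc size) ℚ.- harmonic (suc (lookup t r)))

private
  open CauchyProofs using (inv; inv-pos; p≤q⇒0≤q-p; *-pos)

  harmonic-mono : ∀ m j → harmonic m ℚ.≤ harmonic (j ℕ.+ m)
  harmonic-mono m zero    = ℚ.≤-refl
  harmonic-mono m (suc j) = ℚ.≤-trans (harmonic-mono m j)
    (subst (ℚ._≤ harmonic (suc j ℕ.+ m)) (ℚ.+-identityʳ (harmonic (j ℕ.+ m)))
      (ℚ.+-monoʳ-≤ (harmonic (j ℕ.+ m)) (ℚ.<⇒≤ (inv-pos (j ℕ.+ m)))))

  harmonic-strict : ∀ {m n} → m ℕ.< n → 0ℚ ℚ.< harmonic n ℚ.- harmonic m
  harmonic-strict {m} {n} m<n = subst (ℚ._< harmonic n ℚ.- harmonic m)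
    (ℚ.+-inverseʳ (harmonic m))
    (ℚ.+-monoˡ-< (ℚ.- harmonic m) (ℚ.<-≤-trans step
      (subst (λ i → harmonic (suc m) ℚ.≤ harmonic i) (ℕ.m∸n+n≡m m<n) (harmonic-mono (suc m) (n ℕ.∸ suc m)))))
    where
    step : harmonic m ℚ.< harmonic (suc m)
    step = subst (ℚ._< harmonic (suc m)) (ℚ.+-identityʳ (harmonic m))
      (ℚ.+-monoʳ-< (harmonic m) (inv-pos m))

  lookup<size : ∀ t r → lookup t r ℕ.< size t
  lookup<size t r = ℕ.≤-trans (s≤s (lookup≤sum t r))
    (subst (suc (Vec.sum t) ℕ.≤_) (ℕ.+-comm 2 (Vec.sum t)) (ℕ.n≤1+n (suc (Vec.sum t))))
    where
    lookup≤sum : ∀ {d} (t : Vec ℕ d) r → lookup t r ℕ.≤ Vec.sum t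
    lookup≤sum (x ∷ t) zero    = ℕ.m≤m+n x (Vec.sum t)
    lookup≤sum (x ∷ t) (suc r) = ℕ.≤-trans (lookup≤sum t r) (ℕ.m≤n+m (Vec.sum t) x)

𝓗-positive : ∀ t → 0ℚ ℚ.< 𝓗 t
𝓗-positive t = ℚ.+-mono-< (ℚ.+-mono-< (pos zero) (pos (suc zero))) (pos (suc (suc zero)))
  where
  pos : ∀ r → 0ℚ ℚ.< (ℤ.+ suc (lookup t r) ℚ./ suc (size t))
                      ℚ.* (harmonic (suc (size t)) ℚ.- harmonic (suc (lookup t r)))
  pos r = *-pos
    (ℚ.positive⁻¹ (ℤ.+ suc (lookup t r) ℚ./ suc (size t))
      {{ℚ.normalize-pos (suc (lookup t r)) (suc (size t))}})
    (harmonic-strict (s≤s (lookup<size t r)))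

𝓗-nonZero : ∀ t → ℚ.NonZero (𝓗 t)
𝓗-nonZero t = ℚ.>-nonZero (𝓗-positive t)

{-# OPTIONS --safe #-}

-- Write ρ(n, j) = ∑ᵣ ℙ(Jᵣ = j). The arrays C(m, p) and C(m, p) (H_m − H_p) both satisfy Pascal's rule
-- in (m, p), so that their Vandermonde convolutions evaluate in closed form; for F(n) = (n + 1) H_{n+1}
-- this gives the exact identities
--   ∑_j (j + 1) ρ(n, j) = n + 1   and   ∑_j F(j) ρ(n, j) = F(n) − 𝓗 (n + 1).
-- Hence D(n) = E(n) − (a/𝓗) F(n) satisfies the same recurrence with toll T(n) − a (n + 1) = o(n), and,
-- for every η > 0 and a suitable K, η F(n) + K (n + 1) dominates |D(n)| by induction on n: its own toll
-- η 𝓗 (n + 1) exceeds that of D from some index on, and K takes care of the smaller n.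
-- Finally F(n) = n ln n + O(n).

module Submission where

open import Data.Nat.Base as ℕ using (ℕ; zero; suc)
import Data.Nat.Properties as ℕ
open import Data.Nat.Properties using (_≟_; ≤-trans; <⇒≤)
open import Data.Nat.Induction using (<-rec)
import Data.Nat.Tactic.RingSolver as ℕSolver
import Data.Integer.Base as ℤ
import Data.Integer.Properties as ℤ
open import Data.Rational.Unnormalised.Base as ℚᵘ using (mkℚᵘ; *≡*)
open import Data.Rational.Base as ℚ using (ℚ; 0ℚ; 1ℚ; ½)
import Data.Rational.Properties as ℚ
open import Data.Rational.Solver using (module +-*-Solver)
open import Data.Fin.Base using (Fin; zero; suc)
open import Data.List.Base using (List; []; _∷_; _++_; map; filter; concatMap; applyUpTo)
open import Data.List.Properties using (map-++; map-∘; filter-accept; filter-reject)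
open import Data.List.Relation.Unary.All as All using (All; []; _∷_)
import Data.List.Relation.Unary.All.Properties as All
open import Data.Vec.Base using (Vec; []; _∷_; lookup)
open import Data.Product.Base using (∃; _×_; _,_)
open import Data.Sum.Base using (inj₁; inj₂)
open import Function.Base using (_∘_; id; case_of_)
open import Relation.Nullary using (Dec; yes; no; contradiction)
open import Relation.Binary.PropositionalEquality
open +-*-Solver using (solve; _:=_; _:+_; _:*_; _:-_; :-_; con)

-- Moments of the parts of J

-- The index shift in F is what makes the identities exact: absorption turns (j + 1) C(j, t_r) into
-- (t_r + 1) C(j + 1, t_r + 1), again a binomial array. With n ln n in place of F, the sum would
-- only be approximated by an integral, and the error would have to be controlled. A real number is
-- a Cauchy sequence of rationals, and its order holds up to ε from some index on; so the estimates
-- are made on the rational approximations and then lifted. The obstacle there is the toll: n^(1 -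
-- ε) is given by an exponential series that is cut off at the approximation index, where e^(x + y)
-- = e^x e^y holds only up to an error. This error is bounded by a tail of the series of e^B, for a
-- bound B on |x| + |y|. In contrast, e^(ln n) ≤ n involves no limit: it comes from a telescoping
-- product and holds at every cut-off.

module Moments where

  open import Data.Nat.Combinatorics using (_C_; nCk+nC[k+1]≡[n+1]C[k+1])
  open import Data.Rational.Base using (_+_; _*_; _-_; _/_; _≤_)
  open import Defs using (harmonic; compositions; sumℚ; ∑₃; size; pmf; ℙ; 𝓗; C-nonZero)
  open Defs.CauchyProofs
  open ≡-Reasoning

  fraction-* : ∀ a b .{{_ : ℕ.NonZero b}} → (ℤ.+ a / b) * fromℕ b ≡ fromℕ a
  fraction-* a (suc b) = trans (fromℚᵘ-homo-* (mkℚᵘ (ℤ.+ a) b) (mkℚᵘ (ℤ.+ suc b) 0))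
    (ℚ.fromℚᵘ-cong {mkℚᵘ (ℤ.+ a) b ℚᵘ.* mkℚᵘ (ℤ.+ suc b) 0} {mkℚᵘ (ℤ.+ a) 0}
      (*≡* (trans (ℤ.*-identityʳ _) (cong (ℤ.+ a ℤ.*_) (cong (ℤ.+_ ∘ suc) (sym (ℕ.*-identityʳ b)))))))

  *-cancelʳ : ∀ {p q r s} → r * s ≡ 1ℚ → p * r ≡ q * r → p ≡ q
  *-cancelʳ {p} {q} {r} {s} rs e = begin
    p            ≡⟨ lem p ⟩
    p * r * s    ≡⟨ cong (_* s) e ⟩
    q * r * s    ≡⟨ lem q ⟨
    q            ∎
    where
    lem : ∀ p → p ≡ p * r * s
    lem p = sym (trans (ℚ.*-assoc p r s) (trans (cong (p *_) rs) (ℚ.*-identityʳ p)))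

  -- ∑_{i ≤ N} f i · g (N − i)
  conv : (ℕ → ℚ) → (ℕ → ℚ) → ℕ → ℚ
  conv f g zero    = f 0 * g 0
  conv f g (suc N) = conv f (g ∘ suc) N + f (suc N) * g 0

  conv-cong : ∀ {f f′ g g′} → f ≗ f′ → g ≗ g′ → conv f g ≗ conv f′ g′
  conv-cong e e′ zero    = cong₂ _*_ (e 0) (e′ 0)
  conv-cong e e′ (suc N) = cong₂ _+_ (conv-cong e (e′ ∘ suc) N) (cong₂ _*_ (e (suc N)) (e′ 0))

  conv-suc : ∀ f g N → conv f g (suc N) ≡ f 0 * g (suc N) + conv (f ∘ suc) g N
  conv-suc f g zero    = refl
  conv-suc f g (suc N) = trans (cong (_+ f (suc (suc N)) * g 0) (conv-suc f (g ∘ suc) N))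
    (ℚ.+-assoc (f 0 * g (suc (suc N))) (conv (f ∘ suc) (g ∘ suc) N) (f (suc (suc N)) * g 0))

  conv-comm : ∀ f g N → conv f g N ≡ conv g f N
  conv-comm f g zero    = ℚ.*-comm (f 0) (g 0)
  conv-comm f g (suc N) = begin
    conv f (g ∘ suc) N + f (suc N) * g 0  ≡⟨ cong₂ _+_ (conv-comm f (g ∘ suc) N) (ℚ.*-comm (f (suc N)) (g 0)) ⟩
    conv (g ∘ suc) f N + g 0 * f (suc N)  ≡⟨ ℚ.+-comm (conv (g ∘ suc) f N) (g 0 * f (suc N)) ⟩
    g 0 * f (suc N) + conv (g ∘ suc) f N  ≡⟨ conv-suc g f N ⟨
    conv g f (suc N)                      ∎

  conv-+ʳ : ∀ f g h N → conv f (λ m → g m + h m) N ≡ conv f g N + conv f h N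
  conv-+ʳ f g h zero    = ℚ.*-distribˡ-+ (f 0) (g 0) (h 0)
  conv-+ʳ f g h (suc N) = trans (cong (_+ f (suc N) * (g 0 + h 0)) (conv-+ʳ f (g ∘ suc) (h ∘ suc) N))
    (solve 5 (λ a b c d e → a :+ b :+ c :* (d :+ e) := a :+ c :* d :+ (b :+ c :* e)) refl
      (conv f (g ∘ suc) N) (conv f (h ∘ suc) N) (f (suc N)) (g 0) (h 0))

  conv-sucʳ : ∀ f g N → g 0 ≡ 0ℚ → conv f (g ∘ suc) N ≡ conv f g (suc N)
  conv-sucʳ f g N g0 = sym (trans (cong (λ r → conv f (g ∘ suc) N + f (suc N) * r) g0)
    (trans (cong (conv f (g ∘ suc) N +_) (ℚ.*-zeroʳ (f (suc N)))) (ℚ.+-identityʳ _)))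

  -- Arrays with Pascal's rule and their Vandermonde convolution

  record IsPascal (u : ℕ → ℕ → ℚ) : Set where
    field
      pascal : ∀ p m → u (suc p) (suc m) ≡ u (suc p) m + u p m
      vanish : ∀ p → u (suc p) 0 ≡ 0ℚ

  open IsPascal

  binom : ℕ → ℕ → ℚ
  binom p m = fromℕ (m C p)

  binom-isPascal : IsPascal binom
  binom-isPascal .pascal p m = trans (cong fromℕ (sym (nCk+nC[k+1]≡[n+1]C[k+1] m p)))
    (trans (fromℕ-+ (m C p) (m C suc p)) (ℚ.+-comm (binom p m) (binom (suc p) m)))
  binom-isPascal .vanish p = refl

  -- With U_p(z) the generating function of row p, `IsPascal` says (1 - z) U_{p+1} = z U_p. Row q of
  -- the binomials has z^q / (1 - z)^(q+1), so its product with U_p is U_{p+q+1} / z, whence the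
  -- shift of the column by one.
  conv-pascal : ∀ {u} → IsPascal u → ∀ p q N → conv (u p) (binom q) N ≡ u (suc (p ℕ.+ q)) (suc N)
  conv-pascal {u} U p zero zero rewrite ℕ.+-identityʳ p = begin
    u p 0 * 1ℚ               ≡⟨ ℚ.*-identityʳ (u p 0) ⟩
    u p 0                    ≡⟨ ℚ.+-identityˡ (u p 0) ⟨
    0ℚ + u p 0               ≡⟨ cong (_+ u p 0) (vanish U p) ⟨
    u (suc p) 0 + u p 0      ≡⟨ pascal U p 0 ⟨
    u (suc p) 1              ∎
  conv-pascal {u} U p zero (suc N) rewrite ℕ.+-identityʳ p = begin
    conv (u p) (binom 0) N + u p (suc N) * 1ℚ
      ≡⟨ cong₂ _+_ (conv-pascal U p zero N) (ℚ.*-identityʳ (u p (suc N))) ⟩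
    u (suc (p ℕ.+ 0)) (suc N) + u p (suc N)
      ≡⟨ cong (λ i → u (suc i) (suc N) + u p (suc N)) (ℕ.+-identityʳ p) ⟩
    u (suc p) (suc N) + u p (suc N)
      ≡⟨ pascal U p (suc N) ⟨
    u (suc p) (suc (suc N)) ∎
  conv-pascal {u} U p (suc q) zero rewrite ℕ.+-suc p q = begin
    u p 0 * 0ℚ                                   ≡⟨ ℚ.*-zeroʳ (u p 0) ⟩
    0ℚ + 0ℚ                                      ≡⟨ cong₂ _+_ (vanish U (suc (p ℕ.+ q))) (vanish U (p ℕ.+ q)) ⟨
    u (suc (suc (p ℕ.+ q))) 0 + u (suc (p ℕ.+ q)) 0  ≡⟨ pascal U (suc (p ℕ.+ q)) 0 ⟨
    u (suc (suc (p ℕ.+ q))) 1                    ∎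
  conv-pascal {u} U p (suc q) (suc N) rewrite ℕ.+-suc p q = begin
    conv (u p) (binom (suc q) ∘ suc) N + u p (suc N) * 0ℚ
      ≡⟨ cong₂ _+_ (conv-cong {u p} (λ _ → refl) (pascal binom-isPascal q) N) (ℚ.*-zeroʳ (u p (suc N))) ⟩
    conv (u p) (λ m → binom (suc q) m + binom q m) N + 0ℚ
      ≡⟨ trans (ℚ.+-identityʳ _) (conv-+ʳ (u p) (binom (suc q)) (binom q) N) ⟩
    conv (u p) (binom (suc q)) N + conv (u p) (binom q) N
      ≡⟨ cong₂ _+_ (trans (conv-pascal U p (suc q) N) (cong (λ i → u (suc i) (suc N)) (ℕ.+-suc p q)))
           (conv-pascal U p q N) ⟩
    u (suc (suc (p ℕ.+ q))) (suc N) + u (suc (p ℕ.+ q)) (suc N)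
      ≡⟨ pascal U (suc (p ℕ.+ q)) (suc N) ⟨
    u (suc (suc (p ℕ.+ q))) (suc (suc N)) ∎

  -- Sums over compositions as iterated convolutions

  sumℚ-++ : ∀ xs ys → sumℚ (xs ++ ys) ≡ sumℚ xs + sumℚ ys
  sumℚ-++ []       ys = sym (ℚ.+-identityˡ (sumℚ ys))
  sumℚ-++ (x ∷ xs) ys = trans (cong (x +_) (sumℚ-++ xs ys)) (sym (ℚ.+-assoc x (sumℚ xs) (sumℚ ys)))

  sumℚ-map-cong-*ˡ : ∀ {A : Set} (f g : A → ℚ) c xs → All (λ x → f x ≡ c * g x) xs →
    sumℚ (map f xs) ≡ c * sumℚ (map g xs)
  sumℚ-map-cong-*ˡ f g c []       []       = sym (ℚ.*-zeroʳ c)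
  sumℚ-map-cong-*ˡ f g c (x ∷ xs) (e ∷ es) = trans (cong₂ _+_ e (sumℚ-map-cong-*ˡ f g c xs es))
    (sym (ℚ.*-distribˡ-+ c (g x) (sumℚ (map g xs))))

  weight : ∀ {d} → Vec (ℕ → ℚ) d → Vec ℕ d → ℚ
  weight []       []      = 1ℚ
  weight (f ∷ fs) (j ∷ J) = f j * weight fs J

  convs : ∀ {d} → Vec (ℕ → ℚ) d → ℕ → ℚ
  convs []       zero    = 1ℚ
  convs []       (suc _) = 0ℚ
  convs (f ∷ fs) = conv f (convs fs)

  conv-convs-[] : ∀ f → conv f (convs []) ≗ f
  conv-convs-[] f zero    = ℚ.*-identityʳ (f 0)
  conv-convs-[] f (suc N) = trans (cong₂ _+_ (conv-0 N) (ℚ.*-identityʳ (f (suc N)))) (ℚ.+-identityˡ _)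
    where
    conv-0 : ∀ N → conv f (λ _ → 0ℚ) N ≡ 0ℚ
    conv-0 zero    = ℚ.*-zeroʳ (f 0)
    conv-0 (suc N) = trans (cong₂ _+_ (conv-0 N) (ℚ.*-zeroʳ (f (suc N)))) (ℚ.+-identityʳ 0ℚ)

  -- `e` is arbitrary for the sake of the induction: the tail of `applyUpTo e (suc (suc m))`
  -- enumerates with `e ∘ suc`.
  sum-concatMap : ∀ {A : Set} (φ : A → ℚ) (h : ℕ → List A) (e : ℕ → ℕ) (f g : ℕ → ℚ) m →
    (∀ i → sumℚ (map φ (h (e i))) ≡ f i * g (m ℕ.∸ i)) →
    sumℚ (map φ (concatMap h (applyUpTo e (suc m)))) ≡ conv f g m
  sum-concatMap φ h e f g zero    H = trans (cong sumℚ (map-++ φ (h (e 0)) []))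
    (trans (sumℚ-++ (map φ (h (e 0))) []) (trans (ℚ.+-identityʳ _) (H 0)))
  sum-concatMap φ h e f g (suc m) H = begin
    sumℚ (map φ (h (e 0) ++ rest))             ≡⟨ cong sumℚ (map-++ φ (h (e 0)) rest) ⟩
    sumℚ (map φ (h (e 0)) ++ map φ rest)       ≡⟨ sumℚ-++ (map φ (h (e 0))) (map φ rest) ⟩
    sumℚ (map φ (h (e 0))) + sumℚ (map φ rest)
      ≡⟨ cong₂ _+_ (H 0) (sum-concatMap φ h (e ∘ suc) (f ∘ suc) g m (H ∘ suc)) ⟩
    f 0 * g (suc m) + conv (f ∘ suc) g m       ≡⟨ conv-suc f g m ⟨
    conv f g (suc m)                           ∎
    where
    rest = concatMap h (applyUpTo (e ∘ suc) (suc m))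

  sum-compositions : ∀ {d} (fs : Vec (ℕ → ℚ) d) m → sumℚ (map (weight fs) (compositions d m)) ≡ convs fs m
  sum-compositions         []       zero    = refl
  sum-compositions         []       (suc m) = refl
  sum-compositions {suc d} (f ∷ fs) m       = sum-concatMap (weight (f ∷ fs)) (λ i → map (i ∷_) (compositions d (m ℕ.∸ i))) id f (convs fs) m λ i →
    begin
    sumℚ (map (weight (f ∷ fs)) (map (i ∷_) (compositions d (m ℕ.∸ i))))
      ≡⟨ cong sumℚ (map-∘ {g = weight (f ∷ fs)} (compositions d (m ℕ.∸ i))) ⟨
    sumℚ (map (λ J → f i * weight fs J) (compositions d (m ℕ.∸ i)))
      ≡⟨ sumℚ-map-cong-*ˡ _ (weight fs) (f i) (compositions d (m ℕ.∸ i)) (All.universal (λ _ → refl) _) ⟩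
    f i * sumℚ (map (weight fs) (compositions d (m ℕ.∸ i)))
      ≡⟨ cong (f i *_) (sum-compositions fs (m ℕ.∸ i)) ⟩
    f i * convs fs (m ℕ.∸ i) ∎

  compositions-≤ : ∀ d m (r : Fin d) → All (λ J → lookup J r ℕ.≤ m) (compositions d m)
  compositions-≤ (suc d) m zero    = All.concat⁺ (All.map⁺ (All.applyUpTo⁺₁ id (suc m) λ i<1+m →
    All.map⁺ (All.universal (λ _ → ℕ.s≤s⁻¹ i<1+m) _)))
  compositions-≤ (suc d) m (suc r) = All.concat⁺ (All.map⁺ (All.applyUpTo⁺₁ id (suc m) λ {i} _ →
    All.map⁺ (All.map (λ J≤ → ℕ.≤-trans J≤ (ℕ.m∸n≤m m i)) (compositions-≤ d (m ℕ.∸ i) r))))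

  -- Expectations of functions of one part of J

  sum< : ℕ → (ℕ → ℚ) → ℚ
  sum< zero    f = 0ℚ
  sum< (suc n) f = sum< n f + f n

  sum<-cong : ∀ n {f g : ℕ → ℚ} → f ≗ g → sum< n f ≡ sum< n g
  sum<-cong zero    e = refl
  sum<-cong (suc n) e = cong₂ _+_ (sum<-cong n e) (e n)

  sum<-0 : ∀ n → sum< n (λ _ → 0ℚ) ≡ 0ℚ
  sum<-0 zero    = refl
  sum<-0 (suc n) = trans (ℚ.+-identityʳ _) (sum<-0 n)

  sum<-+ : ∀ n f g → sum< n (λ j → f j + g j) ≡ sum< n f + sum< n g
  sum<-+ zero    f g = refl
  sum<-+ (suc n) f g = trans (cong (_+ (f n + g n)) (sum<-+ n f g))
    (solve 4 (λ a b c d → a :+ b :+ (c :+ d) := a :+ c :+ (b :+ d)) refl (sum< n f) (sum< n g) (f n) (g n))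

  sum<-*ˡ : ∀ n c f → sum< n (λ j → c * f j) ≡ c * sum< n f
  sum<-*ˡ zero    c f = sym (ℚ.*-zeroʳ c)
  sum<-*ˡ (suc n) c f = trans (cong (_+ c * f n) (sum<-*ˡ n c f)) (sym (ℚ.*-distribˡ-+ c (sum< n f) (f n)))

  mass : ℚ → ℕ → ℕ → ℚ
  mass p i j with i ℕ.≟ j
  ... | yes _ = p
  ... | no  _ = 0ℚ

  sum<-mass-≥ : ∀ (G : ℕ → ℚ) p i n → n ℕ.≤ i → sum< n (λ j → G j * mass p i j) ≡ 0ℚ
  sum<-mass-≥ G p i zero    _   = refl
  sum<-mass-≥ G p i (suc n) n<i with i ℕ.≟ n
  ... | yes refl = contradiction n<i (ℕ.n≮n n)
  ... | no  _    = trans (cong₂ _+_ (sum<-mass-≥ G p i n (ℕ.<⇒≤ n<i)) (ℚ.*-zeroʳ (G n))) (ℚ.+-identityʳ 0ℚ)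

  sum<-mass : ∀ (G : ℕ → ℚ) p i n → i ℕ.< n → sum< n (λ j → G j * mass p i j) ≡ G i * p
  sum<-mass G p i (suc n) i<1+n with i ℕ.≟ n
  ... | yes refl = trans (cong (_+ G n * p) (sum<-mass-≥ G p n n ℕ.≤-refl)) (ℚ.+-identityˡ _)
  ... | no  i≢n  = trans (cong₂ _+_ (sum<-mass G p i n (ℕ.≤∧≢⇒< (ℕ.s≤s⁻¹ i<1+n) i≢n)) (ℚ.*-zeroʳ (G n)))
    (ℚ.+-identityʳ _)

  sumℚ-filter-∷ : ∀ {A : Set} (φ : A → ℚ) (ι : A → ℕ) j x xs →
    sumℚ (map φ (filter (λ y → ι y ℕ.≟ j) (x ∷ xs))) ≡
    mass (φ x) (ι x) j + sumℚ (map φ (filter (λ y → ι y ℕ.≟ j) xs))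
  sumℚ-filter-∷ φ ι j x xs with ι x ℕ.≟ j
  ... | yes e = cong (sumℚ ∘ map φ) (filter-accept (λ y → ι y ℕ.≟ j) e)
  ... | no ¬e = trans (cong (sumℚ ∘ map φ) (filter-reject (λ y → ι y ℕ.≟ j) ¬e)) (sym (ℚ.+-identityˡ _))

  -- Each list element puts the point mass `φ x` at `ι x`, from which the weight `G` picks out
  -- `G (ι x) * φ x`. This makes a sum over the values of one part an expectation over J.
  sum-fibres : ∀ {A : Set} (φ : A → ℚ) (ι : A → ℕ) (G : ℕ → ℚ) n xs → All (λ x → ι x ℕ.< n) xs →
    sum< n (λ j → G j * sumℚ (map φ (filter (λ x → ι x ℕ.≟ j) xs))) ≡ sumℚ (map (λ x → G (ι x) * φ x) xs)
  sum-fibres φ ι G n []       []       = trans (sum<-cong n (λ j → ℚ.*-zeroʳ (G j))) (sum<-0 n)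
  sum-fibres φ ι G n (x ∷ xs) (h ∷ hs) = begin
    sum< n (λ j → G j * S (x ∷ xs) j)
      ≡⟨ sum<-cong n (λ j → trans (cong (G j *_) (sumℚ-filter-∷ φ ι j x xs))
           (ℚ.*-distribˡ-+ (G j) (mass (φ x) (ι x) j) (S xs j))) ⟩
    sum< n (λ j → G j * mass (φ x) (ι x) j + G j * S xs j)
      ≡⟨ sum<-+ n _ _ ⟩
    sum< n (λ j → G j * mass (φ x) (ι x) j) + sum< n (λ j → G j * S xs j)
      ≡⟨ cong₂ _+_ (sum<-mass G (φ x) (ι x) n h) (sum-fibres φ ι G n xs hs) ⟩
    G (ι x) * φ x + sumℚ (map (λ x → G (ι x) * φ x) xs) ∎
    where
    S : List _ → ℕ → ℚ
    S ys j = sumℚ (map φ (filter (λ y → ι y ℕ.≟ j) ys))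

  -- Once the denominator C(n, k) is cleared, the weight of J is a product of three binomials, and
  -- the factor `G` turns the r-th of them into an entry of `u`. Two applications of `conv-pascal`
  -- evaluate the sum over the compositions of n - 2; each adds one to row and column, which
  -- restores k and n.
  mean-J : ∀ t r n (k≤n : size t ℕ.≤ n) {u} → IsPascal u → ∀ (G : ℕ → ℚ) →
    (∀ j → G j * binom (lookup t r) j ≡ u (lookup t r) j) →
    fromℕ (n C size t) * sum< (n ℕ.∸ 1) (λ j → G j * ℙ t n k≤n (λ J → lookup J r ℕ.≟ j)) ≡ u (size t) n
  mean-J t@(t₁ ∷ t₂ ∷ t₃ ∷ []) r n k≤n {u} U G Gu = go n k≤n (ℕ.≤-trans (ℕ.m≤n+m 2 _) k≤n)
    where
    b = binom
    fs : Fin 3 → Vec (ℕ → ℚ) 3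
    fs zero             = u t₁ ∷ b t₂ ∷ b t₃ ∷ []
    fs (suc zero)       = b t₁ ∷ u t₂ ∷ b t₃ ∷ []
    fs (suc (suc zero)) = b t₁ ∷ b t₂ ∷ u t₃ ∷ []

    -- The inner convolution leaves a row whose column is shifted by one. A row of positive index
    -- vanishes in column 0, so convolving with the shifted row amounts to convolving with the row
    -- itself in the next degree.
    shift : ∀ p q M {g} → (∀ m → g m ≡ b (suc q) (suc m)) → conv (u p) g M ≡ u (suc (p ℕ.+ suc q)) (suc (suc M))
    shift p q M e = trans (conv-cong {u p} (λ _ → refl) e M)
      (trans (conv-sucʳ (u p) (b (suc q)) M (vanish binom-isPascal q)) (conv-pascal U p (suc q) (suc M)))

    shift′ : ∀ p q s M {g} → (∀ m → g m ≡ u (suc (p ℕ.+ q)) (suc m)) →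
      conv (b s) g M ≡ u (suc (suc (p ℕ.+ q) ℕ.+ s)) (suc (suc M))
    shift′ p q s M e = trans (conv-cong {b s} (λ _ → refl) e M)
      (trans (conv-sucʳ (b s) (u (suc (p ℕ.+ q))) M (vanish U (p ℕ.+ q)))
        (trans (conv-comm (b s) (u (suc (p ℕ.+ q))) (suc M)) (conv-pascal U (suc (p ℕ.+ q)) s (suc M))))

    total₁ : ∀ a b c → suc (a ℕ.+ suc (b ℕ.+ c)) ≡ a ℕ.+ (b ℕ.+ (c ℕ.+ 0)) ℕ.+ 2
    total₁ = ℕSolver.solve-∀
    total₂ : ∀ a b c → suc (suc (b ℕ.+ c) ℕ.+ a) ≡ a ℕ.+ (b ℕ.+ (c ℕ.+ 0)) ℕ.+ 2
    total₂ = ℕSolver.solve-∀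
    total₃ : ∀ a b c → suc (suc (c ℕ.+ b) ℕ.+ a) ≡ a ℕ.+ (b ℕ.+ (c ℕ.+ 0)) ℕ.+ 2
    total₃ = ℕSolver.solve-∀

    convs-fs : ∀ r M → convs (fs r) M ≡ u (size t) (suc (suc M))
    convs-fs zero M = trans
      (shift t₁ (t₂ ℕ.+ t₃) M (λ m → trans (conv-cong {b t₂} (λ _ → refl) (conv-convs-[] (b t₃)) m)
        (conv-pascal binom-isPascal t₂ t₃ m)))
      (cong (λ k → u k (suc (suc M))) (total₁ t₁ t₂ t₃))
    convs-fs (suc zero) M = trans
      (shift′ t₂ t₃ t₁ M (λ m → trans (conv-cong {u t₂} (λ _ → refl) (conv-convs-[] (b t₃)) m)
        (conv-pascal U t₂ t₃ m)))
      (cong (λ k → u k (suc (suc M))) (total₂ t₁ t₂ t₃))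
    convs-fs (suc (suc zero)) M = trans
      (shift′ t₃ t₂ t₁ M (λ m → trans (conv-cong {b t₂} (λ _ → refl) (conv-convs-[] (u t₃)) m)
        (trans (conv-comm (b t₂) (u t₃) m) (conv-pascal U t₃ t₂ m))))
      (cong (λ k → u k (suc (suc M))) (total₃ t₁ t₂ t₃))

    tilt : ∀ r → (∀ j → G j * b (lookup t r) j ≡ u (lookup t r) j) → ∀ J →
      G (lookup J r) * weight (b t₁ ∷ b t₂ ∷ b t₃ ∷ []) J ≡ weight (fs r) J
    tilt zero h (j₁ ∷ j₂ ∷ j₃ ∷ []) = trans (sym (ℚ.*-assoc (G j₁) (b t₁ j₁) _)) (cong (_* (b t₂ j₂ * (b t₃ j₃ * 1ℚ))) (h j₁))
    tilt (suc zero) h (j₁ ∷ j₂ ∷ j₃ ∷ []) = trans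
      (solve 4 (λ g x y z → g :* (x :* (y :* z)) := x :* (g :* y :* z)) refl (G j₂) (b t₁ j₁) (b t₂ j₂) (b t₃ j₃ * 1ℚ))
      (cong (λ x → b t₁ j₁ * (x * (b t₃ j₃ * 1ℚ))) (h j₂))
    tilt (suc (suc zero)) h (j₁ ∷ j₂ ∷ j₃ ∷ []) = trans
      (solve 4 (λ g x y z → g :* (x :* (y :* (z :* con 1ℚ))) := x :* (y :* (g :* z :* con 1ℚ))) refl
        (G j₃) (b t₁ j₁) (b t₂ j₂) (b t₃ j₃))
      (cong (λ x → b t₁ j₁ * (b t₂ j₂ * (x * 1ℚ))) (h j₃))

    go : ∀ n (k≤n : size t ℕ.≤ n) → 2 ℕ.≤ n →
      fromℕ (n C size t) * sum< (n ℕ.∸ 1) (λ j → G j * ℙ t n k≤n (λ J → lookup J r ℕ.≟ j)) ≡ u (size t) n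
    go n@(suc (suc M)) k≤n (ℕ.s≤s (ℕ.s≤s _)) = begin
      N * sum< (suc M) (λ j → G j * ℙ t n k≤n (λ J → lookup J r ℕ.≟ j))
        ≡⟨ cong (N *_) (sum-fibres (pmf t n k≤n) (λ J → lookup J r) G (suc M) (compositions 3 M)
             (All.map ℕ.s≤s (compositions-≤ 3 M r))) ⟩
      N * sumℚ (map (λ J → G (lookup J r) * pmf t n k≤n J) (compositions 3 M))
        ≡⟨ sumℚ-map-cong-*ˡ (weight (fs r)) _ N (compositions 3 M) (All.universal clear _) ⟨
      sumℚ (map (weight (fs r)) (compositions 3 M))
        ≡⟨ sum-compositions (fs r) M ⟩
      convs (fs r) M
        ≡⟨ convs-fs r M ⟩
      u (size t) n ∎
      where
      N = fromℕ (n C size t)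
      clear : ∀ J → weight (fs r) J ≡ N * (G (lookup J r) * pmf t n k≤n J)
      clear J@(j₁ ∷ j₂ ∷ j₃ ∷ []) = begin
        weight (fs r) J
          ≡⟨ tilt r Gu J ⟨
        G (lookup J r) * (b t₁ j₁ * (b t₂ j₂ * (b t₃ j₃ * 1ℚ)))
          ≡⟨ cong (G (lookup J r) *_) (solve 3 (λ x y z → x :* (y :* (z :* con 1ℚ)) := x :* y :* z) refl
               (b t₁ j₁) (b t₂ j₂) (b t₃ j₃)) ⟩
        G (lookup J r) * (b t₁ j₁ * b t₂ j₂ * b t₃ j₃)
          ≡⟨ cong (G (lookup J r) *_) (trans (fromℕ-* ((j₁ C t₁) ℕ.* (j₂ C t₂)) (j₃ C t₃))
               (cong (_* b t₃ j₃) (fromℕ-* (j₁ C t₁) (j₂ C t₂)))) ⟨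
        G (lookup J r) * fromℕ ((j₁ C t₁) ℕ.* (j₂ C t₂) ℕ.* (j₃ C t₃))
          ≡⟨ cong (G (lookup J r) *_) (fraction-* ((j₁ C t₁) ℕ.* (j₂ C t₂) ℕ.* (j₃ C t₃)) (n C size t) {{C-nonZero k≤n}}) ⟨
        G (lookup J r) * (pmf t n k≤n J * N)
          ≡⟨ solve 3 (λ g p n → g :* (p :* n) := n :* (g :* p)) refl (G (lookup J r)) (pmf t n k≤n J) N ⟩
        N * (G (lookup J r) * pmf t n k≤n J) ∎

  -- Moments of affine functions of harmonic numbers

  binom-absorb : ∀ p m → fromℕ (suc p) * binom (suc p) (suc m) ≡ fromℕ (suc m) * binom p m
  binom-absorb zero    zero    = refl
  binom-absorb (suc p) zero    = trans
    (cong (fromℕ (suc (suc p)) *_) (trans (pascal binom-isPascal (suc p) 0)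
      (cong₂ _+_ (vanish binom-isPascal (suc p)) (vanish binom-isPascal p))))
    (trans (ℚ.*-zeroʳ (fromℕ (suc (suc p)))) (sym (ℚ.*-zeroʳ 1ℚ)))
  binom-absorb zero    (suc m) = begin
    1ℚ * binom 1 (suc (suc m))
      ≡⟨ cong (1ℚ *_) (pascal binom-isPascal 0 (suc m)) ⟩
    1ℚ * (binom 1 (suc m) + 1ℚ)
      ≡⟨ ℚ.*-distribˡ-+ 1ℚ (binom 1 (suc m)) 1ℚ ⟩
    1ℚ * binom 1 (suc m) + 1ℚ
      ≡⟨ cong (_+ 1ℚ) (binom-absorb zero m) ⟩
    fromℕ (suc m) * 1ℚ + 1ℚ
      ≡⟨ solve 1 (λ a → a :* con 1ℚ :+ con 1ℚ := (con 1ℚ :+ a) :* con 1ℚ) refl (fromℕ (suc m)) ⟩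
    (1ℚ + fromℕ (suc m)) * 1ℚ
      ≡⟨ cong (_* 1ℚ) (fromℕ-+ 1 (suc m)) ⟨
    fromℕ (suc (suc m)) * 1ℚ ∎
  binom-absorb (suc p) (suc m) = begin
    fromℕ (suc (suc p)) * binom (suc (suc p)) (suc (suc m))
      ≡⟨ cong (fromℕ (suc (suc p)) *_) (pascal binom-isPascal (suc p) (suc m)) ⟩
    fromℕ (suc (suc p)) * (x + y)
      ≡⟨ trans (ℚ.*-distribˡ-+ (fromℕ (suc (suc p))) x y)
           (cong (λ r → fromℕ (suc (suc p)) * x + r * y) (fromℕ-+ 1 (suc p))) ⟩
    fromℕ (suc (suc p)) * x + (1ℚ + fromℕ (suc p)) * y
      ≡⟨ cong (fromℕ (suc (suc p)) * x +_) (solve 2 (λ a y → (con 1ℚ :+ a) :* y := a :* y :+ y) refl (fromℕ (suc p)) y) ⟩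
    fromℕ (suc (suc p)) * x + (fromℕ (suc p) * y + y)
      ≡⟨ cong₂ (λ a b → a + (b + y)) (binom-absorb (suc p) m) (binom-absorb p m) ⟩
    fromℕ (suc m) * binom (suc p) m + (fromℕ (suc m) * binom p m + y)
      ≡⟨ solve 4 (λ c a b y → c :* a :+ (c :* b :+ y) := c :* (a :+ b) :+ y) refl
           (fromℕ (suc m)) (binom (suc p) m) (binom p m) y ⟩
    fromℕ (suc m) * (binom (suc p) m + binom p m) + y
      ≡⟨ cong (λ r → fromℕ (suc m) * r + y) (pascal binom-isPascal p m) ⟨
    fromℕ (suc m) * y + y
      ≡⟨ solve 2 (λ c y → c :* y :+ y := (con 1ℚ :+ c) :* y) refl (fromℕ (suc m)) y ⟩
    (1ℚ + fromℕ (suc m)) * y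
      ≡⟨ cong (_* y) (fromℕ-+ 1 (suc m)) ⟨
    fromℕ (suc (suc m)) * y ∎
    where
    x = binom (suc (suc p)) (suc m)
    y = binom (suc p) (suc m)

  inv-absorb : ∀ p m → binom (suc p) (suc m) * inv m ≡ binom p m * inv p
  inv-absorb p m = begin
    b′ * inv m
      ≡⟨ trans (cong (b′ * inv m *_) (fromℕ-inv p)) (ℚ.*-identityʳ _) ⟨
    b′ * inv m * (fromℕ (suc p) * inv p)
      ≡⟨ solve 4 (λ b i c j → b :* i :* (c :* j) := c :* b :* i :* j) refl b′ (inv m) (fromℕ (suc p)) (inv p) ⟩
    fromℕ (suc p) * b′ * inv m * inv p
      ≡⟨ cong (λ r → r * inv m * inv p) (binom-absorb p m) ⟩
    fromℕ (suc m) * b * inv m * inv p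
      ≡⟨ solve 4 (λ b i c j → c :* b :* i :* j := b :* j :* (c :* i)) refl b (inv m) (fromℕ (suc m)) (inv p) ⟩
    b * inv p * (fromℕ (suc m) * inv m)
      ≡⟨ trans (cong (b * inv p *_) (fromℕ-inv m)) (ℚ.*-identityʳ _) ⟩
    b * inv p ∎
    where
    b b′ : ℚ
    b  = binom p m
    b′ = binom (suc p) (suc m)

  -- For h = 0 and x = 1 the generating function of row p is − zᵖ ln(1 − z) / (1 − z)ᵖ⁺¹.
  affine : ℚ → ℚ → ℕ → ℕ → ℚ
  affine x h p m = x * (harmonic m - harmonic p) + h

  -- Passing from H_m to H_{m+1} contributes x C(m+1, p+1)/(m+1), which by `inv-absorb` is x C(m,
  -- p)/(p+1): just what replaces H_{p+1} by H_p in the summand with C(m, p).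
  binom-affine-isPascal : ∀ x h → IsPascal (λ p m → binom p m * affine x h p m)
  binom-affine-isPascal x h .vanish p = trans (cong (_* affine x h (suc p) 0) (vanish binom-isPascal p))
    (ℚ.*-zeroˡ (affine x h (suc p) 0))
  binom-affine-isPascal x h .pascal p m = begin
    b″ * (x * (Hm + inv m - (Hp + inv p)) + h)
      ≡⟨ solve 7 (λ b x m i p j h → b :* (x :* (m :+ i :- (p :+ j)) :+ h)
            := b :* (x :* (m :- (p :+ j)) :+ h) :+ x :* (b :* i)) refl b″ x Hm (inv m) Hp (inv p) h ⟩
    b″ * (x * (Hm - (Hp + inv p)) + h) + x * (b″ * inv m)
      ≡⟨ cong₂ (λ b c → b * (x * (Hm - (Hp + inv p)) + h) + x * c) (pascal binom-isPascal p m) (inv-absorb p m) ⟩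
    (b′ + b) * (x * (Hm - (Hp + inv p)) + h) + x * (b * inv p)
      ≡⟨ solve 7 (λ b′ b x m p j h → (b′ :+ b) :* (x :* (m :- (p :+ j)) :+ h) :+ x :* (b :* j)
            := b′ :* (x :* (m :- (p :+ j)) :+ h) :+ b :* (x :* (m :- p) :+ h)) refl b′ b x Hm Hp (inv p) h ⟩
    b′ * (x * (Hm - (Hp + inv p)) + h) + b * (x * (Hm - Hp) + h) ∎
    where
    Hm Hp b b′ b″ : ℚ
    Hm = harmonic m
    Hp = harmonic p
    b  = binom p m
    b′ = binom (suc p) m
    b″ = binom (suc p) (suc m)

  shift-isPascal : ∀ {u} → IsPascal u → IsPascal (λ p m → u (suc p) (suc m))
  shift-isPascal U .pascal p m = pascal U (suc p) (suc m)
  shift-isPascal U .vanish p   = trans (pascal U (suc p) 0) (cong₂ _+_ (vanish U (suc p)) (vanish U p))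

  scale-isPascal : ∀ c {u} → IsPascal u → IsPascal (λ p m → c * u p m)
  scale-isPascal c {u} U .pascal p m = trans (cong (c *_) (pascal U p m)) (ℚ.*-distribˡ-+ c (u (suc p) m) (u p m))
  scale-isPascal c U .vanish p   = trans (cong (c *_) (vanish U p)) (ℚ.*-zeroʳ c)

  -- Absorbing j + 1 into C(j, t_r) moves both indices up by one, so `mean-J` applies to the shifted
  -- array, scaled by t_r + 1. Its value contains C(n+1, k+1); absorption in reverse yields (n +
  -- 1)/(k + 1) and the C(n, k) that cancels.
  mean-affine : ∀ x h t r n (k≤n : size t ℕ.≤ n) →
    sum< (n ℕ.∸ 1) (λ j → fromℕ (suc j) * affine x h (suc (lookup t r)) (suc j) * ℙ t n k≤n (λ J → lookup J r ℕ.≟ j))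
    ≡ (ℤ.+ suc (lookup t r) / suc (size t)) * (fromℕ (suc n) * affine x h (suc (size t)) (suc n))
  mean-affine x h t r n k≤n =
    let N⁻¹ , _ , NN⁻¹ = recip N (ℚ.positive⁻¹ N {{ℚ.normalize-pos (n C k) 1 {{_}} {{C-nonZero k≤n}}}})
    in *-cancelʳ NN⁻¹ (begin
    S * N
      ≡⟨ ℚ.*-comm S N ⟩
    N * S
      ≡⟨ mean-J t r n k≤n (scale-isPascal (fromℕ (suc tᵣ)) (shift-isPascal (binom-affine-isPascal x h)))
           (λ j → fromℕ (suc j) * affine x h (suc tᵣ) (suc j)) (λ j →
             trans (solve 3 (λ a y b → a :* y :* b := a :* b :* y) refl
               (fromℕ (suc j)) (affine x h (suc tᵣ) (suc j)) (binom tᵣ j))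
             (trans (cong (_* affine x h (suc tᵣ) (suc j)) (sym (binom-absorb tᵣ j)))
               (ℚ.*-assoc (fromℕ (suc tᵣ)) (binom (suc tᵣ) (suc j)) _))) ⟩
    fromℕ (suc tᵣ) * (binom (suc k) (suc n) * Y)
      ≡⟨ cong (_* (binom (suc k) (suc n) * Y)) (fraction-* (suc tᵣ) (suc k)) ⟨
    q * fromℕ (suc k) * (binom (suc k) (suc n) * Y)
      ≡⟨ solve 4 (λ q c b y → q :* c :* (b :* y) := q :* (c :* b :* y)) refl q (fromℕ (suc k)) (binom (suc k) (suc n)) Y ⟩
    q * (fromℕ (suc k) * binom (suc k) (suc n) * Y)
      ≡⟨ cong (λ r → q * (r * Y)) (binom-absorb k n) ⟩
    q * (fromℕ (suc n) * N * Y)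
      ≡⟨ solve 4 (λ q a b y → q :* (a :* b :* y) := q :* (a :* y) :* b) refl q (fromℕ (suc n)) N Y ⟩
    q * (fromℕ (suc n) * Y) * N ∎)
    where
    k tᵣ : ℕ
    k  = size t
    tᵣ = lookup t r
    N Y q S : ℚ
    N = binom k n
    Y = affine x h (suc k) (suc n)
    q = ℤ.+ suc tᵣ / suc k
    S = sum< (n ℕ.∸ 1) (λ j → fromℕ (suc j) * affine x h (suc tᵣ) (suc j) * ℙ t n k≤n (λ J → lookup J r ℕ.≟ j))

  rate : ∀ t n (k≤n : size t ℕ.≤ n) → ℕ → ℚ
  rate t n k≤n j = ∑₃ λ r → ℙ t n k≤n (λ J → lookup J r ℕ.≟ j)

  sum<-∑₃ : ∀ n (G : ℕ → ℚ) (f : Fin 3 → ℕ → ℚ) → sum< n (λ j → G j * ∑₃ (λ r → f r j)) ≡ ∑₃ (λ r → sum< n (λ j → G j * f r j))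
  sum<-∑₃ zero    G f = refl
  sum<-∑₃ (suc n) G f = trans (cong (_+ G n * ∑₃ (λ r → f r n)) (sum<-∑₃ n G f))
    (solve 7 (λ a b c g x y z → a :+ b :+ c :+ g :* (x :+ y :+ z) := a :+ g :* x :+ (b :+ g :* y) :+ (c :+ g :* z)) refl
      (sum< n (λ j → G j * f zero j)) (sum< n (λ j → G j * f (suc zero) j)) (sum< n (λ j → G j * f (suc (suc zero)) j))
      (G n) (f zero n) (f (suc zero) n) (f (suc (suc zero)) n))

  ∑₃-cong : ∀ {f g : Fin 3 → ℚ} → (∀ r → f r ≡ g r) → ∑₃ f ≡ ∑₃ g
  ∑₃-cong e = cong₂ _+_ (cong₂ _+_ (e zero) (e (suc zero))) (e (suc (suc zero)))

  -- The expectation of (J_r + 1)/(n + 1), by `mean-affine` with x = 0 and h = 1.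
  share : Vec ℕ 3 → Fin 3 → ℚ
  share t r = ℤ.+ suc (lookup t r) / suc (size t)

  ∑-share : ∀ t → ∑₃ (share t) ≡ 1ℚ
  ∑-share t@(t₁ ∷ t₂ ∷ t₃ ∷ []) = *-cancelʳ (fromℕ-inv k) (begin
    ∑₃ (share t) * fromℕ (suc k)
      ≡⟨ solve 4 (λ a b c k → (a :+ b :+ c) :* k := a :* k :+ b :* k :+ c :* k) refl
           (share t zero) (share t (suc zero)) (share t (suc (suc zero))) (fromℕ (suc k)) ⟩
    ∑₃ (λ r → share t r * fromℕ (suc k))
      ≡⟨ ∑₃-cong (λ r → fraction-* (suc (lookup t r)) (suc k)) ⟩
    fromℕ (suc t₁) + fromℕ (suc t₂) + fromℕ (suc t₃)
      ≡⟨ trans (fromℕ-+ (suc t₁ ℕ.+ suc t₂) (suc t₃)) (cong (_+ fromℕ (suc t₃)) (fromℕ-+ (suc t₁) (suc t₂))) ⟨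
    fromℕ (suc t₁ ℕ.+ suc t₂ ℕ.+ suc t₃)
      ≡⟨ cong fromℕ (total t₁ t₂ t₃) ⟩
    fromℕ (suc k)
      ≡⟨ ℚ.*-identityˡ (fromℕ (suc k)) ⟨
    1ℚ * fromℕ (suc k) ∎)
    where
    k = size t
    total : ∀ a b c → suc a ℕ.+ suc b ℕ.+ suc c ≡ suc (a ℕ.+ (b ℕ.+ (c ℕ.+ 0)) ℕ.+ 2)
    total = ℕSolver.solve-∀

  sum-rate : ∀ x t n k≤n (G : ℕ → ℚ) (h : Fin 3 → ℚ) → (∀ r j → G j ≡ fromℕ (suc j) * affine x (h r) (suc (lookup t r)) (suc j)) →
    sum< (n ℕ.∸ 1) (λ j → G j * rate t n k≤n j)
    ≡ ∑₃ (λ r → share t r * (fromℕ (suc n) * affine x (h r) (suc (size t)) (suc n)))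
  sum-rate x t n k≤n G h e = trans (sum<-∑₃ (n ℕ.∸ 1) G (λ r j → ℙ t n k≤n (λ J → lookup J r ℕ.≟ j)))
    (∑₃-cong λ r → trans (sum<-cong (n ℕ.∸ 1) (λ j → cong (_* ℙ t n k≤n (λ J → lookup J r ℕ.≟ j)) (e r j)))
      (mean-affine x (h r) t r n k≤n))

  sum-rate-linear : ∀ t n k≤n → sum< (n ℕ.∸ 1) (λ j → fromℕ (suc j) * rate t n k≤n j) ≡ fromℕ (suc n)
  sum-rate-linear t n k≤n = begin
    sum< (n ℕ.∸ 1) (λ j → fromℕ (suc j) * rate t n k≤n j)
      ≡⟨ sum-rate 0ℚ t n k≤n (λ j → fromℕ (suc j)) (λ _ → 1ℚ) (λ r j →
           solve 3 (λ a b c → a := a :* (con 0ℚ :* (b :- c) :+ con 1ℚ)) refl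
             (fromℕ (suc j)) (harmonic (suc j)) (harmonic (suc (lookup t r)))) ⟩
    ∑₃ (λ r → share t r * (fromℕ (suc n) * (0ℚ * (H n - H k) + 1ℚ)))
      ≡⟨ solve 6 (λ a b c n x y → let z = n :* (con 0ℚ :* (x :- y) :+ con 1ℚ) in
           a :* z :+ b :* z :+ c :* z := (a :+ b :+ c) :* n) refl
           (share t zero) (share t (suc zero)) (share t (suc (suc zero))) (fromℕ (suc n)) (H n) (H k) ⟩
    ∑₃ (share t) * fromℕ (suc n)
      ≡⟨ trans (cong (_* fromℕ (suc n)) (∑-share t)) (ℚ.*-identityˡ (fromℕ (suc n))) ⟩
    fromℕ (suc n) ∎
    where
    k = size t
    H : ℕ → ℚ
    H i = harmonic (suc i)

  harmonicCost : ℕ → ℚ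
  harmonicCost n = fromℕ (suc n) * harmonic (suc n)

  -- Splitting H_{j+1} into (H_{j+1} - H_{t_r+1}) + H_{t_r+1} gives the affine form with x = 1 and
  -- an h that depends on r. Its mean carries H_{n+1} - H_{k+1} + H_{t_r+1}, and the differences
  -- H_{k+1} - H_{t_r+1}, averaged with the shares, are 𝓗.
  sum-rate-harmonicCost : ∀ t n k≤n →
    sum< (n ℕ.∸ 1) (λ j → harmonicCost j * rate t n k≤n j) + 𝓗 t * fromℕ (suc n) ≡ harmonicCost n
  sum-rate-harmonicCost t n k≤n = begin
    sum< (n ℕ.∸ 1) (λ j → harmonicCost j * rate t n k≤n j) + 𝓗 t * m
      ≡⟨ cong (_+ 𝓗 t * m) (sum-rate 1ℚ t n k≤n harmonicCost (λ r → H (lookup t r)) (λ r j →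
           solve 3 (λ a b c → a :* b := a :* (con 1ℚ :* (b :- c) :+ c)) refl
             (fromℕ (suc j)) (H j) (H (lookup t r)))) ⟩
    ∑₃ (λ r → share t r * (m * (1ℚ * (H n - H k) + H (lookup t r)))) + 𝓗 t * m
      ≡⟨ solve 9 (λ a b c n x y t₁ t₂ t₃ → let z = λ t → n :* (con 1ℚ :* (x :- y) :+ t) in
           a :* z t₁ :+ b :* z t₂ :+ c :* z t₃ :+ (a :* (y :- t₁) :+ b :* (y :- t₂) :+ c :* (y :- t₃)) :* n
             := (a :+ b :+ c) :* (n :* x)) refl
           (share t zero) (share t (suc zero)) (share t (suc (suc zero))) m (H n) (H k)
           (H (lookup t zero)) (H (lookup t (suc zero))) (H (lookup t (suc (suc zero)))) ⟩
    ∑₃ (share t) * (m * H n)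
      ≡⟨ trans (cong (_* (m * H n)) (∑-share t)) (ℚ.*-identityˡ (m * H n)) ⟩
    harmonicCost n ∎
    where
    k = size t
    m = fromℕ (suc n)
    H : ℕ → ℚ
    H i = harmonic (suc i)

  0≤sumℚ : ∀ {A : Set} (φ : A → ℚ) → (∀ x → 0ℚ ≤ φ x) → ∀ xs → 0ℚ ≤ sumℚ (map φ xs)
  0≤sumℚ φ 0≤φ []       = ℚ.≤-refl
  0≤sumℚ φ 0≤φ (x ∷ xs) = ℚ.+-mono-≤ (0≤φ x) (0≤sumℚ φ 0≤φ xs)

  0≤pmf : ∀ t n (k≤n : size t ℕ.≤ n) J → 0ℚ ≤ pmf t n k≤n J
  0≤pmf t n k≤n (j₁ ∷ j₂ ∷ j₃ ∷ []) = ℚ.nonNegative⁻¹ (pmf t n k≤n (j₁ ∷ j₂ ∷ j₃ ∷ []))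
    {{ℚ.normalize-nonNeg ((j₁ C lookup t zero) ℕ.* (j₂ C lookup t (suc zero)) ℕ.* (j₃ C lookup t (suc (suc zero))))
      (n C size t) {{C-nonZero k≤n}}}}

  0≤rate : ∀ t n k≤n j → 0ℚ ≤ rate t n k≤n j
  0≤rate t n k≤n j = ℚ.+-mono-≤ (ℚ.+-mono-≤ (0≤ℙ zero) (0≤ℙ (suc zero))) (0≤ℙ (suc (suc zero)))
    where
    0≤ℙ : ∀ r → 0ℚ ≤ ℙ t n k≤n (λ J → lookup J r ℕ.≟ j)
    0≤ℙ r = 0≤sumℚ (pmf t n k≤n) (0≤pmf t n k≤n) (filter (λ J → lookup J r ℕ.≟ j) (compositions 3 (n ℕ.∸ 2)))

-- Truncated exponential and logarithm sums

module Estimates where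

  open import Data.Rational.Base using (_+_; _*_; _-_; -_; ∣_∣; _≤_; nonNegative)
  open import Defs using (harmonic; expTerm; expSum; lnSum)
  open Defs.CauchyProofs
  open Moments using (conv; conv-cong; conv-suc; conv-comm; conv-+ʳ; conv-sucʳ; *-cancelʳ)

  -- Products of truncated exponential series

  conv-*ˡ : ∀ c f g N → conv (λ i → c * f i) g N ≡ c * conv f g N
  conv-*ˡ c f g zero    = ℚ.*-assoc c (f 0) (g 0)
  conv-*ˡ c f g (suc N) = trans (cong (_+ c * f (suc N) * g 0) (conv-*ˡ c f (g ∘ suc) N))
    (solve 4 (λ c x y z → c :* x :+ c :* y :* z := c :* (x :+ y :* z)) refl c (conv f (g ∘ suc) N) (f (suc N)) (g 0))

  -- The derivation zd/dz on the power series with coefficients f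
  euler : (ℕ → ℚ) → ℕ → ℚ
  euler f i = fromℕ i * f i

  -- Leibniz rule: in the term with indices i and N - i, the factor N is i + (N - i). It serves
  -- `expTerm-+` in place of the binomial theorem.
  euler-conv : ∀ f g N → euler (conv f g) N ≡ conv (euler f) g N + conv f (euler g) N
  euler-conv f g zero    = solve 2 (λ a b → con 0ℚ :* (a :* b) := con 0ℚ :* a :* b :+ a :* (con 0ℚ :* b)) refl (f 0) (g 0)
  euler-conv f g (suc N) = begin
    n * (conv f (g ∘ suc) N + f (suc N) * g 0)
      ≡⟨ cong (_* (conv f (g ∘ suc) N + f (suc N) * g 0)) (fromℕ-+ 1 N) ⟩
    (1ℚ + fromℕ N) * (conv f (g ∘ suc) N + f (suc N) * g 0)
      ≡⟨ solve 4 (λ n c x y → (con 1ℚ :+ n) :* (c :+ x :* y) := n :* c :+ c :+ (con 1ℚ :+ n) :* x :* y) refl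
           (fromℕ N) (conv f (g ∘ suc) N) (f (suc N)) (g 0) ⟩
    euler (conv f (g ∘ suc)) N + conv f (g ∘ suc) N + (1ℚ + fromℕ N) * f (suc N) * g 0
      ≡⟨ cong₂ (λ a b → a + conv f (g ∘ suc) N + b * f (suc N) * g 0) (euler-conv f (g ∘ suc) N) (sym (fromℕ-+ 1 N)) ⟩
    conv (euler f) (g ∘ suc) N + conv f (euler (g ∘ suc)) N + conv f (g ∘ suc) N + n * f (suc N) * g 0
      ≡⟨ solve 6 (λ a b c d x y → a :+ b :+ c :+ d := a :+ d :+ (b :+ c :+ x :* (con 0ℚ :* y))) refl
           (conv (euler f) (g ∘ suc) N) (conv f (euler (g ∘ suc)) N) (conv f (g ∘ suc) N) (n * f (suc N) * g 0)
           (f (suc N)) (g 0) ⟩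
    conv (euler f) g (suc N) + (conv f (euler (g ∘ suc)) N + conv f (g ∘ suc) N + f (suc N) * euler g 0)
      ≡⟨ cong (λ r → conv (euler f) g (suc N) + (r + f (suc N) * euler g 0))
           (trans (sym (conv-+ʳ f (euler (g ∘ suc)) (g ∘ suc) N))
             (conv-cong {f} (λ _ → refl) (λ i → trans
               (solve 2 (λ a b → a :* b :+ b := (con 1ℚ :+ a) :* b) refl (fromℕ i) (g (suc i)))
               (cong (_* g (suc i)) (sym (fromℕ-+ 1 i)))) N)) ⟩
    conv (euler f) g (suc N) + conv f (euler g) (suc N) ∎
    where
    open ≡-Reasoning
    n : ℚ
    n = fromℕ (suc N)

  euler-expTerm : ∀ x i → euler (expTerm x) (suc i) ≡ x * expTerm x i
  euler-expTerm x i = trans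
    (solve 4 (λ n t x v → n :* (t :* (x :* v)) := n :* v :* (x :* t)) refl (fromℕ (suc i)) (expTerm x i) x (inv i))
    (trans (cong (_* (x * expTerm x i)) (fromℕ-inv i)) (ℚ.*-identityˡ _))

  -- Both sides start with 1 and satisfy (N + 1) c_{N+1} = (x + y) c_N; for the convolution this is
  -- the Leibniz rule.
  expTerm-+ : ∀ x y N → expTerm (x + y) N ≡ conv (expTerm x) (expTerm y) N
  expTerm-+ x y zero    = refl
  expTerm-+ x y (suc N) = *-cancelʳ (fromℕ-inv N) (begin
    expTerm (x + y) (suc N) * fromℕ (suc N)
      ≡⟨ ℚ.*-comm (expTerm (x + y) (suc N)) (fromℕ (suc N)) ⟩
    euler (expTerm (x + y)) (suc N)
      ≡⟨ trans (euler-expTerm (x + y) N) (cong ((x + y) *_) (expTerm-+ x y N)) ⟩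
    (x + y) * conv a b N
      -- The zero summand is the degree 0 term of `euler a`, which `conv-suc` splits off.
      ≡⟨ solve 4 (λ x y c z → (x :+ y) :* c := con 0ℚ :* z :+ x :* c :+ y :* c) refl x y (conv a b N) (b (suc N)) ⟩
    0ℚ * b (suc N) + x * conv a b N + y * conv a b N
      ≡⟨ cong₂ (λ r s → 0ℚ * b (suc N) + r + s) (conv-*ˡ x a b N) y-part ⟨
    euler a 0 * b (suc N) + conv (λ i → x * a i) b N + conv a (λ i → y * b i) N
      ≡⟨ cong₂ (λ r s → euler a 0 * b (suc N) + r + s)
           (conv-cong {g = b} (euler-expTerm x) (λ _ → refl) N)
           (conv-cong {a} (λ _ → refl) (euler-expTerm y) N) ⟨
    euler a 0 * b (suc N) + conv (euler a ∘ suc) b N + conv a (euler b ∘ suc) N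
      ≡⟨ cong₂ _+_ (conv-suc (euler a) b N) (sym (conv-sucʳ a (euler b) N refl)) ⟨
    conv (euler a) b (suc N) + conv a (euler b) (suc N)
      ≡⟨ euler-conv a b (suc N) ⟨
    fromℕ (suc N) * conv a b (suc N)
      ≡⟨ ℚ.*-comm (fromℕ (suc N)) (conv a b (suc N)) ⟩
    conv a b (suc N) * fromℕ (suc N) ∎)
    where
    open ≡-Reasoning
    a b : ℕ → ℚ
    a = expTerm x
    b = expTerm y
    y-part : conv a (λ i → y * b i) N ≡ y * conv a b N
    y-part = trans (conv-comm a (λ i → y * b i) N) (trans (conv-*ˡ y b a N) (cong (y *_) (conv-comm b a N)))

  -- Partial sums are the coefficients after multiplication by 1/(1 - z), and in the product of the
  -- two series this factor can go to the second one.
  expSum-+ : ∀ x y N → expSum (x + y) N ≡ conv (expTerm x) (expSum y) N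
  expSum-+ x y zero    = refl
  expSum-+ x y (suc N) = begin
    expSum (x + y) N + expTerm (x + y) (suc N)
      ≡⟨ cong₂ _+_ (expSum-+ x y N) (expTerm-+ x y (suc N)) ⟩
    conv a (expSum y) N + (conv a (b ∘ suc) N + a (suc N) * 1ℚ)
      ≡⟨ ℚ.+-assoc (conv a (expSum y) N) (conv a (b ∘ suc) N) (a (suc N) * 1ℚ) ⟨
    conv a (expSum y) N + conv a (b ∘ suc) N + a (suc N) * 1ℚ
      ≡⟨ cong (_+ a (suc N) * 1ℚ) (conv-+ʳ a (expSum y) (b ∘ suc) N) ⟨
    conv a (expSum y) (suc N) ∎
    where
    open ≡-Reasoning
    a b : ℕ → ℚ
    a = expTerm x
    b = expTerm y

  expSum-conv : ∀ x c N → conv (expTerm x) (λ _ → c) N ≡ expSum x N * c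
  expSum-conv x c zero    = refl
  expSum-conv x c (suc N) = trans (cong (_+ expTerm x (suc N) * c) (expSum-conv x c N))
    (sym (ℚ.*-distribʳ-+ c (expSum x N) (expTerm x (suc N))))

  open ℚ.≤-Reasoning

  ∣product∣≤ : ∀ {p p′ q q′} → ∣ p ∣ ≤ p′ → ∣ q ∣ ≤ q′ → ∣ p * q ∣ ≤ p′ * q′
  ∣product∣≤ {p} {p′} {q} {q′} hp hq = begin
    ∣ p * q ∣      ≡⟨ ℚ.∣p*q∣≡∣p∣*∣q∣ p q ⟩
    ∣ p ∣ * ∣ q ∣  ≤⟨ *-mono (ℚ.0≤∣p∣ p) (ℚ.≤-trans (ℚ.0≤∣p∣ q) hq) hp hq ⟩
    p′ * q′        ∎

  ∣conv∣≤ : ∀ {f f′ g g′} N → (∀ i → ∣ f i ∣ ≤ f′ i) → (∀ i → i ℕ.≤ N → ∣ g i ∣ ≤ g′ i) → ∣ conv f g N ∣ ≤ conv f′ g′ N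
  ∣conv∣≤ {f} {f′} {g} {g′} zero    hf hg = ∣product∣≤ (hf 0) (hg 0 ℕ.≤-refl)
  ∣conv∣≤ {f} {f′} {g} {g′} (suc N) hf hg = begin
    ∣ conv f (g ∘ suc) N + f (suc N) * g 0 ∣      ≤⟨ ℚ.∣p+q∣≤∣p∣+∣q∣ (conv f (g ∘ suc) N) (f (suc N) * g 0) ⟩
    ∣ conv f (g ∘ suc) N ∣ + ∣ f (suc N) * g 0 ∣  ≤⟨ ℚ.+-mono-≤ (∣conv∣≤ N hf (λ i → hg (suc i) ∘ ℕ.s≤s))
                                                     (∣product∣≤ (hf (suc N)) (hg 0 ℕ.z≤n)) ⟩
    conv f′ (g′ ∘ suc) N + f′ (suc N) * g′ 0      ∎

  -- The product of the partial sums runs over the square i, j ≤ N and the partial sum for x + y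
  -- over the triangle i + j ≤ N. What remains is the corner: for each i, the j with N - i < j ≤ N.
  conv-minus : ∀ x y N → conv (expTerm x) (λ i → expSum y N - expSum y i) N ≡ expSum x N * expSum y N - expSum (x + y) N
  conv-minus x y N = ≡R.begin
    conv a (λ i → c - s i) N
      ≡R.≡⟨ solve 2 (λ p q → p := p :+ q :- q) refl (conv a (λ i → c - s i) N) (conv a s N) ⟩
    conv a (λ i → c - s i) N + conv a s N - conv a s N
      ≡R.≡⟨ cong (_- conv a s N) (trans (sym (conv-+ʳ a (λ i → c - s i) s N))
           (conv-cong {a} (λ _ → refl) (λ i → solve 2 (λ c s → c :- s :+ s := c) refl c (s i)) N)) ⟩
    conv a (λ _ → c) N - conv a s N
      ≡R.≡⟨ cong₂ _-_ (expSum-conv x c N) (sym (expSum-+ x y N)) ⟩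
    expSum x N * c - expSum (x + y) N ≡R.∎
    where
    module ≡R = ≡-Reasoning
    a s : ℕ → ℚ
    a = expTerm x
    s = expSum y
    c : ℚ
    c = s N

  expSum-product-error : ∀ x y N → ∣ expSum x N * expSum y N - expSum (x + y) N ∣
    ≤ expSum (∣ x ∣) N * expSum (∣ y ∣) N - expSum (∣ x ∣ + ∣ y ∣) N
  expSum-product-error x y N = subst₂ _≤_ (cong ∣_∣ (conv-minus x y N)) (conv-minus ∣ x ∣ ∣ y ∣ N)
    (∣conv∣≤ N (EX.∣term∣≤ x ℚ.≤-refl) (λ i i≤N → subst
      (λ M → ∣ expSum y M - expSum y i ∣ ≤ expSum (∣ y ∣) M - expSum (∣ y ∣) i) (ℕ.m∸n+n≡m i≤N)
      (EY.sum-tail y ℚ.≤-refl i (N ℕ.∸ i))))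
    where
    module EX = Exp ∣ x ∣ (ℚ.0≤∣p∣ x)
    module EY = Exp ∣ y ∣ (ℚ.0≤∣p∣ y)

  0≤expSum : ∀ {x} → 0ℚ ≤ x → ∀ N → 0ℚ ≤ expSum x N
  0≤expSum {x} 0≤x zero    = ℚ.<⇒≤ 0<1
  0≤expSum {x} 0≤x (suc N) = ℚ.+-mono-≤ (0≤expSum 0≤x N) (Exp.0≤term x 0≤x (suc N))

  -- For nonnegative arguments the bound in `expSum-product-error` is the difference itself, and it
  -- is at least an absolute value.
  expSum-submultiplicative : ∀ {x y} → 0ℚ ≤ x → 0ℚ ≤ y → ∀ N → expSum (x + y) N ≤ expSum x N * expSum y N
  expSum-submultiplicative {x} {y} 0≤x 0≤y N = 0≤q-p⇒p≤q (ℚ.≤-trans (ℚ.0≤∣p∣ (expSum x N * expSum y N - expSum (x + y) N))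
    (subst₂ (λ p q → ∣ expSum x N * expSum y N - expSum (x + y) N ∣ ≤ expSum p N * expSum q N - expSum (p + q) N)
      (ℚ.0≤p⇒∣p∣≡p 0≤x) (ℚ.0≤p⇒∣p∣≡p 0≤y) (expSum-product-error x y N)))

  0≤conv : ∀ {f g} → (∀ i → 0ℚ ≤ f i) → (∀ i → 0ℚ ≤ g i) → ∀ N → 0ℚ ≤ conv f g N
  0≤conv 0≤f 0≤g zero    = *-nonneg (0≤f 0) (0≤g 0)
  0≤conv 0≤f 0≤g (suc N) = ℚ.+-mono-≤ (0≤conv 0≤f (0≤g ∘ suc) N) (*-nonneg (0≤f (suc N)) (0≤g 0))

  -- In degree N + L, each f i with i ≤ N meets g (N + L - i), which is at least g L by
  -- monotonicity.
  conv-≥-product : ∀ f {g} → (∀ i → 0ℚ ≤ f i) → (∀ i → 0ℚ ≤ g i) → (∀ i → g i ≤ g (suc i)) → ∀ N L →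
    conv f (λ _ → g L) N ≤ conv f g (N ℕ.+ L)
  conv-≥-product f {g} 0≤f 0≤g inc zero    zero    = ℚ.≤-refl
  conv-≥-product f {g} 0≤f 0≤g inc zero    (suc L) = begin
    f 0 * g (suc L)                         ≡⟨ ℚ.+-identityʳ _ ⟨
    f 0 * g (suc L) + 0ℚ                    ≤⟨ ℚ.+-monoʳ-≤ (f 0 * g (suc L)) (0≤conv (0≤f ∘ suc) 0≤g L) ⟩
    f 0 * g (suc L) + conv (f ∘ suc) g L    ≡⟨ conv-suc f g L ⟨
    conv f g (suc L)                        ∎
  conv-≥-product f {g} 0≤f 0≤g inc (suc N) L       = begin
    conv f (λ _ → g L) (suc N)                             ≡⟨ conv-suc f (λ _ → g L) N ⟩
    f 0 * g L + conv (f ∘ suc) (λ _ → g L) N               ≤⟨ ℚ.+-mono-≤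
      (ℚ.*-monoˡ-≤-nonNeg (f 0) {{nonNegative (0≤f 0)}} (inc* (suc N)))
      (conv-≥-product (f ∘ suc) (0≤f ∘ suc) 0≤g inc N L) ⟩
    f 0 * g (suc N ℕ.+ L) + conv (f ∘ suc) g (N ℕ.+ L)     ≡⟨ conv-suc f g (N ℕ.+ L) ⟨
    conv f g (suc N ℕ.+ L)                                 ∎
    where
    inc* : ∀ j → g L ≤ g (j ℕ.+ L)
    inc* zero    = ℚ.≤-refl
    inc* (suc j) = ℚ.≤-trans (inc* j) (inc (j ℕ.+ L))

  expSum-product-≤ : ∀ {x y} → 0ℚ ≤ x → 0ℚ ≤ y → ∀ N → expSum x N * expSum y N ≤ expSum (x + y) (N ℕ.+ N)
  expSum-product-≤ {x} {y} 0≤x 0≤y N = subst₂ _≤_ (expSum-conv x (expSum y N) N) (sym (expSum-+ x y (N ℕ.+ N)))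
    (conv-≥-product (expTerm x) (Exp.0≤term x 0≤x) (0≤expSum 0≤y) (Exp.sum-mono y 0≤y) N N)

  -- The square i, j ≤ N lies between the triangles i + j ≤ N and i + j ≤ 2N, so the error is at
  -- most a block of the series at |x| + |y|. The block is compared with the one at B because x and
  -- y vary with the approximation, while a fixed B gives a single Cauchy sequence.
  expSum-+-close : ∀ {x y B} → ∣ x ∣ + ∣ y ∣ ≤ B → ∀ N →
    ∣ expSum x N * expSum y N - expSum (x + y) N ∣ ≤ expSum B (N ℕ.+ N) - expSum B N
  expSum-+-close {x} {y} {B} b≤B N = begin
    ∣ expSum x N * expSum y N - expSum (x + y) N ∣
      ≤⟨ expSum-product-error x y N ⟩
    expSum (∣ x ∣) N * expSum (∣ y ∣) N - expSum b N
      ≤⟨ ℚ.+-monoˡ-≤ (- expSum b N) (expSum-product-≤ (ℚ.0≤∣p∣ x) (ℚ.0≤∣p∣ y) N) ⟩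
    expSum b (N ℕ.+ N) - expSum b N
      ≤⟨ p≤∣p∣ _ ⟩
    ∣ expSum b (N ℕ.+ N) - expSum b N ∣
      ≤⟨ Exp.sum-tail B (ℚ.≤-trans 0≤b b≤B) b (subst (_≤ B) (sym (ℚ.0≤p⇒∣p∣≡p 0≤b)) b≤B) N N ⟩
    expSum B (N ℕ.+ N) - expSum B N ∎
    where
    b : ℚ
    b = ∣ x ∣ + ∣ y ∣
    0≤b : 0ℚ ≤ b
    0≤b = ℚ.+-mono-≤ (ℚ.0≤∣p∣ x) (ℚ.0≤∣p∣ y)

  -- Reduces an inequality to a nonnegative certificate `d` and an identity for the ring solver.
  ≤-by-gap : ∀ {p q} d → 0ℚ ≤ d → q ≡ p + d → p ≤ q
  ≤-by-gap {p} {q} d 0≤d e = begin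
    p       ≡⟨ ℚ.+-identityʳ p ⟨
    p + 0ℚ  ≤⟨ ℚ.+-monoʳ-≤ p 0≤d ⟩
    p + d   ≡⟨ e ⟨
    q       ∎

  -- The partial sums are at most those of the geometric series; the last term makes up for the cut-off.
  expSum-geometric : ∀ {x} → 0ℚ ≤ x → ∀ N → expSum x N * (1ℚ - x) + x * expTerm x N ≤ 1ℚ
  expSum-geometric {x} 0≤x zero    = ℚ.≤-reflexive
    (solve 1 (λ x → con 1ℚ :* (con 1ℚ :- x) :+ x :* con 1ℚ := con 1ℚ) refl x)
  expSum-geometric {x} 0≤x (suc N) = ℚ.≤-trans
    -- The left side decreases in N: this is the amount lost from N to N + 1, nonnegative because
    -- 1/(N + 1) ≤ 1.
    (≤-by-gap (x * t * (1ℚ - inv N)) (*-nonneg (*-nonneg 0≤x (Exp.0≤term x 0≤x N)) (p≤q⇒0≤q-p (inv-anti {0} {N} ℕ.z≤n)))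
      (solve 4 (λ s x t v → s :* (con 1ℚ :- x) :+ x :* t
         := (s :+ t :* (x :* v)) :* (con 1ℚ :- x) :+ x :* (t :* (x :* v)) :+ x :* t :* (con 1ℚ :- v)) refl
         (expSum x N) x t (inv N)))
    (expSum-geometric 0≤x N)
    where
    t = expTerm x N

  -- The geometric bound e^(1/m) ≤ 1/(1 - 1/m) = m/(m - 1) for m = p + 2.
  expSum-inv : ∀ p N → expSum (inv (suc p)) N * fromℕ (suc p) ≤ fromℕ (suc (suc p))
  expSum-inv p N = begin
    s * fromℕ (suc p)
      ≡⟨ solve 3 (λ s n v → s :* n := s :* ((con 1ℚ :+ n) :- con 1ℚ)) refl s (fromℕ (suc p)) v ⟩
    s * (1ℚ + fromℕ (suc p) - 1ℚ)
      ≡⟨ cong₂ (λ a b → s * (a - b)) (sym (fromℕ-+ 1 (suc p))) (sym (fromℕ-inv (suc p))) ⟩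
    s * (n - n * v)
      ≡⟨ solve 3 (λ s n v → s :* (n :- n :* v) := n :* (s :* (con 1ℚ :- v))) refl s n v ⟩
    n * (s * (1ℚ - v))
      ≤⟨ ℚ.*-monoˡ-≤-nonNeg n {{nonNegative (0≤fromℕ (suc (suc p)))}}
           (ℚ.≤-trans (≤-by-gap (v * expTerm v N) (*-nonneg (0≤inv (suc p)) (Exp.0≤term v (0≤inv (suc p)) N)) refl)
             (expSum-geometric (0≤inv (suc p)) N)) ⟩
    n * 1ℚ
      ≡⟨ ℚ.*-identityʳ n ⟩
    n ∎
    where
    n v s : ℚ
    n = fromℕ (suc (suc p))
    v = inv (suc p)
    s = expSum v N

  harmonic-inc : ∀ p → harmonic p ≤ harmonic (suc p)
  harmonic-inc p = ≤-by-gap (inv p) (0≤inv p) refl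

  harmonic-mono-≤ : ∀ {m n} → m ℕ.≤ n → harmonic m ≤ harmonic n
  harmonic-mono-≤ {m} {n} m≤n = subst (λ i → harmonic m ≤ harmonic i) (ℕ.m∸n+n≡m m≤n) (go (n ℕ.∸ m))
    where
    go : ∀ j → harmonic m ≤ harmonic (j ℕ.+ m)
    go zero    = ℚ.≤-refl
    go (suc j) = ℚ.≤-trans (go j) (harmonic-inc (j ℕ.+ m))

  -- ∏_{p < i ≤ p + j} exp (1/i) ≤ ∏_{p < i ≤ p + j} i/(i − 1) = (p + j)/p
  expSum-harmonic : ∀ p j N → expSum (harmonic (j ℕ.+ suc p) - harmonic (suc p)) N * fromℕ (suc p) ≤ fromℕ (j ℕ.+ suc p)
  expSum-harmonic p zero    N = begin
    expSum (harmonic (suc p) - harmonic (suc p)) N * fromℕ (suc p)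
      ≡⟨ cong₂ (λ x y → expSum x N * y) (ℚ.+-inverseʳ (harmonic (suc p))) refl ⟩
    expSum 0ℚ N * fromℕ (suc p)
      ≡⟨ cong (_* fromℕ (suc p)) (expSum-0 N) ⟩
    1ℚ * fromℕ (suc p)
      ≡⟨ ℚ.*-identityˡ _ ⟩
    fromℕ (suc p) ∎
    where
    expTerm-0 : ∀ i → expTerm 0ℚ (suc i) ≡ 0ℚ
    expTerm-0 i = trans (cong (expTerm 0ℚ i *_) (ℚ.*-zeroˡ (inv i))) (ℚ.*-zeroʳ (expTerm 0ℚ i))
    expSum-0 : ∀ N → expSum 0ℚ N ≡ 1ℚ
    expSum-0 zero    = refl
    expSum-0 (suc N) = trans (cong₂ _+_ (expSum-0 N) (expTerm-0 N)) (ℚ.+-identityʳ 1ℚ)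
  expSum-harmonic p (suc j) N = begin
    expSum (harmonic (suc m) - harmonic (suc p)) N * fromℕ (suc p)
      ≡⟨ cong (λ x → expSum x N * fromℕ (suc p))
           (solve 3 (λ a b c → a :+ b :- c := b :+ (a :- c)) refl (harmonic m) (inv m) (harmonic (suc p))) ⟩
    expSum (inv m + (harmonic m - harmonic (suc p))) N * fromℕ (suc p)
      ≤⟨ ℚ.*-monoʳ-≤-nonNeg (fromℕ (suc p)) {{nonNegative (0≤fromℕ (suc p))}}
           (expSum-submultiplicative (0≤inv m) (p≤q⇒0≤q-p (harmonic-mono-≤ (ℕ.m≤n+m (suc p) j))) N) ⟩
    expSum (inv m) N * expSum (harmonic m - harmonic (suc p)) N * fromℕ (suc p)
      ≡⟨ ℚ.*-assoc (expSum (inv m) N) _ (fromℕ (suc p)) ⟩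
    expSum (inv m) N * (expSum (harmonic m - harmonic (suc p)) N * fromℕ (suc p))
      ≤⟨ ℚ.*-monoˡ-≤-nonNeg (expSum (inv m) N) {{nonNegative (0≤expSum (0≤inv m) N)}} (expSum-harmonic p j N) ⟩
    expSum (inv m) N * fromℕ m
      ≤⟨ subst (λ i → expSum (inv i) N * fromℕ i ≤ fromℕ (suc i)) (sym (ℕ.+-suc j p)) (expSum-inv (j ℕ.+ p) N) ⟩
    fromℕ (suc m) ∎
    where
    m = j ℕ.+ suc p

  -- The telescoped quotient (n + 1)(i + 1)/(i + 1) is n + 1 whatever the mesh and the cut-off.
  expSum-ln : ∀ n i N → expSum (lnSum (suc n) i) N ≤ fromℕ (suc n)
  expSum-ln n i N = begin
    s
      ≡⟨ trans (cong (s *_) (fromℕ-inv i)) (ℚ.*-identityʳ s) ⟨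
    s * (fromℕ (suc i) * inv i)
      ≡⟨ ℚ.*-assoc s (fromℕ (suc i)) (inv i) ⟨
    s * fromℕ (suc i) * inv i
      ≤⟨ ℚ.*-monoʳ-≤-nonNeg (inv i) {{nonNegative (0≤inv i)}}
           (subst (λ m → expSum (harmonic m - harmonic (suc i)) N * fromℕ (suc i) ≤ fromℕ m)
             (ℕ.+-comm (n ℕ.* suc i) (suc i)) (expSum-harmonic i (n ℕ.* suc i) N)) ⟩
    fromℕ (suc n ℕ.* suc i) * inv i
      ≡⟨ trans (cong (_* inv i) (fromℕ-* (suc n) (suc i))) (ℚ.*-assoc (fromℕ (suc n)) (fromℕ (suc i)) (inv i)) ⟩
    fromℕ (suc n) * (fromℕ (suc i) * inv i)
      ≡⟨ trans (cong (fromℕ (suc n) *_) (fromℕ-inv i)) (ℚ.*-identityʳ (fromℕ (suc n))) ⟩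
    fromℕ (suc n) ∎
    where
    s = expSum (lnSum (suc n) i) N

  lnSum-1 : ∀ i → lnSum 1 i ≡ 0ℚ
  lnSum-1 i = trans (cong (λ m → harmonic m - harmonic (suc i)) (ℕ.*-identityˡ (suc i))) (ℚ.+-inverseʳ (harmonic (suc i)))

  -- Going from n + 1 to n + 2 adds a block of m = i + 1 reciprocals, each at least 1/((n + 2) m),
  -- hence at least 1/(n + 2) in total.
  lnSum-≥ : ∀ n i → harmonic (suc n) - 1ℚ ≤ lnSum (suc n) i
  lnSum-≥ zero    i = ℚ.≤-reflexive (sym (lnSum-1 i))
  lnSum-≥ (suc n) i = begin
    harmonic (suc n) + inv (suc n) - 1ℚ
      ≡⟨ solve 2 (λ a b → a :+ b :- con 1ℚ := a :- con 1ℚ :+ b) refl (harmonic (suc n)) (inv (suc n)) ⟩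
    harmonic (suc n) - 1ℚ + inv (suc n)
      ≤⟨ ℚ.+-monoˡ-≤ (inv (suc n)) (lnSum-≥ n i) ⟩
    harmonic p - harmonic m + inv (suc n)
      ≡⟨ cong (harmonic p - harmonic m +_) (scale-inv i (suc n) q (ℕ.*-comm (suc (suc n)) (suc i))) ⟨
    harmonic p - harmonic m + fromℕ m * inv q
      ≡⟨ solve 3 (λ a b c → a :- b :+ c := a :+ c :- b) refl (harmonic p) (harmonic m) (fromℕ m * inv q) ⟩
    harmonic p + fromℕ m * inv q - harmonic m
      ≤⟨ ℚ.+-monoˡ-≤ (- harmonic m) (harmonic-lower p m q (ℕ.≤-reflexive (ℕ.+-comm p m))) ⟩
    harmonic (p ℕ.+ m) - harmonic m
      ≡⟨ cong (λ k → harmonic k - harmonic m) (ℕ.+-comm p m) ⟩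
    lnSum (suc (suc n)) i ∎
    where
    m p q : ℕ
    m = suc i
    p = suc n ℕ.* m
    q = i ℕ.+ suc n ℕ.* m

  -- The same block of m reciprocals, now each at most 1/((n + 1) m).
  lnSum-≤ : ∀ n i → lnSum (suc n) i ≤ harmonic n
  lnSum-≤ zero    i = ℚ.≤-reflexive (lnSum-1 i)
  lnSum-≤ (suc n) i = begin
    lnSum (suc (suc n)) i
      ≡⟨ cong (λ k → harmonic k - harmonic m) (ℕ.+-comm p m) ⟨
    harmonic (p ℕ.+ m) - harmonic m
      ≤⟨ ℚ.+-monoˡ-≤ (- harmonic m) (harmonic-upper p m q (ℕ.n≤1+n p)) ⟩
    harmonic p + fromℕ m * inv q - harmonic m
      ≡⟨ solve 3 (λ a b c → a :- b :+ c := a :+ c :- b) refl (harmonic p) (harmonic m) (fromℕ m * inv q) ⟨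
    harmonic p - harmonic m + fromℕ m * inv q
      ≡⟨ cong (harmonic p - harmonic m +_) (scale-inv i n q (ℕ.*-comm (suc n) (suc i))) ⟩
    lnSum (suc n) i + inv n
      ≤⟨ ℚ.+-monoˡ-≤ (inv n) (lnSum-≤ n i) ⟩
    harmonic (suc n) ∎
    where
    m p q : ℕ
    m = suc i
    p = suc n ℕ.* m
    q = i ℕ.+ n ℕ.* m

  harmonic-≤ : ∀ n → harmonic n ≤ fromℕ n
  harmonic-≤ zero    = ℚ.≤-refl
  harmonic-≤ (suc n) = begin
    harmonic n + inv n  ≤⟨ ℚ.+-mono-≤ (harmonic-≤ n) (inv-anti {0} {n} ℕ.z≤n) ⟩
    fromℕ n + 1ℚ        ≡⟨ ℚ.+-comm (fromℕ n) 1ℚ ⟩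
    1ℚ + fromℕ n        ≡⟨ fromℕ-+ 1 n ⟨
    fromℕ (suc n)       ∎

  1≤harmonic : ∀ n → 1ℚ ≤ harmonic (suc n)
  1≤harmonic n = harmonic-mono-≤ {1} {suc n} (ℕ.s≤s ℕ.z≤n)

  0≤lnSum : ∀ n i → 0ℚ ≤ lnSum (suc n) i
  0≤lnSum n i = ℚ.≤-trans (p≤q⇒0≤q-p (1≤harmonic n)) (lnSum-≥ n i)

  -- Oresme's argument; the witness has n + 1 = 2^k, and the block from 2^k to 2^(k+1) adds at least
  -- 1/2.
  harmonic-power₂ : ∀ k → ∃ λ n → fromℕ k * ½ ≤ harmonic (suc n)
  harmonic-power₂ zero    = 0 , ℚ.<⇒≤ 0<1
  harmonic-power₂ (suc k) = let n , h = harmonic-power₂ k in n ℕ.+ suc n , (begin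
    fromℕ (suc k) * ½
      ≡⟨ cong (_* ½) (fromℕ-+ 1 k) ⟩
    (1ℚ + fromℕ k) * ½
      ≡⟨ solve 1 (λ k → (con 1ℚ :+ k) :* con ½ := k :* con ½ :+ con ½) refl (fromℕ k) ⟩
    fromℕ k * ½ + ½
      ≤⟨ ℚ.+-monoˡ-≤ ½ h ⟩
    harmonic (suc n) + ½
      ≡⟨ cong (harmonic (suc n) +_) (scale-inv n 1 (n ℕ.+ suc n) (doubling (suc n))) ⟨
    harmonic (suc n) + fromℕ (suc n) * inv (n ℕ.+ suc n)
      ≤⟨ harmonic-lower (suc n) (suc n) (n ℕ.+ suc n) ℕ.≤-refl ⟩
    harmonic (suc n ℕ.+ suc n) ∎)
    where
    doubling : ∀ m → m ℕ.+ m ≡ m ℕ.* 2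
    doubling m = trans (cong (m ℕ.+_) (sym (ℕ.+-identityʳ m))) (ℕ.*-comm 2 m)

  harmonic→∞ : ∀ p → ∃ λ N → ∀ n → N ℕ.≤ n → p ≤ harmonic n
  harmonic→∞ p =
    let K , p≤K = archimedean p
        N , h   = harmonic-power₂ (K ℕ.+ K)
    in suc N , λ n N<n → begin
    p                      ≤⟨ p≤K ⟩
    fromℕ K                ≡⟨ solve 1 (λ k → k := (k :+ k) :* con ½) refl (fromℕ K) ⟩
    (fromℕ K + fromℕ K) * ½  ≡⟨ cong (_* ½) (fromℕ-+ K K) ⟨
    fromℕ (K ℕ.+ K) * ½    ≤⟨ h ⟩
    harmonic (suc N)       ≤⟨ harmonic-mono-≤ N<n ⟩
    harmonic n             ∎

open import Defs
open Moments using (sum<; sum<-cong; sum<-+; sum<-*ˡ; rate; harmonicCost; sum-rate-linear; sum-rate-harmonicCost; 0≤rate)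
open Estimates
open ℚ.≤-Reasoning
private module Q = CauchyProofs

-- Real numbers

halves : ∀ ε → ½ ℚ.* ε ℚ.+ ½ ℚ.* ε ≡ ε
halves = solve 1 (λ e → con ½ :* e :+ con ½ :* e := e) refl

half-pos : ∀ {ε} → 0ℚ ℚ.< ε → 0ℚ ℚ.< ½ ℚ.* ε
half-pos = Q.*-pos Q.0<½

≤-eventually : ∀ {x y} N → (∀ n → N ℕ.≤ n → seq x n ℚ.≤ seq y n) → x ≤ y
≤-eventually {x} {y} N h = mk≤ λ ε 0<ε → N , λ n N≤n →
  ℚ.≤-trans (h n N≤n) (≤-by-gap ε (ℚ.<⇒≤ 0<ε) refl)

≤-pointwise : ∀ {x y} → (∀ n → seq x n ℚ.≤ seq y n) → x ≤ y
≤-pointwise h = ≤-eventually 0 λ n _ → h n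

fromℚ-mono : ∀ {p q} → p ℚ.≤ q → fromℚ p ≤ fromℚ q
fromℚ-mono p≤q = ≤-pointwise λ _ → p≤q

≤ℝ-trans : ∀ {x y z} → x ≤ y → y ≤ z → x ≤ z
≤ℝ-trans {x} {y} {z} (mk≤ h) (mk≤ k) = mk≤ λ ε 0<ε →
  let N , f = h (½ ℚ.* ε) (half-pos 0<ε)
      M , g = k (½ ℚ.* ε) (half-pos 0<ε)
  in N ℕ.⊔ M , λ n ≤n → begin
  seq x n                                   ≤⟨ f n (ℕ.m⊔n≤o⇒m≤o N M ≤n) ⟩
  seq y n ℚ.+ ½ ℚ.* ε                       ≤⟨ ℚ.+-monoˡ-≤ (½ ℚ.* ε) (g n (ℕ.m⊔n≤o⇒n≤o N M ≤n)) ⟩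
  seq z n ℚ.+ ½ ℚ.* ε ℚ.+ ½ ℚ.* ε           ≡⟨ ℚ.+-assoc (seq z n) (½ ℚ.* ε) (½ ℚ.* ε) ⟩
  seq z n ℚ.+ (½ ℚ.* ε ℚ.+ ½ ℚ.* ε)         ≡⟨ cong (seq z n ℚ.+_) (halves ε) ⟩
  seq z n ℚ.+ ε                             ∎

+ℝ-mono-≤ : ∀ {x y u v} → x ≤ y → u ≤ v → x + u ≤ y + v
+ℝ-mono-≤ {x} {y} {u} {v} (mk≤ h) (mk≤ k) = mk≤ λ ε 0<ε →
  let N , f = h (½ ℚ.* ε) (half-pos 0<ε)
      M , g = k (½ ℚ.* ε) (half-pos 0<ε)
  in N ℕ.⊔ M , λ n ≤n → begin
  seq x n ℚ.+ seq u n
    ≤⟨ ℚ.+-mono-≤ (f n (ℕ.m⊔n≤o⇒m≤o N M ≤n)) (g n (ℕ.m⊔n≤o⇒n≤o N M ≤n)) ⟩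
  seq y n ℚ.+ ½ ℚ.* ε ℚ.+ (seq v n ℚ.+ ½ ℚ.* ε)
    ≡⟨ solve 3 (λ a b e → a :+ con ½ :* e :+ (b :+ con ½ :* e) := a :+ b :+ e) refl (seq y n) (seq v n) ε ⟩
  seq y n ℚ.+ seq v n ℚ.+ ε ∎

*-monoˡ-≤ : ∀ {x y} q → 0ℚ ℚ.≤ q → x ≤ y → x * fromℚ q ≤ y * fromℚ q
*-monoˡ-≤ {x} {y} q 0≤q (mk≤ h) = mk≤ λ ε 0<ε →
  -- q may be 0, so ε is divided by q + 1.
  let r , 0<r , q+1*r = Q.recip (q ℚ.+ 1ℚ) (ℚ.+-mono-≤-< 0≤q Q.0<1)
      N , f           = h (ε ℚ.* r) (Q.*-pos 0<ε 0<r)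
  in N , λ n N≤n → begin
  seq x n ℚ.* q
    ≤⟨ ℚ.*-monoʳ-≤-nonNeg q {{ℚ.nonNegative 0≤q}} (f n N≤n) ⟩
  (seq y n ℚ.+ ε ℚ.* r) ℚ.* q
    ≤⟨ ≤-by-gap (ε ℚ.* r) (ℚ.<⇒≤ (Q.*-pos 0<ε 0<r))
         (solve 4 (λ y e r q → y :* q :+ e :* ((q :+ con 1ℚ) :* r) := (y :+ e :* r) :* q :+ e :* r) refl (seq y n) ε r q) ⟩
  seq y n ℚ.* q ℚ.+ ε ℚ.* ((q ℚ.+ 1ℚ) ℚ.* r)
    ≡⟨ cong (λ s → seq y n ℚ.* q ℚ.+ s) (trans (cong (ε ℚ.*_) q+1*r) (ℚ.*-identityʳ ε)) ⟩
  seq y n ℚ.* q ℚ.+ ε ∎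

∣-∣-≤-cong : ∀ {x y} z → x ≃ y → ∣ x - z ∣ ≤ ∣ y - z ∣
∣-∣-≤-cong {x} {y} z (mk≃ h) = mk≤ λ ε 0<ε → let N , f = h ε 0<ε in N , λ n N≤n → begin
  ℚ.∣ seq x n ℚ.- seq z n ∣
    ≡⟨ cong ℚ.∣_∣ (solve 3 (λ x y z → x :- z := (y :- z) :+ (x :- y)) refl (seq x n) (seq y n) (seq z n)) ⟩
  ℚ.∣ (seq y n ℚ.- seq z n) ℚ.+ (seq x n ℚ.- seq y n) ∣
    ≤⟨ ℚ.∣p+q∣≤∣p∣+∣q∣ (seq y n ℚ.- seq z n) (seq x n ℚ.- seq y n) ⟩
  ℚ.∣ seq y n ℚ.- seq z n ∣ ℚ.+ ℚ.∣ seq x n ℚ.- seq y n ∣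
    ≤⟨ ℚ.+-monoʳ-≤ (ℚ.∣ seq y n ℚ.- seq z n ∣) (f n N≤n) ⟩
  ℚ.∣ seq y n ℚ.- seq z n ∣ ℚ.+ ε ∎

∣∣-bounded : ∀ x → ∃ λ B → 0ℚ ℚ.< B × ∃ λ N → ∀ n → N ℕ.≤ n → ℚ.∣ seq x n ∣ ℚ.≤ B
∣∣-bounded x = let B , N , 0<B , h = Q.eventually-bounded {seq x} (cauchy x) in B , 0<B , N , h

∣∣-bounded-below : ∀ (x : ℕ → ℝ) N → ∃ λ K → 0ℚ ℚ.≤ K × (∀ n → n ℕ.< N → ∣ x n ∣ ≤ fromℚ K)
∣∣-bounded-below x zero    = 0ℚ , ℚ.≤-refl , λ _ ()
∣∣-bounded-below x (suc N) =
  let K , 0≤K , h     = ∣∣-bounded-below x N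
      B , 0<B , M , k = ∣∣-bounded (x N)
  in K ℚ.+ B , ℚ.+-mono-≤ 0≤K (ℚ.<⇒≤ 0<B) , λ n n<1+N → case (ℕ.m<1+n⇒m<n∨m≡n n<1+N) of λ where
    (inj₁ n<N)  → ≤ℝ-trans (h n n<N) (fromℚ-mono (≤-by-gap B (ℚ.<⇒≤ 0<B) refl))
    (inj₂ refl) → ≤-eventually M λ i M≤i → ℚ.≤-trans (k i M≤i) (≤-by-gap K 0≤K (ℚ.+-comm K B))

∑<-mono : ∀ n {f g : ℕ → ℝ} → (∀ j → j ℕ.< n → f j ≤ g j) → ∑< n f ≤ ∑< n g
∑<-mono zero    h = ≤-pointwise λ _ → ℚ.≤-refl
∑<-mono (suc n) h = +ℝ-mono-≤ (∑<-mono n (λ j → h j ∘ ℕ.m<n⇒m<1+n)) (h n (ℕ.n<1+n n))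

seq-∑< : ∀ n (f : ℕ → ℝ) i → seq (∑< n f) i ≡ sum< n (λ j → seq (f j) i)
seq-∑< zero    f i = refl
seq-∑< (suc n) f i = cong (ℚ._+ seq (f n) i) (seq-∑< n f i)

>0⇒≥ : ∀ {x} → 0ℝ < x → ∃ λ e → 0ℚ ℚ.< e × ∃ λ N → ∀ n → N ℕ.≤ n → e ℚ.≤ seq x n
>0⇒≥ {x} (mk< (e , 0<e , N , h)) = e , 0<e , N , λ n N≤n → subst (ℚ._≤ seq x n) (ℚ.+-identityˡ e) (h n N≤n)

-- With d = ε ln n one has n^(1−ε) eᵈ = n, and eᵈ ≥ d is unbounded.
module _ (n i : ℕ) {y d : ℚ} (0≤d : 0ℚ ℚ.≤ d) (y+d : y ℚ.+ d ≡ lnSum (suc n) i) where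

  private
    S D m : ℚ
    S = expSum y i
    D = expSum d i
    m = Q.fromℕ (suc n)

  -- At the cut-off, S D differs from the sum for y + d by at most the tail, hence by at most 1 ≤ n
  -- + 1, and that sum is at most n + 1 by `expSum-ln`.
  ∣expSum∣-*-≤ : ∀ {B} → ℚ.∣ y ∣ ℚ.+ ℚ.∣ d ∣ ℚ.≤ B → expSum B (i ℕ.+ i) ℚ.- expSum B i ℚ.≤ 1ℚ → ℚ.∣ S ∣ ℚ.* D ℚ.≤ m ℚ.+ m
  ∣expSum∣-*-≤ {B} b≤B tail≤1 = begin
    ℚ.∣ S ∣ ℚ.* D
      ≡⟨ trans (cong (ℚ.∣ S ∣ ℚ.*_) (sym (ℚ.0≤p⇒∣p∣≡p (0≤expSum 0≤d i)))) (sym (ℚ.∣p*q∣≡∣p∣*∣q∣ S D)) ⟩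
    ℚ.∣ S ℚ.* D ∣
      ≡⟨ cong ℚ.∣_∣ (solve 2 (λ p q → p := (p :- q) :+ q) refl (S ℚ.* D) X) ⟩
    ℚ.∣ (S ℚ.* D ℚ.- X) ℚ.+ X ∣
      ≤⟨ ℚ.∣p+q∣≤∣p∣+∣q∣ (S ℚ.* D ℚ.- X) X ⟩
    ℚ.∣ S ℚ.* D ℚ.- X ∣ ℚ.+ ℚ.∣ X ∣
      ≤⟨ ℚ.+-mono-≤ (ℚ.≤-trans (expSum-+-close {y} {d} {B} b≤B i) tail≤1)
           (ℚ.≤-reflexive (trans (cong (λ z → ℚ.∣ expSum z i ∣) y+d) (ℚ.0≤p⇒∣p∣≡p (0≤expSum (0≤lnSum n i) i)))) ⟩
    1ℚ ℚ.+ expSum (lnSum (suc n) i) i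
      ≤⟨ ℚ.+-mono-≤ (Q.fromℕ-mono {1} {suc n} (ℕ.s≤s ℕ.z≤n)) (expSum-ln n i i) ⟩
    m ℚ.+ m ∎
    where
    X : ℚ
    X = expSum (y ℚ.+ d) i

  -- Here e r = 1/η, so D is at least 2/η and dividing 2 (n + 1) by it leaves η (n + 1).
  ∣expSum∣-≤ : ∀ {η e r} → 0ℚ ℚ.≤ η → η ℚ.* e ℚ.* r ≡ 1ℚ → e ℚ.* (r ℚ.+ r) ℚ.≤ D →
    ℚ.∣ S ∣ ℚ.* D ℚ.≤ m ℚ.+ m → ℚ.∣ S ∣ ℚ.≤ η ℚ.* m
  ∣expSum∣-≤ {η} {e} {r} 0≤η ηer≡1 D≥ SD≤ = begin
    ℚ.∣ S ∣
      ≡⟨ trans (cong (ℚ.∣ S ∣ ℚ.*_) ηer≡1) (ℚ.*-identityʳ ℚ.∣ S ∣) ⟨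
    ℚ.∣ S ∣ ℚ.* (η ℚ.* e ℚ.* r)
      ≡⟨ solve 4 (λ s η e r → s :* (η :* e :* r) := con ½ :* η :* (s :* (e :* (r :+ r)))) refl ℚ.∣ S ∣ η e r ⟩
    ½ ℚ.* η ℚ.* (ℚ.∣ S ∣ ℚ.* (e ℚ.* (r ℚ.+ r)))
      ≤⟨ ℚ.*-monoˡ-≤-nonNeg (½ ℚ.* η) {{ℚ.nonNegative (Q.*-nonneg (ℚ.<⇒≤ Q.0<½) 0≤η)}} (ℚ.≤-trans
           (ℚ.*-monoˡ-≤-nonNeg (ℚ.∣ S ∣) {{ℚ.∣-∣-nonNeg S}} D≥) SD≤) ⟩
    ½ ℚ.* η ℚ.* (m ℚ.+ m)
      ≡⟨ solve 2 (λ η m → con ½ :* η :* (m :+ m) := η :* m) refl η m ⟩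
    η ℚ.* m ∎

expSum-≥ : ∀ {x} → 0ℚ ℚ.≤ x → ∀ {N} → 0 ℕ.< N → x ℚ.≤ expSum x N
expSum-≥ {x} 0≤x {suc zero}    _ = ≤-by-gap 1ℚ (ℚ.<⇒≤ Q.0<1)
  (solve 1 (λ x → con 1ℚ :+ con 1ℚ :* (x :* con 1ℚ) := x :+ con 1ℚ) refl x)
expSum-≥ {x} 0≤x {suc (suc N)} _ = ℚ.≤-trans (expSum-≥ 0≤x {suc N} ℕ.z<s) (Q.Exp.sum-mono x 0≤x (suc N))

-- q approximates ε from some index on and e is a rational lower bound for it. Since ln (n + 1) ≥
-- H_{n+1} - 1 ≥ 2r, the exponent d = q ln (n + 1) is at least 2 e r.
∣expSum-power∣-≤ : ∀ n {i q η e r B} → 0ℚ ℚ.≤ e → 0ℚ ℚ.≤ η → η ℚ.* e ℚ.* r ≡ 1ℚ → e ℚ.≤ q →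
  1ℚ ℚ.+ (r ℚ.+ r) ℚ.≤ harmonic (suc n) → 0 ℕ.< i →
  let x = lnSum (suc n) i in
  ℚ.∣ (1ℚ ℚ.- q) ℚ.* x ∣ ℚ.+ ℚ.∣ q ℚ.* x ∣ ℚ.≤ B → expSum B (i ℕ.+ i) ℚ.- expSum B i ℚ.≤ 1ℚ →
  ℚ.∣ expSum ((1ℚ ℚ.- q) ℚ.* x) i ∣ ℚ.≤ η ℚ.* Q.fromℕ (suc n)
∣expSum-power∣-≤ n {i} {q} {η} {e} {r} {B} 0≤e 0≤η ηer≡1 e≤q r≤ 0<i b≤B tail≤1 =
  ∣expSum∣-≤ n i {y} {d} 0≤d y+d {η} {e} {r} 0≤η ηer≡1
    (ℚ.≤-trans (Q.*-mono 0≤e (0≤lnSum n i) e≤q (ℚ.≤-trans r+r≤ (lnSum-≥ n i))) (expSum-≥ 0≤d 0<i))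
    (∣expSum∣-*-≤ n i {y} {d} 0≤d y+d {B} b≤B tail≤1)
  where
  y d : ℚ
  y = (1ℚ ℚ.- q) ℚ.* lnSum (suc n) i
  d = q ℚ.* lnSum (suc n) i
  0≤d : 0ℚ ℚ.≤ d
  0≤d = Q.*-nonneg (ℚ.≤-trans 0≤e e≤q) (0≤lnSum n i)
  y+d : y ℚ.+ d ≡ lnSum (suc n) i
  y+d = solve 2 (λ q x → (con 1ℚ :- q) :* x :+ q :* x := x) refl q (lnSum (suc n) i)
  r+r≤ : r ℚ.+ r ℚ.≤ harmonic (suc n) ℚ.- 1ℚ
  r+r≤ = subst (ℚ._≤ harmonic (suc n) ℚ.- 1ℚ) (solve 1 (λ r → con 1ℚ :+ r :- con 1ℚ := r) refl (r ℚ.+ r))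
    (ℚ.+-monoˡ-≤ (ℚ.- 1ℚ) r≤)

power-small : ∀ ε → 0ℝ < ε → ∀ η → 0ℚ ℚ.< η →
  ∃ λ N → ∀ n → N ℕ.≤ n → ∣ n ^ (1ℝ - ε) ∣ ≤ fromℚ (η ℚ.* Q.fromℕ n)
power-small ε 0<ε η 0<η =
  let e , 0<e , I , e≤ = >0⇒≥ 0<ε
      r , _ , ηer≡1    = Q.recip (η ℚ.* e) (Q.*-pos 0<η 0<e)
      N , r≤           = harmonic→∞ (1ℚ ℚ.+ (r ℚ.+ r))
  in suc N , λ where
    (suc n) N<n →
      -- `B` and `K` depend on n, but they affect only the approximation index from which the
      -- estimate holds, not the threshold for n.
      let B , 0<B , L , b≤B = ∣∣-bounded (∣ (1ℝ - ε) * ln (suc n) ∣ + ∣ ε * ln (suc n) ∣)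
          K , tail≤1        = Q.Exp.cauchy-sum B (ℚ.<⇒≤ 0<B) 1ℚ Q.0<1
      -- The successor makes i positive, so that the cut-off series contains the linear term d.
      in ≤-eventually (suc (I ℕ.⊔ (L ℕ.⊔ K))) λ i I<i →
      let I⊔≤i = ℕ.≤-trans (ℕ.n≤1+n (I ℕ.⊔ (L ℕ.⊔ K))) I<i
          L⊔≤i = ℕ.m⊔n≤o⇒n≤o I (L ℕ.⊔ K) I⊔≤i
          K≤i  = ℕ.m⊔n≤o⇒n≤o L K L⊔≤i
      in ∣expSum-power∣-≤ n {i} {seq ε i} {η} {e} {r} {B} (ℚ.<⇒≤ 0<e) (ℚ.<⇒≤ 0<η) ηer≡1
        (e≤ i (ℕ.m⊔n≤o⇒m≤o I (L ℕ.⊔ K) I⊔≤i)) (r≤ (suc n) (ℕ.≤-trans (ℕ.n≤1+n N) N<n))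
        (ℕ.≤-trans (ℕ.s≤s ℕ.z≤n) I<i)
        (ℚ.≤-trans (Q.p≤∣p∣ _) (b≤B i (ℕ.m⊔n≤o⇒m≤o L K L⊔≤i)))
        (ℚ.≤-trans (Q.p≤∣p∣ _) (tail≤1 (i ℕ.+ i) i (ℕ.≤-trans K≤i (ℕ.m≤m+n i i)) K≤i))

-- The recurrence

fromℕ-suc : ∀ n → Q.fromℕ (suc n) ≡ 1ℚ ℚ.+ Q.fromℕ n
fromℕ-suc = Q.fromℕ-+ 1

constant-small : ∀ x η → 0ℚ ℚ.< η → ∃ λ N → ∀ n → N ℕ.≤ n → ∣ x ∣ ≤ fromℚ (η ℚ.* Q.fromℕ (suc n))
constant-small x η 0<η =
  let A , 0<A , I , A≥ = ∣∣-bounded x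
      N , h            = Q.inv→0 A (ℚ.<⇒≤ 0<A) η 0<η
  in N , λ n N≤n → ≤-eventually I λ i I≤i → begin
  ℚ.∣ seq x i ∣
    ≤⟨ A≥ i I≤i ⟩
  A
    ≡⟨ trans (cong (A ℚ.*_) (Q.fromℕ-inv n)) (ℚ.*-identityʳ A) ⟨
  A ℚ.* (Q.fromℕ (suc n) ℚ.* Q.inv n)
    ≡⟨ solve 3 (λ a m v → a :* (m :* v) := a :* v :* m) refl A (Q.fromℕ (suc n)) (Q.inv n) ⟩
  A ℚ.* Q.inv n ℚ.* Q.fromℕ (suc n)
    ≤⟨ ℚ.*-monoʳ-≤-nonNeg (Q.fromℕ (suc n)) {{ℚ.nonNegative (Q.0≤fromℕ (suc n))}} (h n N≤n) ⟩
  η ℚ.* Q.fromℕ (suc n) ∎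

*-∣∣-≤ : ∀ {x y B p} N → 0ℚ ℚ.≤ B → (∀ i → N ℕ.≤ i → ℚ.∣ seq x i ∣ ℚ.≤ B) → ∣ y ∣ ≤ fromℚ p →
  x * ∣ y ∣ ≤ fromℚ (p ℚ.* B)
*-∣∣-≤ {x} {y} {B} {p} N 0≤B x≤B y≤p = ≤ℝ-trans {y = ∣ y ∣ * fromℚ B}
  (≤-eventually N λ i N≤i → subst (seq x i ℚ.* ℚ.∣ seq y i ∣ ℚ.≤_) (ℚ.*-comm B (ℚ.∣ seq y i ∣))
    (ℚ.*-monoʳ-≤-nonNeg (ℚ.∣ seq y i ∣) {{ℚ.∣-∣-nonNeg (seq y i)}} (ℚ.≤-trans (Q.p≤∣p∣ (seq x i)) (x≤B i N≤i))))
  (≤ℝ-trans (*-monoˡ-≤ {∣ y ∣} {fromℚ p} B 0≤B y≤p) (≤-pointwise λ _ → ℚ.≤-refl))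

scale-cancel : ∀ {B r} η n → 0ℚ ℚ.≤ η → B ℚ.* r ≡ 1ℚ →
  η ℚ.* r ℚ.* Q.fromℕ n ℚ.* B ℚ.≤ η ℚ.* Q.fromℕ (suc n)
scale-cancel {B} {r} η n 0≤η Br≡1 = begin
  η ℚ.* r ℚ.* Q.fromℕ n ℚ.* B
    ≡⟨ solve 4 (λ h r n b → h :* r :* n :* b := h :* n :* (b :* r)) refl η r (Q.fromℕ n) B ⟩
  η ℚ.* Q.fromℕ n ℚ.* (B ℚ.* r)
    ≡⟨ trans (cong (η ℚ.* Q.fromℕ n ℚ.*_) Br≡1) (ℚ.*-identityʳ (η ℚ.* Q.fromℕ n)) ⟩
  η ℚ.* Q.fromℕ n
    ≤⟨ ℚ.*-monoˡ-≤-nonNeg η {{ℚ.nonNegative 0≤η}} (Q.fromℕ-mono (ℕ.n≤1+n n)) ⟩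
  η ℚ.* Q.fromℕ (suc n) ∎

toll-add-constant : ∀ (T : ℕ → ℝ) a η n → let m = Q.fromℕ (suc n) in
  ∣ T n - a * fromℕ n ∣ ≤ fromℚ (½ ℚ.* η ℚ.* m) → ∣ a ∣ ≤ fromℚ (½ ℚ.* η ℚ.* m) →
  ∣ T n - a * fromℕ (suc n) ∣ ≤ fromℚ (η ℚ.* m)
toll-add-constant T a η n main const = ≤ℝ-trans {y = ∣ T n - a * fromℕ n ∣ + ∣ a ∣} (≤-pointwise λ i → begin
    ℚ.∣ seq (T n) i ℚ.- seq a i ℚ.* m ∣
      ≡⟨ cong (λ k → ℚ.∣ seq (T n) i ℚ.- seq a i ℚ.* k ∣) (fromℕ-suc n) ⟩
    ℚ.∣ seq (T n) i ℚ.- seq a i ℚ.* (1ℚ ℚ.+ Q.fromℕ n) ∣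
      ≡⟨ cong ℚ.∣_∣ (solve 3 (λ t a n → t :- a :* (con 1ℚ :+ n) := t :- a :* n :+ :- a) refl (seq (T n) i) (seq a i) (Q.fromℕ n)) ⟩
    ℚ.∣ seq (T n) i ℚ.- seq a i ℚ.* Q.fromℕ n ℚ.+ ℚ.- seq a i ∣
      ≤⟨ ℚ.∣p+q∣≤∣p∣+∣q∣ (seq (T n) i ℚ.- seq a i ℚ.* Q.fromℕ n) (ℚ.- seq a i) ⟩
    ℚ.∣ seq (T n) i ℚ.- seq a i ℚ.* Q.fromℕ n ∣ ℚ.+ ℚ.∣ ℚ.- seq a i ∣
      ≡⟨ cong (ℚ.∣ seq (T n) i ℚ.- seq a i ℚ.* Q.fromℕ n ∣ ℚ.+_) (ℚ.∣-p∣≡∣p∣ (seq a i)) ⟩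
    ℚ.∣ seq (T n) i ℚ.- seq a i ℚ.* Q.fromℕ n ∣ ℚ.+ ℚ.∣ seq a i ∣ ∎)
  (≤ℝ-trans (+ℝ-mono-≤ main const) (≤-pointwise λ _ → ℚ.≤-reflexive (solve 2 (λ h m → con ½ :* h :* m :+ con ½ :* h :* m := h :* m) refl η m)))
  where
  m : ℚ
  m = Q.fromℕ (suc n)

-- One half of η pays for the O-term, through `power-small` at η/(2B) with B a rational bound for
-- |C|; the other half pays for the constant a in passing from a n to a (n + 1), the form produced
-- by the exact identities.
toll-small : ∀ (T : ℕ → ℝ) a ε → 0ℝ < ε → (λ n → T n - a * fromℕ n) =O (λ n → n ^ (1ℝ - ε)) →
  ∀ η → 0ℚ ℚ.< η → ∃ λ N → ∀ n → N ℕ.≤ n → ∣ T n - a * fromℕ (suc n) ∣ ≤ fromℚ (η ℚ.* Q.fromℕ (suc n))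
toll-small T a ε 0<ε (C , N₀ , O) η 0<η =
  let B , 0<B , I , C≤B = ∣∣-bounded C
      r , 0<r , Br≡1    = Q.recip B 0<B
      N₁ , pow          = power-small ε 0<ε (½ ℚ.* η ℚ.* r) (Q.*-pos (half-pos 0<η) 0<r)
      N₂ , const        = constant-small a (½ ℚ.* η) (half-pos 0<η)
  in N₀ ℕ.⊔ (N₁ ℕ.⊔ N₂) , λ n N≤n →
  let N₁⊔N₂≤n = ℕ.m⊔n≤o⇒n≤o N₀ (N₁ ℕ.⊔ N₂) N≤n in
  toll-add-constant T a η n
    (≤ℝ-trans (O n (ℕ.m⊔n≤o⇒m≤o N₀ (N₁ ℕ.⊔ N₂) N≤n)) (≤ℝ-trans
      (*-∣∣-≤ {C} {n ^ (1ℝ - ε)} {B} {½ ℚ.* η ℚ.* r ℚ.* Q.fromℕ n} I (ℚ.<⇒≤ 0<B) C≤B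
        (pow n (ℕ.m⊔n≤o⇒m≤o N₁ N₂ N₁⊔N₂≤n)))
      (fromℚ-mono (scale-cancel {B} {r} (½ ℚ.* η) n (ℚ.<⇒≤ (half-pos 0<η)) Br≡1))))
    (const n (ℕ.m⊔n≤o⇒n≤o N₁ N₂ N₁⊔N₂≤n))

-- The recurrence of the error and its envelope

∣sum<∣≤ : ∀ n f → ℚ.∣ sum< n f ∣ ℚ.≤ sum< n (λ j → ℚ.∣ f j ∣)
∣sum<∣≤ zero    f = ℚ.≤-refl
∣sum<∣≤ (suc n) f = ℚ.≤-trans (ℚ.∣p+q∣≤∣p∣+∣q∣ (sum< n f) (f n)) (ℚ.+-monoˡ-≤ (ℚ.∣ f n ∣) (∣sum<∣≤ n f))

∣affine-sum<∣≤ : ∀ n (e f w : ℕ → ℚ) c τ → (∀ j → 0ℚ ℚ.≤ w j) →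
  ℚ.∣ τ ℚ.+ (sum< n (λ j → e j ℚ.* w j) ℚ.- c ℚ.* sum< n (λ j → f j ℚ.* w j)) ∣
    ℚ.≤ ℚ.∣ τ ∣ ℚ.+ sum< n (λ j → ℚ.∣ e j ℚ.- c ℚ.* f j ∣ ℚ.* w j)
∣affine-sum<∣≤ n e f w c τ 0≤w = begin
  ℚ.∣ τ ℚ.+ (sum< n (λ j → e j ℚ.* w j) ℚ.- c ℚ.* sum< n (λ j → f j ℚ.* w j)) ∣
    ≡⟨ cong (λ x → ℚ.∣ τ ℚ.+ x ∣) (difference n) ⟩
  ℚ.∣ τ ℚ.+ sum< n (λ j → (e j ℚ.- c ℚ.* f j) ℚ.* w j) ∣
    ≤⟨ ℚ.∣p+q∣≤∣p∣+∣q∣ τ _ ⟩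
  ℚ.∣ τ ∣ ℚ.+ ℚ.∣ sum< n (λ j → (e j ℚ.- c ℚ.* f j) ℚ.* w j) ∣
    ≤⟨ ℚ.+-monoʳ-≤ (ℚ.∣ τ ∣) (∣sum<∣≤ n _) ⟩
  ℚ.∣ τ ∣ ℚ.+ sum< n (λ j → ℚ.∣ (e j ℚ.- c ℚ.* f j) ℚ.* w j ∣)
    ≡⟨ cong (ℚ.∣ τ ∣ ℚ.+_) (sum<-cong n λ j → trans (ℚ.∣p*q∣≡∣p∣*∣q∣ (e j ℚ.- c ℚ.* f j) (w j))
         (cong (ℚ.∣ e j ℚ.- c ℚ.* f j ∣ ℚ.*_) (ℚ.0≤p⇒∣p∣≡p (0≤w j)))) ⟩
  ℚ.∣ τ ∣ ℚ.+ sum< n (λ j → ℚ.∣ e j ℚ.- c ℚ.* f j ∣ ℚ.* w j) ∎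
  where
  difference : ∀ n → sum< n (λ j → e j ℚ.* w j) ℚ.- c ℚ.* sum< n (λ j → f j ℚ.* w j)
    ≡ sum< n (λ j → (e j ℚ.- c ℚ.* f j) ℚ.* w j)
  difference zero    = solve 1 (λ c → con 0ℚ :- c :* con 0ℚ := con 0ℚ) refl c
  difference (suc n) = trans
    (solve 6 (λ s t c e f w → s :+ e :* w :- c :* (t :+ f :* w) := s :- c :* t :+ (e :- c :* f) :* w) refl
      (sum< n (λ j → e j ℚ.* w j)) (sum< n (λ j → f j ℚ.* w j)) c (e n) (f n) (w n))
    (cong (ℚ._+ (e n ℚ.- c ℚ.* f n) ℚ.* w n) (difference n))

0≤harmonicCost : ∀ n → 0ℚ ℚ.≤ harmonicCost n
0≤harmonicCost n = Q.*-nonneg (Q.0≤fromℕ (suc n)) (ℚ.≤-trans (ℚ.<⇒≤ Q.0<1) (1≤harmonic n))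

module Recurrence (t : Vec ℕ 3) (w : ℕ) (k≤w : size t ℕ.≤ w) (E T : ℕ → ℝ)
  (recurrence : ∀ n (w<n : w ℕ.< n) → E n ≃ T n + ∑< (n ℕ.∸ 1) (λ j →
    E j * fromℚ (∑₃ (λ r → ℙ t n (≤-trans k≤w (<⇒≤ w<n)) (λ J → lookup J r ≟ j)))))
  (a : ℝ) where

  c : ℝ
  c = _÷ℚ_ a (𝓗 t) {{𝓗-nonZero t}}

  -- Since 𝓗 is rational this is exact at every approximation index, so the main terms cancel
  -- without a limit.
  c*𝓗 : ∀ i → seq c i ℚ.* 𝓗 t ≡ seq a i
  c*𝓗 i = trans (ℚ.*-assoc (seq a i) ((ℚ.1/ 𝓗 t) {{𝓗-nonZero t}}) (𝓗 t))
    (trans (cong (seq a i ℚ.*_) (ℚ.*-inverseˡ (𝓗 t) {{𝓗-nonZero t}})) (ℚ.*-identityʳ (seq a i)))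

  error : ℕ → ℝ
  error n = E n - c * fromℚ (harmonicCost n)

  error-recurrence : ∀ n (w<n : w ℕ.< n) → ∣ error n ∣ ≤ ∣ T n - a * fromℕ (suc n) ∣ +
    ∑< (n ℕ.∸ 1) (λ j → ∣ error j ∣ * fromℚ (rate t n (ℕ.≤-trans k≤w (<⇒≤ w<n)) j))
  error-recurrence n w<n = ≤ℝ-trans (∣-∣-≤-cong (c * fromℚ (harmonicCost n)) (recurrence n w<n)) (≤-pointwise λ i →
    let eᵢ = λ j → seq (E j) i
        cᵢ = seq c i
        aᵢ = seq a i
        τᵢ = seq (T n) i
        S  = sum< (n ℕ.∸ 1) (λ j → eᵢ j ℚ.* W j)
        S′ = sum< (n ℕ.∸ 1) (λ j → harmonicCost j ℚ.* W j)
    in begin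
    ℚ.∣ τᵢ ℚ.+ seq (∑< (n ℕ.∸ 1) (λ j → E j * fromℚ (W j))) i ℚ.- cᵢ ℚ.* harmonicCost n ∣
      ≡⟨ cong₂ (λ x y → ℚ.∣ τᵢ ℚ.+ x ℚ.- cᵢ ℚ.* y ∣) (seq-∑< (n ℕ.∸ 1) (λ j → E j * fromℚ (W j)) i)
           (sym (sum-rate-harmonicCost t n k≤n)) ⟩
    ℚ.∣ τᵢ ℚ.+ S ℚ.- cᵢ ℚ.* (S′ ℚ.+ 𝓗 t ℚ.* m) ∣
      ≡⟨ cong ℚ.∣_∣ (solve 6 (λ τ s c s′ h m → τ :+ s :- c :* (s′ :+ h :* m) := τ :- c :* h :* m :+ (s :- c :* s′))
           refl τᵢ S cᵢ S′ (𝓗 t) m) ⟩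
    ℚ.∣ τᵢ ℚ.- cᵢ ℚ.* 𝓗 t ℚ.* m ℚ.+ (S ℚ.- cᵢ ℚ.* S′) ∣
      ≡⟨ cong (λ x → ℚ.∣ τᵢ ℚ.- x ℚ.* m ℚ.+ (S ℚ.- cᵢ ℚ.* S′) ∣) (c*𝓗 i) ⟩
    ℚ.∣ τᵢ ℚ.- aᵢ ℚ.* m ℚ.+ (S ℚ.- cᵢ ℚ.* S′) ∣
      ≤⟨ ∣affine-sum<∣≤ (n ℕ.∸ 1) eᵢ harmonicCost W cᵢ (τᵢ ℚ.- aᵢ ℚ.* m) (0≤rate t n k≤n) ⟩
    ℚ.∣ τᵢ ℚ.- aᵢ ℚ.* m ∣ ℚ.+ sum< (n ℕ.∸ 1) (λ j → ℚ.∣ eᵢ j ℚ.- cᵢ ℚ.* harmonicCost j ∣ ℚ.* W j)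
      ≡⟨ cong (ℚ.∣ τᵢ ℚ.- aᵢ ℚ.* m ∣ ℚ.+_) (seq-∑< (n ℕ.∸ 1) (λ j → ∣ error j ∣ * fromℚ (W j)) i) ⟨
    ℚ.∣ τᵢ ℚ.- aᵢ ℚ.* m ∣ ℚ.+ seq (∑< (n ℕ.∸ 1) (λ j → ∣ error j ∣ * fromℚ (W j))) i ∎)
    where
    k≤n : size t ℕ.≤ n
    k≤n = ℕ.≤-trans k≤w (<⇒≤ w<n)
    W : ℕ → ℚ
    W = rate t n k≤n
    m : ℚ
    m = Q.fromℕ (suc n)

  envelope : ℚ → ℚ → ℕ → ℚ
  envelope η K n = η ℚ.* harmonicCost n ℚ.+ K ℚ.* Q.fromℕ (suc n)

  -- The part K (n + 1) solves the recurrence with toll 0, so K can be chosen after η and N without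
  -- affecting the toll.
  envelope-recurrence : ∀ η K n k≤n →
    η ℚ.* 𝓗 t ℚ.* Q.fromℕ (suc n) ℚ.+ sum< (n ℕ.∸ 1) (λ j → envelope η K j ℚ.* rate t n k≤n j) ≡ envelope η K n
  envelope-recurrence η K n k≤n = begin-equality
    η ℚ.* 𝓗 t ℚ.* m ℚ.+ sum< L (λ j → envelope η K j ℚ.* W j)
      ≡⟨ cong (η ℚ.* 𝓗 t ℚ.* m ℚ.+_) (trans
           (sum<-cong L (λ j → solve 5 (λ h f k m w → (h :* f :+ k :* m) :* w := h :* (f :* w) :+ k :* (m :* w)) refl
             η (harmonicCost j) K (Q.fromℕ (suc j)) (W j)))
           (trans (sum<-+ L _ _) (cong₂ ℚ._+_ (sum<-*ˡ L η _) (sum<-*ˡ L K _)))) ⟩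
    η ℚ.* 𝓗 t ℚ.* m ℚ.+ (η ℚ.* S ℚ.+ K ℚ.* sum< L (λ j → Q.fromℕ (suc j) ℚ.* W j))
      ≡⟨ cong (λ x → η ℚ.* 𝓗 t ℚ.* m ℚ.+ (η ℚ.* S ℚ.+ K ℚ.* x)) (sum-rate-linear t n k≤n) ⟩
    η ℚ.* 𝓗 t ℚ.* m ℚ.+ (η ℚ.* S ℚ.+ K ℚ.* m)
      ≡⟨ solve 5 (λ h x m s k → h :* x :* m :+ (h :* s :+ k :* m) := h :* (s :+ x :* m) :+ k :* m) refl η (𝓗 t) m S K ⟩
    η ℚ.* (S ℚ.+ 𝓗 t ℚ.* m) ℚ.+ K ℚ.* m
      ≡⟨ cong (λ x → η ℚ.* x ℚ.+ K ℚ.* m) (sum-rate-harmonicCost t n k≤n) ⟩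
    envelope η K n ∎
    where
    L : ℕ
    L = n ℕ.∸ 1
    W : ℕ → ℚ
    W = rate t n k≤n
    m S : ℚ
    m = Q.fromℕ (suc n)
    S = sum< L (λ j → harmonicCost j ℚ.* W j)

  error-induction : ∀ η K N → 0ℚ ℚ.≤ η → 0ℚ ℚ.≤ K →
    (∀ n → N ℕ.≤ n → ∣ T n - a * fromℕ (suc n) ∣ ≤ fromℚ (η ℚ.* 𝓗 t ℚ.* Q.fromℕ (suc n))) →
    (∀ n → n ℕ.< N ℕ.⊔ suc w → ∣ error n ∣ ≤ fromℚ K) → ∀ n → ∣ error n ∣ ≤ fromℚ (envelope η K n)
  error-induction η K N 0≤η 0≤K small base = <-rec _ λ n ih → step n ih (n ℕ.<? N ℕ.⊔ suc w)
    where
    K≤ : ∀ n → K ℚ.≤ envelope η K n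
    K≤ n = ≤-by-gap (η ℚ.* harmonicCost n ℚ.+ K ℚ.* Q.fromℕ n)
      (ℚ.+-mono-≤ (Q.*-nonneg 0≤η (0≤harmonicCost n)) (Q.*-nonneg 0≤K (Q.0≤fromℕ n)))
      (trans (cong (λ m → η ℚ.* harmonicCost n ℚ.+ K ℚ.* m) (fromℕ-suc n))
        (solve 3 (λ x k n → x :+ k :* (con 1ℚ :+ n) := k :+ (x :+ k :* n)) refl (η ℚ.* harmonicCost n) K (Q.fromℕ n)))

    step : ∀ n → (∀ {j} → j ℕ.< n → ∣ error j ∣ ≤ fromℚ (envelope η K j)) → Dec (n ℕ.< N ℕ.⊔ suc w) →
      ∣ error n ∣ ≤ fromℚ (envelope η K n)
    step n ih (yes n<N) = ≤ℝ-trans (base n n<N) (fromℚ-mono (K≤ n))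
    -- From N ⊔ (w + 1) on, both the recurrence and the bound on the toll are available.
    step n ih (no  n≮N) = ≤ℝ-trans (error-recurrence n w<n) (≤ℝ-trans
      (+ℝ-mono-≤ (small n (ℕ.m⊔n≤o⇒m≤o N (suc w) N≤n)) (∑<-mono (n ℕ.∸ 1) {g = g} λ j j<n-1 →
        *-monoˡ-≤ (rate t n k≤n j) (0≤rate t n k≤n j) (ih (ℕ.<-≤-trans j<n-1 (ℕ.m∸n≤m n 1)))))
      (≤-pointwise λ i → ℚ.≤-reflexive (trans
        (cong (η ℚ.* 𝓗 t ℚ.* Q.fromℕ (suc n) ℚ.+_) (seq-∑< (n ℕ.∸ 1) g i))
        (envelope-recurrence η K n k≤n))))
      where
      N≤n : N ℕ.⊔ suc w ℕ.≤ n
      N≤n = ℕ.≮⇒≥ n≮N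
      w<n : w ℕ.< n
      w<n = ℕ.m⊔n≤o⇒n≤o N (suc w) N≤n
      k≤n : size t ℕ.≤ n
      k≤n = ℕ.≤-trans k≤w (<⇒≤ w<n)
      g : ℕ → ℝ
      g j = fromℚ (envelope η K j) * fromℚ (rate t n k≤n j)

  module _ (toll : ∀ η → 0ℚ ℚ.< η → ∃ λ N → ∀ n → N ℕ.≤ n →
      ∣ T n - a * fromℕ (suc n) ∣ ≤ fromℚ (η ℚ.* Q.fromℕ (suc n))) where

    error-bound : ∀ η → 0ℚ ℚ.< η → ∃ λ K → 0ℚ ℚ.≤ K × (∀ n → ∣ error n ∣ ≤ fromℚ (envelope η K n))
    error-bound η 0<η =
      let N , small      = toll (η ℚ.* 𝓗 t) (Q.*-pos 0<η (𝓗-positive t))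
          K , 0≤K , base = ∣∣-bounded-below error (N ℕ.⊔ suc w)
      in K , 0≤K , error-induction η K N (ℚ.<⇒≤ 0<η) 0≤K small base

-- From (n + 1) H_{n+1} to n ln n

harmonicCost-suc : ∀ n → harmonicCost n ≡ (1ℚ ℚ.+ Q.fromℕ n) ℚ.* harmonic n ℚ.+ 1ℚ
harmonicCost-suc n = begin-equality
  Q.fromℕ (suc n) ℚ.* (harmonic n ℚ.+ Q.inv n)
    ≡⟨ ℚ.*-distribˡ-+ (Q.fromℕ (suc n)) (harmonic n) (Q.inv n) ⟩
  Q.fromℕ (suc n) ℚ.* harmonic n ℚ.+ Q.fromℕ (suc n) ℚ.* Q.inv n
    ≡⟨ cong₂ (λ x y → x ℚ.* harmonic n ℚ.+ y) (fromℕ-suc n) (Q.fromℕ-inv n) ⟩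
  (1ℚ ℚ.+ Q.fromℕ n) ℚ.* harmonic n ℚ.+ 1ℚ ∎

-- With m = n + 1, the difference is (m + 1) H_m + 1 - m ln m. From H_m - 1 ≤ ln m ≤ H_m it lies
-- between 0 and m + H_m + 1, and H_m ≤ m.
harmonicCost-ln : ∀ n i → let m = Q.fromℕ (suc n) in
  ℚ.∣ harmonicCost (suc n) ℚ.- m ℚ.* lnSum (suc n) i ∣ ℚ.≤ m ℚ.+ m ℚ.+ 1ℚ
harmonicCost-ln n i = subst (λ F → ℚ.∣ F ℚ.- m ℚ.* l ∣ ℚ.≤ m ℚ.+ m ℚ.+ 1ℚ) (sym (harmonicCost-suc (suc n)))
  (subst (ℚ._≤ m ℚ.+ m ℚ.+ 1ℚ) (sym (ℚ.0≤p⇒∣p∣≡p lower)) upper)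
  where
  m h l : ℚ
  m = Q.fromℕ (suc n)
  h = harmonic (suc n)
  l = lnSum (suc n) i
  0≤m = Q.0≤fromℕ (suc n)
  lower : 0ℚ ℚ.≤ (1ℚ ℚ.+ m) ℚ.* h ℚ.+ 1ℚ ℚ.- m ℚ.* l
  lower = ≤-by-gap (m ℚ.* (h ℚ.- l) ℚ.+ h ℚ.+ 1ℚ)
    (ℚ.+-mono-≤ (ℚ.+-mono-≤ (Q.*-nonneg 0≤m (Q.p≤q⇒0≤q-p (ℚ.≤-trans (lnSum-≤ n i) (harmonic-inc n))))
      (ℚ.≤-trans (ℚ.<⇒≤ Q.0<1) (1≤harmonic n))) (ℚ.<⇒≤ Q.0<1))
    (solve 3 (λ m h l → (con 1ℚ :+ m) :* h :+ con 1ℚ :- m :* l := con 0ℚ :+ (m :* (h :- l) :+ h :+ con 1ℚ)) refl m h l)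
  upper : (1ℚ ℚ.+ m) ℚ.* h ℚ.+ 1ℚ ℚ.- m ℚ.* l ℚ.≤ m ℚ.+ m ℚ.+ 1ℚ
  upper = ≤-by-gap (m ℚ.* (l ℚ.- (h ℚ.- 1ℚ)) ℚ.+ (m ℚ.- h))
    (ℚ.+-mono-≤ (Q.*-nonneg 0≤m (Q.p≤q⇒0≤q-p (lnSum-≥ n i))) (Q.p≤q⇒0≤q-p (harmonic-≤ (suc n))))
    (solve 3 (λ m h l → m :+ m :+ con 1ℚ
      := (con 1ℚ :+ m) :* h :+ con 1ℚ :- m :* l :+ (m :* (l :- (h :- con 1ℚ)) :+ (m :- h))) refl m h l)

-- What η (H_m - 1) must exceed in `envelope-≤`: estimate H_m ≤ m and 1 ≤ m in the lower-order terms
-- there, then divide by m.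
margin : ℚ → ℚ → ℚ → ℚ
margin η K B = η ℚ.+ η ℚ.+ η ℚ.+ (K ℚ.+ K) ℚ.+ (B ℚ.+ B ℚ.+ B)

envelope-≤ : ∀ {η K B} n → 0ℚ ℚ.≤ η → 0ℚ ℚ.≤ K → 0ℚ ℚ.≤ B →
  margin η K B ℚ.≤ η ℚ.* (harmonic (suc n) ℚ.- 1ℚ) →
  let m = Q.fromℕ (suc n) in
  η ℚ.* harmonicCost (suc n) ℚ.+ K ℚ.* Q.fromℕ (suc (suc n)) ℚ.+ B ℚ.* (m ℚ.+ m ℚ.+ 1ℚ)
    ℚ.≤ (η ℚ.+ η) ℚ.* (m ℚ.* (harmonic (suc n) ℚ.- 1ℚ))
envelope-≤ {η} {K} {B} n 0≤η 0≤K 0≤B G≤ =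
  subst₂ (λ F k → η ℚ.* F ℚ.+ K ℚ.* k ℚ.+ B ℚ.* (m ℚ.+ m ℚ.+ 1ℚ) ℚ.≤ (η ℚ.+ η) ℚ.* (m ℚ.* (h ℚ.- 1ℚ)))
    (sym (harmonicCost-suc (suc n))) (sym (fromℕ-suc (suc n)))
    -- The summands are the slacks in the hypothesis on `margin`, in H_m ≤ m and in 1 ≤ m.
    (≤-by-gap (m ℚ.* (η ℚ.* (h ℚ.- 1ℚ) ℚ.- margin η K B)
        ℚ.+ η ℚ.* (m ℚ.- h) ℚ.+ (η ℚ.+ K ℚ.+ B) ℚ.* (m ℚ.- 1ℚ))
      (ℚ.+-mono-≤ (ℚ.+-mono-≤ (Q.*-nonneg (Q.0≤fromℕ (suc n)) (Q.p≤q⇒0≤q-p G≤))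
          (Q.*-nonneg 0≤η (Q.p≤q⇒0≤q-p (harmonic-≤ (suc n)))))
        (Q.*-nonneg (ℚ.+-mono-≤ (ℚ.+-mono-≤ 0≤η 0≤K) 0≤B) (Q.p≤q⇒0≤q-p (Q.fromℕ-mono {1} {suc n} (ℕ.s≤s ℕ.z≤n)))))
      (solve 5 (λ η K B m h → (η :+ η) :* (m :* (h :- con 1ℚ))
        := η :* ((con 1ℚ :+ m) :* h :+ con 1ℚ) :+ K :* (con 1ℚ :+ m) :+ B :* (m :+ m :+ con 1ℚ)
          :+ (m :* (η :* (h :- con 1ℚ) :- (η :+ η :+ η :+ (K :+ K) :+ (B :+ B :+ B)))
            :+ η :* (m :- h) :+ (η :+ K :+ B) :* (m :- con 1ℚ))) refl η K B m h))
  where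
  m h : ℚ
  m = Q.fromℕ (suc n)
  h = harmonic (suc n)

-- Triangle inequality through c F, where F is (m + 1) H_{m+1} and m = n + 1. Both errors fit into
-- 2η m (H_m - 1) for η = d/2, and then d ≤ δ and H_m - 1 ≤ ln m. Here r = 1/η, so the hypothesis on
-- H_m says that η (H_m - 1) reaches the margin.
nlnn-error : ∀ {E : ℕ → ℝ} {c δ d B K r} n M I → 0ℚ ℚ.< d → 0ℚ ℚ.< B → 0ℚ ℚ.≤ K →
  (∀ i → I ℕ.≤ i → d ℚ.≤ seq δ i) → (∀ i → M ℕ.≤ i → ℚ.∣ seq c i ∣ ℚ.≤ B) →
  ½ ℚ.* d ℚ.* r ≡ 1ℚ → 1ℚ ℚ.+ margin (½ ℚ.* d) K B ℚ.* r ℚ.≤ harmonic (suc n) →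
  ∣ E (suc n) - c * fromℚ (harmonicCost (suc n)) ∣
    ≤ fromℚ (½ ℚ.* d ℚ.* harmonicCost (suc n) ℚ.+ K ℚ.* Q.fromℕ (suc (suc n))) →
  ∣ E (suc n) - c * (fromℕ (suc n) * ln (suc n)) ∣ ≤ δ * ∣ fromℕ (suc n) * ln (suc n) ∣
nlnn-error {E} {c} {δ} {d} {B} {K} {r} n M I 0<d 0<B 0≤K d≤ c≤B ηr≡1 h≥ env = ≤ℝ-trans {y = ∣ E (suc n) - c * fromℚ F ∣ + fromℚ R} (≤-eventually M λ i M≤i → begin
    ℚ.∣ seq (E (suc n)) i ℚ.- seq c i ℚ.* (m ℚ.* l i) ∣
      ≡⟨ cong ℚ.∣_∣ (solve 4 (λ e c f x → e :- c :* x := (e :- c :* f) :+ c :* (f :- x)) refl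
           (seq (E (suc n)) i) (seq c i) F (m ℚ.* l i)) ⟩
    ℚ.∣ (seq (E (suc n)) i ℚ.- seq c i ℚ.* F) ℚ.+ seq c i ℚ.* (F ℚ.- m ℚ.* l i) ∣
      ≤⟨ ℚ.∣p+q∣≤∣p∣+∣q∣ (seq (E (suc n)) i ℚ.- seq c i ℚ.* F) (seq c i ℚ.* (F ℚ.- m ℚ.* l i)) ⟩
    ℚ.∣ seq (E (suc n)) i ℚ.- seq c i ℚ.* F ∣ ℚ.+ ℚ.∣ seq c i ℚ.* (F ℚ.- m ℚ.* l i) ∣
      ≤⟨ ℚ.+-monoʳ-≤ (ℚ.∣ seq (E (suc n)) i ℚ.- seq c i ℚ.* F ∣) (∣product∣≤ (c≤B i M≤i) (harmonicCost-ln n i)) ⟩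
    ℚ.∣ seq (E (suc n)) i ℚ.- seq c i ℚ.* F ∣ ℚ.+ R ∎)
  (≤ℝ-trans (+ℝ-mono-≤ {u = fromℚ R} env (fromℚ-mono (ℚ.≤-refl {R}))) (≤-eventually I λ i I≤i → begin
    η ℚ.* F ℚ.+ K ℚ.* Q.fromℕ (suc (suc n)) ℚ.+ R
      ≤⟨ envelope-≤ n 0≤η 0≤K (ℚ.<⇒≤ 0<B) G≤ ⟩
    (η ℚ.+ η) ℚ.* (m ℚ.* (h ℚ.- 1ℚ))
      ≡⟨ cong (ℚ._* (m ℚ.* (h ℚ.- 1ℚ))) (halves d) ⟩
    d ℚ.* (m ℚ.* (h ℚ.- 1ℚ))
      ≤⟨ Q.*-mono (ℚ.<⇒≤ 0<d) (ℚ.0≤∣p∣ (m ℚ.* l i)) (d≤ i I≤i) (ℚ.≤-trans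
           (ℚ.*-monoˡ-≤-nonNeg m {{ℚ.nonNegative (Q.0≤fromℕ (suc n))}} (lnSum-≥ n i)) (Q.p≤∣p∣ (m ℚ.* l i))) ⟩
    seq δ i ℚ.* ℚ.∣ m ℚ.* l i ∣ ∎))
  where
  η G m h F R : ℚ
  η = ½ ℚ.* d
  G = margin η K B
  m = Q.fromℕ (suc n)
  h = harmonic (suc n)
  F = harmonicCost (suc n)
  R = B ℚ.* (m ℚ.+ m ℚ.+ 1ℚ)
  0≤η : 0ℚ ℚ.≤ η
  0≤η = ℚ.<⇒≤ (half-pos 0<d)
  l : ℕ → ℚ
  l = lnSum (suc n)
  G≤ : G ℚ.≤ η ℚ.* (h ℚ.- 1ℚ)
  G≤ = begin
    G
      ≡⟨ trans (cong (G ℚ.*_) ηr≡1) (ℚ.*-identityʳ G) ⟨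
    G ℚ.* (η ℚ.* r)
      ≡⟨ solve 3 (λ g e r → g :* (e :* r) := e :* (con 1ℚ :+ g :* r :- con 1ℚ)) refl G η r ⟩
    η ℚ.* (1ℚ ℚ.+ G ℚ.* r ℚ.- 1ℚ)
      ≤⟨ ℚ.*-monoˡ-≤-nonNeg η {{ℚ.nonNegative 0≤η}} (ℚ.+-monoˡ-≤ (ℚ.- 1ℚ) h≥) ⟩
    η ℚ.* (h ℚ.- 1ℚ) ∎

nlnn-asymptotics : ∀ (E : ℕ → ℝ) c →
  (∀ η → 0ℚ ℚ.< η → ∃ λ K → 0ℚ ℚ.≤ K × (∀ n →
    ∣ E n - c * fromℚ (harmonicCost n) ∣ ≤ fromℚ (η ℚ.* harmonicCost n ℚ.+ K ℚ.* Q.fromℕ (suc n)))) →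
  (λ n → E n - c * (fromℕ n * ln n)) =o (λ n → fromℕ n * ln n)
nlnn-asymptotics E c bound δ 0<δ =
  let d , 0<d , I , d≤  = >0⇒≥ 0<δ
      B , 0<B , M , c≤B = ∣∣-bounded c
      K , 0≤K , env     = bound (½ ℚ.* d) (half-pos 0<d)
      r , _ , ηr≡1      = Q.recip (½ ℚ.* d) (half-pos 0<d)
      N , h≥            = harmonic→∞ (1ℚ ℚ.+ margin (½ ℚ.* d) K B ℚ.* r)
  -- The successor excludes n = 0, where `ln` has its dummy value.
  in suc N , λ where
    (suc n) N<n → nlnn-error {E} {c} {δ} {d} {B} {K} {r} n M I 0<d 0<B 0≤K d≤ c≤B ηr≡1
      (h≥ (suc n) (ℕ.≤-trans (ℕ.n≤1+n N) N<n)) (env (suc n))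

-- Asymptotic equivalence for a leading coefficient apart from 0

#0⇒∣∣≥ : ∀ {x} → x # 0ℝ → ∃ λ e → 0ℚ ℚ.< e × ∃ λ N → ∀ n → N ℕ.≤ n → e ℚ.≤ ℚ.∣ seq x n ∣
#0⇒∣∣≥ {x} (inj₁ (mk< (e , 0<e , N , h))) = e , 0<e , N , λ n N≤n → begin
  e                             ≡⟨ solve 2 (λ x e → e := x :+ e :+ :- x) refl (seq x n) e ⟩
  seq x n ℚ.+ e ℚ.+ ℚ.- seq x n ≤⟨ ℚ.+-monoˡ-≤ (ℚ.- seq x n) (h n N≤n) ⟩
  0ℚ ℚ.+ ℚ.- seq x n            ≡⟨ ℚ.+-identityˡ (ℚ.- seq x n) ⟩
  ℚ.- seq x n                   ≤⟨ Q.p≤∣p∣ (ℚ.- seq x n) ⟩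
  ℚ.∣ ℚ.- seq x n ∣             ≡⟨ ℚ.∣-p∣≡∣p∣ (seq x n) ⟩
  ℚ.∣ seq x n ∣                 ∎
#0⇒∣∣≥ {x} (inj₂ 0<x) = let e , 0<e , N , h = >0⇒≥ 0<x in e , 0<e , N , λ n N≤n → ℚ.≤-trans (h n N≤n) (Q.p≤∣p∣ (seq x n))

-- Apply the hypothesis to δ |c|, which is positive.
=o-scale : ∀ {f g} c → 0ℝ < ∣ c ∣ → f =o g → f =o (λ n → c * g n)
=o-scale {f} {g} c 0<∣c∣ f=og δ 0<δ =
  let d , 0<d , I , d≤ = >0⇒≥ 0<δ
      e , 0<e , J , e≤ = >0⇒≥ 0<∣c∣
      N , h            = f=og (δ * ∣ c ∣) (mk< (d ℚ.* e , Q.*-pos 0<d 0<e , I ℕ.⊔ J , λ i ≤i →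
        let d≤δ = d≤ i (ℕ.m⊔n≤o⇒m≤o I J ≤i) in subst (ℚ._≤ seq δ i ℚ.* ℚ.∣ seq c i ∣) (sym (ℚ.+-identityˡ (d ℚ.* e)))
          (Q.*-mono (ℚ.<⇒≤ 0<d) (ℚ.0≤∣p∣ (seq c i)) d≤δ (e≤ i (ℕ.m⊔n≤o⇒n≤o I J ≤i)))))
  in N , λ n N≤n → ≤ℝ-trans (h n N≤n) (≤-pointwise λ i → ℚ.≤-reflexive (trans
    (ℚ.*-assoc (seq δ i) (ℚ.∣ seq c i ∣) (ℚ.∣ seq (g n) i ∣))
    (cong (seq δ i ℚ.*_) (sym (ℚ.∣p*q∣≡∣p∣*∣q∣ (seq c i) (seq (g n) i))))))

-- If |y| ≥ e eventually, then |x| = |y|/q ≥ e/q. It carries apartness from a over to c = a/𝓗.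
∣∣-pos-of-product : ∀ {x y} q → 0ℚ ℚ.< q → (∀ i → seq x i ℚ.* q ≡ seq y i) → y # 0ℝ → 0ℝ < ∣ x ∣
∣∣-pos-of-product {x} {y} q 0<q xq≡y y#0 =
  let e , 0<e , N , e≤ = #0⇒∣∣≥ {y} y#0
      r , 0<r , qr≡1   = Q.recip q 0<q
  in mk< (e ℚ.* r , Q.*-pos 0<e 0<r , N , λ i N≤i → begin
    0ℚ ℚ.+ e ℚ.* r
      ≡⟨ ℚ.+-identityˡ (e ℚ.* r) ⟩
    e ℚ.* r
      ≤⟨ ℚ.*-monoʳ-≤-nonNeg r {{ℚ.nonNegative (ℚ.<⇒≤ 0<r)}} (e≤ i N≤i) ⟩
    ℚ.∣ seq y i ∣ ℚ.* r
      ≡⟨ cong (ℚ._* r) (trans (cong ℚ.∣_∣ (sym (xq≡y i))) (trans (ℚ.∣p*q∣≡∣p∣*∣q∣ (seq x i) q)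
           (cong (ℚ.∣ seq x i ∣ ℚ.*_) (ℚ.0≤p⇒∣p∣≡p (ℚ.<⇒≤ 0<q))))) ⟩
    ℚ.∣ seq x i ∣ ℚ.* q ℚ.* r
      ≡⟨ trans (ℚ.*-assoc (ℚ.∣ seq x i ∣) q r) (trans (cong (ℚ.∣ seq x i ∣ ℚ.*_) qr≡1) (ℚ.*-identityʳ _)) ⟩
    ℚ.∣ seq x i ∣ ∎)

theorem6p2 : (t : Vec ℕ 3) (w : ℕ) (k≤w : size t ℕ.≤ w) (E T : ℕ → ℝ) →
    (∀ n (w<n : w ℕ.< n) →
    E n ≃ T n + ∑< (n ℕ.∸ 1) (λ j →
    E j * fromℚ (∑₃ (λ r → ℙ t n (≤-trans k≤w (<⇒≤ w<n)) (λ J → lookup J r ≟ j))))) →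
    (a ε : ℝ) → 0ℝ < ε →
    (λ n → T n - a * fromℕ n) =O (λ n → n ^ (1ℝ - ε)) →
    let c = _÷ℚ_ a (𝓗 t) {{𝓗-nonZero t}} in
    (a # 0ℝ → E ∼ (λ n → c * (fromℕ n * ln n)))
    × (λ n → E n - c * (fromℕ n * ln n)) =o (λ n → fromℕ n * ln n)
theorem6p2 t w k≤w E T recurrence a ε 0<ε O =
  -- If a were 0, `∼` would force E n to be 0 eventually; the estimate relative to n ln n covers
  -- every a, and apartness allows dividing by |c|.
  (λ a#0 → =o-scale c (∣∣-pos-of-product {c} {a} (𝓗 t) (𝓗-positive t) c*𝓗 a#0) E=o) , E=o
  where
  open Recurrence t w k≤w E T recurrence a
  E=o : (λ n → E n - c * (fromℕ n * ln n)) =o (λ n → fromℕ n * ln n)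
  E=o = nlnn-asymptotics E c (error-bound (toll-small T a ε 0<ε O))
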